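{- There exists a kernelization that reduces instances $(G,k)$ of the problem Edge Clique Cover, where $G$ has $n$ vertices, to a kernel with at most $2^k$ nodes. The length of the data reduction chain is $O\big(\log_{1+\frac{1}{2^{k}-1}}(n)\big)$. The soundness of each reduction step can be witnessed by polynomial size Frege proofs. Consequently, for fixed $k$, negative instances $(G,k)$ of Edge Clique Cover have extended Frege proofs of polynomial size and Frege proofs of quasipolynomial size in $|\Phi_{G,k}|$ (proofs of the unsatisfiability of $\Phi_{G,k}$).
   Context: Edge Clique Cover: given a graph $G=(V,E)$ and an integer $k$ (the parameter), decide whether there are $V_1,\ldots,V_k\subseteq V$, each inducing a clique, such that for every edge $(v,w)\in E$ there is $i$ with $v,w\in V_i$. Negative instances are those where the answer is no. Propositional translation $\Phi_{G,k}$: variables $Y_{v,w}$ for distinct $v,w\in V$ and $X_{v,i}$ for $v\in V$, $1\le i\le k$ ("$v\in V_i$"). Clauses: unit clause $Y_{v,w}$ for edges and $\overline{Y_{v,w}}$ for non-edges; for distinct $v,w\in V$ and $1\le i\le k$, $\overline{X_{v,i}}\vee\overline{X_{w,i}}\vee Y_{v,w}$; for distinct $v,w$, $\overline{Y_{v,w}}\vee\bigvee_{j=1}^{k}(X_{v,j}\wedge X_{w,j})$, converted to CNF by expanding the disjunction. Proof systems. A Frege system is a sound and complete propositional proof system with finitely many axiom schemes and rules (all are polynomially equivalent; fix one whose only rule is modus ponens); extended Frege proofs may also introduce new variables as abbreviations for formulas. The length (size) of a proof is measured by the number of clauses in it. A proof for an unsatisfiable formula means a refutation. A function $f$ is quasipolynomial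 if $f(n)=O(2^{O(\log^{c} n)})$ for some $c>0$. Witnessing $\Phi_1\vdash\Phi_2$ by Frege proofs means: with disjoint variables $X,Y$ for $\Phi_1,\Phi_2$, there are substitutions $Y_i=\Xi_i[X]$ such that the clauses of $\Phi_2[Y]$, with the substitutions expanded, have a derivation from the clauses of $\Phi_1[X]$. Kernelization. A data reduction rule for a parameterized problem $L$ is an algorithm, polynomial time in $|x|+k$, mapping $(x,k)$ to $(x',k')$ with $(x,k)\in L\iff(x',k')\in L$ and $|x'|\le|x|$. A kernelization is a polynomial-time map to an equivalent instance (the kernel) of size bounded by a computable function of $k$; here it is obtained by applying finitely many data reduction rules as long as possible. A data reduction chain is the sequence of instances so obtained, its length being the number of steps. The soundness of the reduction steps is witnessed by Frege proofs of polynomial size if there are an integer $R\ge 1$ and a polynomial $h$ such that for every negative instance $(x,k)$ and each step $(x_i,k_i)\to(x_{i+1},k_{i+1})$ of its chain there are a tautology $\bigvee_{t=1}^{r}\Xi_{i,t}$ with $r\le R$ and formulas $\eta_{i,t}$ isomorphic (up to renaming) to $\Phi(x_{i+1},k_{i+1})$ such that this tautology and all implications $\Phi(x_i,k_i)\wedge\Xi_{i,t}\vdash\eta_{i,t}$ have Frege proofs of total size at most $h(|\Phi(x,k)|)$. -}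

module Defs where

open import Data.Bool using (Bool; true; false; if_then_else_)
open import Data.Fin using (Fin)
open import Data.Fin.Subset using (Subset)
import Data.Fin.Subset as Subset
open import Data.Fin.Properties using (_≟_)
open import Data.List using (List; []; _∷_; _++_; map; concatMap; foldr; length; filter; allFin; tabulate; cartesianProduct; cartesianProductWith)
open import Data.Nat.ListAction using (sum)
open import Data.List.Membership.Propositional using (_∈_; _∉_)
open import Data.List.Relation.Unary.All using (All)
open import Data.Nat using (ℕ; zero; suc; _+_; _*_; _^_; _≤_)
open import Data.Nat.Logarithm using (⌊log₂_⌋)
open import Data.Product using (Σ; Σ-syntax; ∃; ∃-syntax; _×_; _,_)
open import Data.Sum using (_⊎_; inj₁)
open import Data.Unit using (⊤)
open import Data.Vec using (Vec; lookup)
import Data.Vec as Vec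
open import Function.Bundles using (_⇔_)
open import Function.Definitions using (Injective)
open import Relation.Binary.PropositionalEquality using (_≡_; _≢_)
open import Relation.Nullary using (¬_)
open import Relation.Nullary.Decidable using (¬?)

infixr 5 _·_
infixr 4 _⇒_
infixr 6 _∨ᶠ_
infixr 7 _∧ᶠ_

-- Coefficients, constant term first.  Only upper bounds are ever taken, so
-- natural coefficients suffice.
Polynomial : Set
Polynomial = List ℕ

⟦_⟧ : Polynomial → ℕ → ℕ
⟦ p ⟧ n = foldr (λ a r → a + n * r) 0 p

-- f(n) = O(2^{O(log^c n)}) for some c > 0.  A real exponent can be rounded
-- up, and ⌊log₂ n⌋ differs from log₂ n by a factor of at most 2 for n ≥ 2.
Quasipolynomial : (ℕ → ℕ) → Set
Quasipolynomial f =
  ∃[ c ] (1 ≤ c × ∃[ A ] ∃[ B ] ∃[ N ] (∀ n → N ≤ n → f n ≤ A * 2 ^ (B * ⌊log₂ n ⌋ ^ c)))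

-- ℓ ≤ C · log_{1+1/m} n, for m, n ≥ 1: exponentiated to
-- (1 + 1/m)^ℓ ≤ n^C and multiplied by m^ℓ.
AtMostLog : (ℓ C m n : ℕ) → Set
AtMostLog ℓ C m n = suc m ^ ℓ ≤ n ^ C * m ^ ℓ

-- Model of computation: first-order recursive functional programs over
-- binary trees (the language F of N. Jones, "Computability and Complexity
-- from a Programming Perspective"), call by value, one time unit per
-- evaluated expression.  Trees can be shared, so every operation costs
-- constant time on a pointer machine.

data Tree : Set where
  nil : Tree
  _·_ : Tree → Tree → Tree

size : Tree → ℕ
size nil     = 1
size (a · b) = suc (size a + size b)

-- `ar f` is the arity of the f-th function; variables are de Bruijn indices.
data Expr {m : ℕ} (ar : Fin m → ℕ) (n : ℕ) : Set where
  var  : Fin n → Expr ar n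
  nil  : Expr ar n
  cons : Expr ar n → Expr ar n → Expr ar n
  case : Expr ar n → Expr ar n → Expr ar (2 + n) → Expr ar n
  call : (f : Fin m) → Vec (Expr ar n) (ar f) → Expr ar n

record Program : Set where
  field
    {functions} : ℕ
    arity       : Fin functions → ℕ
    body        : (f : Fin functions) → Expr arity (arity f)
    main        : Expr arity 1

module Semantics (P : Program) where
  open Program P

  mutual
    -- ρ ⊢ e ⇓ v ⟨ t ⟩: in environment ρ, e evaluates to v in t time units.
    data _⊢_⇓_⟨_⟩ {n : ℕ} (ρ : Vec Tree n) : Expr arity n → Tree → ℕ → Set where
      var : ∀ i → ρ ⊢ var i ⇓ lookup ρ i ⟨ 1 ⟩
      nil : ρ ⊢ nil ⇓ nil ⟨ 1 ⟩
      cons : ∀ {e₁ e₂ a b s t} → ρ ⊢ e₁ ⇓ a ⟨ s ⟩ → ρ ⊢ e₂ ⇓ b ⟨ t ⟩ →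
             ρ ⊢ cons e₁ e₂ ⇓ a · b ⟨ suc (s + t) ⟩
      case-nil : ∀ {e e₁ e₂ v s t} → ρ ⊢ e ⇓ nil ⟨ s ⟩ → ρ ⊢ e₁ ⇓ v ⟨ t ⟩ →
                 ρ ⊢ case e e₁ e₂ ⇓ v ⟨ suc (s + t) ⟩
      case-cons : ∀ {e e₁ e₂ a b v s t} → ρ ⊢ e ⇓ a · b ⟨ s ⟩ →
                  (a Vec.∷ b Vec.∷ ρ) ⊢ e₂ ⇓ v ⟨ t ⟩ →
                  ρ ⊢ case e e₁ e₂ ⇓ v ⟨ suc (s + t) ⟩
      call : ∀ {f es vs v s t} → ρ ⊢* es ⇓ vs ⟨ s ⟩ → vs ⊢ body f ⇓ v ⟨ t ⟩ →
             ρ ⊢ call f es ⇓ v ⟨ suc (s + t) ⟩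

    data _⊢*_⇓_⟨_⟩ {n : ℕ} (ρ : Vec Tree n) :
                   ∀ {l} → Vec (Expr arity n) l → Vec Tree l → ℕ → Set where
      [] : ρ ⊢* Vec.[] ⇓ Vec.[] ⟨ 0 ⟩
      _∷_ : ∀ {l e v s t} {es : Vec (Expr arity n) l} {vs : Vec Tree l} →
            ρ ⊢ e ⇓ v ⟨ s ⟩ → ρ ⊢* es ⇓ vs ⟨ t ⟩ →
            ρ ⊢* (e Vec.∷ es) ⇓ (v Vec.∷ vs) ⟨ s + t ⟩

Runs : Program → (input output : Tree) (time : ℕ) → Set
Runs P a b t = (a Vec.∷ Vec.[]) ⊢ Program.main P ⇓ b ⟨ t ⟩
  where open Semantics P

listCode : List Tree → Tree
listCode = foldr _·_ nil

bitCode : Bool → Tree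
bitCode b = if b then nil · nil else nil

-- Unary: a running time polynomial in |x|+k is polynomial in the input size.
numCode : ℕ → Tree
numCode zero    = nil
numCode (suc k) = nil · numCode k

Computable : (ℕ → ℕ) → Set
Computable g = Σ[ P ∈ Program ] (∀ k → ∃[ t ] Runs P (numCode k) (numCode (g k)) t)

record Graph (n : ℕ) : Set where
  field
    adj   : Fin n → Fin n → Bool
    sym   : ∀ v w → adj v w ≡ adj w v
    irref : ∀ v → adj v v ≡ false

Edge : ∀ {n} → Graph n → Fin n → Fin n → Set
Edge G v w = Graph.adj G v w ≡ true

Clique : ∀ {n} → Graph n → Subset n → Set
Clique G U = ∀ v w → v Subset.∈ U → w Subset.∈ U → v ≢ w → Edge G v w

EdgeCliqueCover : ∀ {n} → Graph n → ℕ → Set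
EdgeCliqueCover {n} G k =
  Σ[ V ∈ (Fin k → Subset n) ]
    (∀ i → Clique G (V i)) ×
    (∀ v w → Edge G v w → ∃[ i ] (v Subset.∈ V i × w Subset.∈ V i))

record Instance : Set where
  constructor ⟨_,_⟩
  field
    {order}   : ℕ
    graph     : Graph order
    parameter : ℕ

open Instance public

Positive Negative : Instance → Set
Positive x = EdgeCliqueCover (graph x) (parameter x)
Negative x = ¬ Positive x

graphCode : ∀ {n} → Graph n → Tree
graphCode G = listCode (tabulate λ v → listCode (tabulate λ w → bitCode (Graph.adj G v w)))

code : Instance → Tree
code x = graphCode (graph x) · numCode (parameter x)

-- |x| for an instance (x,k).
∣_∣ : Instance → ℕ
∣ x ∣ = size (graphCode (graph x))

PolynomialTime : (Instance → Instance) → Set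
PolynomialTime f =
  Σ[ P ∈ Program ] Σ[ p ∈ Polynomial ]
    (∀ x → ∃[ t ] (Runs P (code x) (code (f x)) t × t ≤ ⟦ p ⟧ (∣ x ∣ + parameter x)))

record DataReductionRule : Set where
  field
    reduce         : Instance → Instance
    polynomialTime : PolynomialTime reduce
    equivalent     : ∀ x → Positive x ⇔ Positive (reduce x)
    nonincreasing  : ∀ x → ∣ reduce x ∣ ≤ ∣ x ∣

open DataReductionRule public using (reduce)

-- Instances are compared through their codes, which avoids equality of
-- adjacency functions and of the proofs stored in a graph.
Applicable : DataReductionRule → Instance → Set
Applicable r x = code (reduce r x) ≢ code x

-- A chain only ends where no rule is applicable any more.
data Chain (rules : List DataReductionRule) : Instance → Instance → Set where
  exhausted : ∀ {x} → All (λ r → ¬ Applicable r x) rules → Chain rules x x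
  step : ∀ {x y} r → r ∈ rules → Applicable r x →
         Chain rules (reduce r x) y → Chain rules x y

chainLength : ∀ {rules x y} → Chain rules x y → ℕ
chainLength (exhausted _)  = 0
chainLength (step _ _ _ c) = suc (chainLength c)

AllSteps : ∀ {rules x y} → (Instance → Instance → Set) → Chain rules x y → Set
AllSteps P (exhausted _)      = ⊤
AllSteps P (step {x} r _ _ c) = P x (reduce r x) × AllSteps P c

record Kernelization : Set where
  field
    kernel         : Instance → Instance
    polynomialTime : PolynomialTime kernel
    equivalent     : ∀ x → Positive x ⇔ Positive (kernel x)
    bound          : ℕ → ℕ
    computable     : Computable bound
    bounded        : ∀ x → ∣ kernel x ∣ + parameter (kernel x) ≤ bound (parameter x)
    rules          : List DataReductionRule
    chain          : ∀ x → Chain rules x (kernel x)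

data Formula (V : Set) : Set where
  var            : V → Formula V
  ⊥ᶠ             : Formula V
  _⇒_ _∧ᶠ_ _∨ᶠ_  : Formula V → Formula V → Formula V

_[_] : ∀ {V W} → Formula V → (V → Formula W) → Formula W
var v    [ σ ] = σ v
⊥ᶠ       [ σ ] = ⊥ᶠ
(A ⇒ B)  [ σ ] = (A [ σ ]) ⇒ (B [ σ ])
(A ∧ᶠ B) [ σ ] = (A [ σ ]) ∧ᶠ (B [ σ ])
(A ∨ᶠ B) [ σ ] = (A [ σ ]) ∨ᶠ (B [ σ ])

vars : ∀ {V} → Formula V → List V
vars (var v)  = v ∷ []
vars ⊥ᶠ       = []
vars (A ⇒ B)  = vars A ++ vars B
vars (A ∧ᶠ B) = vars A ++ vars B
vars (A ∨ᶠ B) = vars A ++ vars B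

⋁ : ∀ {V} → List (Formula V) → Formula V
⋁ = foldr _∨ᶠ_ ⊥ᶠ

data Literal (V : Set) : Set where
  pos neg : V → Literal V

Clause CNF : Set → Set
Clause V = List (Literal V)
CNF V    = List (Clause V)

literalFormula : ∀ {V} → Literal V → Formula V
literalFormula (pos v) = var v
literalFormula (neg v) = var v ⇒ ⊥ᶠ

formulas : ∀ {V} → CNF V → List (Formula V)
formulas = map (λ C → ⋁ (map literalFormula C))

renameLiteral : ∀ {V W} → (V → W) → Literal V → Literal W
renameLiteral ρ (pos v) = pos (ρ v)
renameLiteral ρ (neg v) = neg (ρ v)

rename : ∀ {V W} → (V → W) → CNF V → CNF W
rename ρ = map (map (renameLiteral ρ))

IsomorphicTo : ∀ {V W} → CNF W → CNF V → Set
IsomorphicTo {V} {W} η Φ = Σ[ ρ ∈ (V → W) ] (Injective _≡_ _≡_ ρ × η ≡ rename ρ Φ)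

-- The diagonal variables Y v v exist but do not occur in Φ.
data Var (n k : ℕ) : Set where
  Y : (v w : Fin n) → Var n k
  X : (v : Fin n) (i : Fin k) → Var n k

-- CNF of ⋁ⱼ (aⱼ ∧ bⱼ): one clause per choice of a disjunct from each pair.
distribute : ∀ {V} → List (Literal V × Literal V) → CNF V
distribute []             = [] ∷ []
distribute ((a , b) ∷ ds) = cartesianProductWith _∷_ (a ∷ b ∷ []) (distribute ds)

distinctPairs : ∀ n → List (Fin n × Fin n)
distinctPairs n = filter (λ (v , w) → ¬? (v ≟ w)) (cartesianProduct (allFin n) (allFin n))

Φ : ∀ {n} → Graph n → (k : ℕ) → CNF (Var n k)
Φ {n} G k = concatMap clauses (distinctPairs n)
  where
  clauses : Fin n × Fin n → CNF (Var n k)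
  clauses (v , w) =
    ((if Graph.adj G v w then pos (Y v w) else neg (Y v w)) ∷ []) ∷
    (map (λ i → neg (X v i) ∷ neg (X w i) ∷ pos (Y v w) ∷ []) (allFin k) ++
     map (neg (Y v w) ∷_) (distribute (map (λ j → pos (X v j) , pos (X w j)) (allFin k))))

InstanceVar : Instance → Set
InstanceVar x = Var (order x) (parameter x)

Φᴵ : (x : Instance) → CNF (InstanceVar x)
Φᴵ x = Φ (graph x) (parameter x)

-- Sizes of formulas, like those of proofs below, are measured by the number
-- of clauses (lines).
∣Φ_∣ : Instance → ℕ
∣Φ x ∣ = length (Φᴵ x)

-- A complete set of schemes for classical logic with modus ponens;
-- negation is A ⇒ ⊥ᶠ.
data Axiom {V : Set} : Formula V → Set where
  weaken     : ∀ A B → Axiom (A ⇒ B ⇒ A)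
  compose    : ∀ A B C → Axiom ((A ⇒ B ⇒ C) ⇒ (A ⇒ B) ⇒ A ⇒ C)
  pair       : ∀ A B → Axiom (A ⇒ B ⇒ A ∧ᶠ B)
  first      : ∀ A B → Axiom (A ∧ᶠ B ⇒ A)
  second     : ∀ A B → Axiom (A ∧ᶠ B ⇒ B)
  left       : ∀ A B → Axiom (A ⇒ A ∨ᶠ B)
  right      : ∀ A B → Axiom (B ⇒ A ∨ᶠ B)
  cases      : ∀ A B C → Axiom ((A ⇒ C) ⇒ (B ⇒ C) ⇒ A ∨ᶠ B ⇒ C)
  stable     : ∀ A → Axiom (((A ⇒ ⊥ᶠ) ⇒ ⊥ᶠ) ⇒ A)

-- Proofs from hypotheses Γ, indexed by the list of their lines, last line
-- first.
data Frege {V : Set} (Γ : List (Formula V)) : List (Formula V) → Set where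
  start        : Frege Γ []
  hypothesis   : ∀ {Δ A} → A ∈ Γ → Frege Γ Δ → Frege Γ (A ∷ Δ)
  axiomatic    : ∀ {Δ A} → Axiom A → Frege Γ Δ → Frege Γ (A ∷ Δ)
  modus-ponens : ∀ {Δ A B} → (A ⇒ B) ∈ Δ → A ∈ Δ → Frege Γ Δ → Frege Γ (B ∷ Δ)

-- `extension` introduces q as an abbreviation for A.
data ExtendedFrege {V : Set} (Γ : List (Formula V)) : List (Formula V) → Set where
  start        : ExtendedFrege Γ []
  hypothesis   : ∀ {Δ A} → A ∈ Γ → ExtendedFrege Γ Δ → ExtendedFrege Γ (A ∷ Δ)
  axiomatic    : ∀ {Δ A} → Axiom A → ExtendedFrege Γ Δ → ExtendedFrege Γ (A ∷ Δ)
  modus-ponens : ∀ {Δ A B} → (A ⇒ B) ∈ Δ → A ∈ Δ → ExtendedFrege Γ Δ → ExtendedFrege Γ (B ∷ Δ)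
  extension    : ∀ {Δ} q A → q ∉ concatMap vars (A ∷ Δ ++ Γ) → ExtendedFrege Γ Δ →
                 ExtendedFrege Γ (((var q ⇒ A) ∧ᶠ (A ⇒ var q)) ∷ Δ)

-- A derivation from Γ, of size s, in which all of `goals` occur.
FregeDerivation : ∀ {V} (Γ goals : List (Formula V)) (s : ℕ) → Set
FregeDerivation Γ goals s = ∃[ Δ ] (Frege Γ Δ × All (_∈ Δ) goals × length Δ ≡ s)

FregeRefutation : ∀ {V} → CNF V → ℕ → Set
FregeRefutation Ψ s = FregeDerivation (formulas Ψ) (⊥ᶠ ∷ []) s

-- The summand ℕ supplies variables for abbreviations.
ExtendedFregeRefutation : ∀ {V} → CNF V → ℕ → Set
ExtendedFregeRefutation {V} Ψ s =
  ∃[ Δ ] (ExtendedFrege {V ⊎ ℕ} (formulas (rename inj₁ Ψ)) Δ × ⊥ᶠ ∈ Δ × length Δ ≡ s)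

-- Γ ⊢ Ψ: the variables of Ψ, disjoint from those of Γ by typing, are
-- replaced by formulas in the variables of Γ.
Witnessed : ∀ {V W} → List (Formula V) → CNF W → ℕ → Set
Witnessed {V} {W} Γ Ψ s =
  Σ[ σ ∈ (W → Formula V) ] FregeDerivation Γ (map (_[ σ ]) (formulas Ψ)) s

record StepCase (x x′ : Instance) : Set where
  field
    Ξ          : Formula (InstanceVar x)
    η          : CNF (InstanceVar x′)
    isomorphic : IsomorphicTo η (Φᴵ x′)
    caseSize   : ℕ
    witness    : Witnessed (Ξ ∷ formulas (Φᴵ x)) η caseSize

StepWitnessed : (R bound : ℕ) (x x′ : Instance) → Set
StepWitnessed R bound x x′ =
  Σ[ alternatives ∈ List (StepCase x x′) ] ∃[ s ]
    (length alternatives ≤ R ×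
     FregeDerivation [] (⋁ (map StepCase.Ξ alternatives) ∷ []) s ×
     s + sum (map StepCase.caseSize alternatives) ≤ bound)

SoundnessWitnessed : Kernelization → Set
SoundnessWitnessed K =
  ∃[ R ] (1 ≤ R × Σ[ h ∈ Polynomial ]
    (∀ x → Negative x → AllSteps (StepWitnessed R (⟦ h ⟧ ∣Φ x ∣)) (Kernelization.chain K x)))

{-# OPTIONS --safe #-}

-- Twins, vertices with the same closed neighbourhood, can share their cliques.
-- So isolated vertices and all but one vertex of every class of twins can be
-- deleted, except that a class which is a whole component keeps two vertices.
-- In a clique cover the remaining vertices get different subsets of [k], the
-- second vertices of components being given subsets that no other vertex can
-- have.  If more than 2^k vertices remain, the instance is thus negative and is
-- replaced by K₂ with parameter 0.
--
-- Deleting vertices only removes clauses from Φ.  In the other case Φ is refuted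
-- by Cook's proof of the pigeonhole principle.  As lines are counted, not
-- symbols, his substitutions can be composed without extension variables, and
-- the refutation is polynomial because Φ has at least 2^k clauses.
--
-- For fixed k, a negative instance either has too many classes, or its reduced
-- graph has at most 2^k vertices and a decision tree refutes it.  Both
-- refutations have a size depending only on k.

module Submission where

open import Defs
open import Data.Bool using (Bool; true; false; if_then_else_; not; _∧_; _∨_)
import Data.Bool.Properties as Bool
open import Data.Fin using (Fin; zero; suc; toℕ)
import Data.Fin as Fin
open import Data.Fin.Induction using (<-wellFounded; >-wellFounded)
import Data.Fin.Properties as Fin
import Data.Fin.Subset as Subset
open import Data.List using (List; []; _∷_; _++_; map; concatMap; length; filter; take; allFin; tabulate; cartesianProduct; cartesianProductWith)
import Data.List as List
open import Data.List.Membership.Propositional using (_∈_; lose; find)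
open import Data.List.Membership.Propositional.Properties
import Data.List.Properties as List
open import Data.List.Relation.Binary.Subset.Propositional using (_⊆_)
open import Data.List.Relation.Unary.All as All using (All; []; _∷_)
import Data.List.Relation.Unary.All.Properties as All
open import Data.List.Relation.Unary.AllPairs using (AllPairs; []; _∷_)
import Data.List.Relation.Unary.AllPairs.Properties as AllPairs
open import Data.List.Relation.Unary.Any using (here; there)
import Data.List.Relation.Unary.Any as Any
import Data.List.Relation.Unary.Any.Properties as Any
open import Data.List.Relation.Unary.Unique.Propositional using (Unique)
import Data.List.Relation.Unary.Unique.Propositional.Properties as Unique
open import Data.Nat
open import Data.Nat.Properties
open import Data.Nat.Tactic.RingSolver using (solve-∀)
open import Data.Product using (Σ-syntax; ∃-syntax; _×_; _,_; proj₁; proj₂)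
open import Data.Sum using (_⊎_; inj₁; inj₂)
open import Data.Unit using (tt)
open import Data.Vec using (Vec; []; _∷_)
import Data.Vec as Vec
import Data.Vec.Properties as Vec
open import Function using (_∘_; id; case_of_)
open import Function.Bundles using (_⇔_; mk⇔)
open import Induction.WellFounded using (Acc; acc)
open import Relation.Binary.Definitions using (tri<; tri≈; tri>)
open import Relation.Binary.PropositionalEquality hiding ([_])
open import Relation.Nullary using (¬_; Dec; yes; no; contradiction)
open import Relation.Nullary.Decidable using (True; does; map′; toWitness; ¬?; _×-dec_; _→-dec_)


-- Derivations measured by lines

-- A component must keep two vertices because a single one would become isolated and its clique
-- would be forgotten. But the two are twins and may lie in the same cliques, so comparing the sets
-- T(v) of cliques bounds the number of classes only, not the number of kept vertices; the
-- reassignment of subsets restores the bound 2^k. The counting argument is carried out once, as a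
-- Frege derivation. That too large instances are negative, which the equivalence of the reduction
-- rule needs, is read off from it by soundness. Discharging a hypothesis multiplies the number of
-- lines by five, so hypothetical reasoning must not be nested deeply. Long disjunctions are
-- eliminated through implications proved side by side, long arguments are chained by cuts, where
-- sizes add up, and only the decision tree nests without a fixed limit, to a depth bounded in terms
-- of k. A single rule makes all deletions at once and leaves instances with at most 2^k vertices
-- alone, so chains have at most one step. The large numerical constants are generous upper bounds
-- without further meaning.

infix 3 _⊢_within_ _⊩_within_

_⊢_within_ : ∀ {V} → List (Formula V) → List (Formula V) → ℕ → Set
Γ ⊢ Θ within s = ∃[ Δ ] (Frege Γ Δ × All (_∈ Δ) Θ × length Δ ≤ s)

_⊩_within_ : ∀ {V} → List (Formula V) → Formula V → ℕ → Set
Γ ⊩ A within s = Γ ⊢ A ∷ [] within s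

infixr 8 ¬ᶠ_

¬ᶠ_ : ∀ {V} → Formula V → Formula V
¬ᶠ A = A ⇒ ⊥ᶠ

-- The second proof is replayed on top of the first. A hypothesis that is already a line of the
-- first costs nothing, so the sizes add. Weakening, cut and juxtaposition of derivations are all
-- instances.
frege-cut : ∀ {V} {Γ Γ′ Δ Δ′ : List (Formula V)} → (∀ {A} → A ∈ Γ′ → A ∈ Δ ⊎ A ∈ Γ) →
            Frege Γ Δ → Frege Γ′ Δ′ →
            ∃[ Δ″ ] (Frege Γ Δ″ × Δ ⊆ Δ″ × Δ′ ⊆ Δ″ × length Δ″ ≤ length Δ′ + length Δ)
frege-cut f π start = _ , π , id , (λ ()) , ≤-refl
frege-cut f π (hypothesis A∈ ρ) with frege-cut f π ρ | f A∈
... | Δ″ , τ , i , j , l | inj₁ A∈Δ =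
  Δ″ , τ , i , (λ { (here refl) → i A∈Δ ; (there B∈) → j B∈ }) , m≤n⇒m≤1+n l
... | Δ″ , τ , i , j , l | inj₂ A∈Γ =
  _ , hypothesis A∈Γ τ , there ∘ i ,
  (λ { (here refl) → here refl ; (there B∈) → there (j B∈) }) , s≤s l
frege-cut f π (axiomatic a ρ) with frege-cut f π ρ
... | Δ″ , τ , i , j , l =
  _ , axiomatic a τ , there ∘ i ,
  (λ { (here refl) → here refl ; (there B∈) → there (j B∈) }) , s≤s l
frege-cut f π (modus-ponens x y ρ) with frege-cut f π ρ
... | Δ″ , τ , i , j , l =
  _ , modus-ponens (j x) (j y) τ , there ∘ i ,
  (λ { (here refl) → here refl ; (there B∈) → there (j B∈) }) , s≤s l

module _ {V : Set} where

  private variable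
    Γ Γ′ Θ Θ′ : List (Formula V)
    A B C D : Formula V
    s t u : ℕ

  relax : s ≤ t → Γ ⊢ Θ within s → Γ ⊢ Θ within t
  relax s≤t (Δ , π , g , l) = Δ , π , g , ≤-trans l s≤t

  -- For closed numerals: the comparison is decided during type checking, so derivations of constant
  -- size get a round bound without a count of their lines.
  relaxed : {_ : True (s ≤? t)} → Γ ⊢ Θ within s → Γ ⊢ Θ within t
  relaxed {_} {_} {_} {_} {p} = relax (toWitness p)

  weaken-⊢ : Γ ⊆ Γ′ → Γ ⊢ Θ within s → Γ′ ⊢ Θ within s
  weaken-⊢ sub (Δ , π , g , l) with frege-cut (inj₂ ∘ sub) start π
  ... | Δ″ , τ , _ , j , l″ =
    Δ″ , τ , All.map j g , ≤-trans l″ (≤-trans (≤-reflexive (+-identityʳ _)) l)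

  cut : Γ ⊢ Θ within s → Θ ++ Γ ⊢ Θ′ within t → Γ ⊢ Θ′ within t + s
  cut {Θ = Θ} (Δ , π , g , l) (Δ′ , π′ , g′ , l′) with frege-cut split π π′
    where
    split : ∀ {A} → A ∈ Θ ++ _ → A ∈ Δ ⊎ A ∈ _
    split A∈ with ∈-++⁻ Θ A∈
    ... | inj₁ A∈Θ = inj₁ (All.lookup g A∈Θ)
    ... | inj₂ A∈Γ = inj₂ A∈Γ
  ... | Δ″ , τ , _ , j , l″ = Δ″ , τ , All.map j g′ , ≤-trans l″ (+-mono-≤ l′ l)

  apply : Γ ⊢ Θ within s → Θ ⊢ Θ′ within t → Γ ⊢ Θ′ within t + s
  apply d e = cut d (weaken-⊢ ∈-++⁺ˡ e)

  ∅ : Γ ⊢ [] within 0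
  ∅ = [] , start , [] , z≤n

  infixr 5 _▹▹_ _▹_

  _▹▹_ : Γ ⊢ Θ within s → Γ ⊢ Θ′ within t → Γ ⊢ Θ ++ Θ′ within t + s
  (Δ , π , g , l) ▹▹ (Δ′ , π′ , g′ , l′) with frege-cut inj₂ π π′
  ... | Δ″ , τ , i , j , l″ =
    Δ″ , τ , All.++⁺ (All.map i g) (All.map j g′) , ≤-trans l″ (+-mono-≤ l′ l)

  _▹_ : Γ ⊩ A within s → Γ ⊢ Θ within t → Γ ⊢ A ∷ Θ within t + s
  _▹_ = _▹▹_

  each : All (λ A → Γ ⊩ A within s) Θ → Γ ⊢ Θ within length Θ * s
  each [] = ∅
  each {s = s} {Θ = _ ∷ Θ} (d ∷ ds) = relax (≤-reflexive (+-comm (length Θ * s) s)) (d ▹ each ds)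

  hyp : A ∈ Γ → Γ ⊩ A within 1
  hyp A∈ = _ , hypothesis A∈ start , here refl ∷ [] , ≤-refl

  h₀ : A ∷ Γ ⊩ A within 1
  h₀ = hyp (here refl)

  h₁ : B ∷ A ∷ Γ ⊩ A within 1
  h₁ = hyp (there (here refl))

  h₂ : C ∷ B ∷ A ∷ Γ ⊩ A within 1
  h₂ = hyp (there (there (here refl)))

  h₃ : D ∷ C ∷ B ∷ A ∷ Γ ⊩ A within 1
  h₃ = hyp (there (there (there (here refl))))

  ax : Axiom A → Γ ⊩ A within 1
  ax a = _ , axiomatic a start , here refl ∷ [] , ≤-refl

  ⇒E : Γ ⊩ A ⇒ B within s → Γ ⊩ A within t → Γ ⊩ B within suc (t + s)
  ⇒E d e with d ▹ e
  ... | Δ , π , x ∷ y ∷ [] , l = _ , modus-ponens x y π , here refl ∷ [] , s≤s l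

  -- The factor 5 comes from the five-line proof of `H ⇒ H`; every other line is replaced by three.
  deduction : ∀ H {Δ} → Frege (H ∷ Γ) Δ →
              ∃[ Δ′ ] (Frege Γ Δ′ × (∀ {A} → A ∈ Δ → (H ⇒ A) ∈ Δ′) × length Δ′ ≤ length Δ * 5)
  deduction H start = _ , start , (λ ()) , z≤n
  deduction H (hypothesis (here refl) π) with deduction H π
  ... | Δ′ , τ , f , l =
    _ , modus-ponens (there (here refl)) (here refl)
          (axiomatic (weaken H H)
            (modus-ponens (there (here refl)) (here refl)
              (axiomatic (weaken H (H ⇒ H)) (axiomatic (compose H (H ⇒ H) H) τ)))) ,
    (λ { (here refl) → here refl ; (there A∈) → there (there (there (there (there (f A∈))))) }) ,
    s≤s (s≤s (s≤s (s≤s (s≤s l))))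
  deduction H (hypothesis {A = A} (there A∈) π) with deduction H π
  ... | Δ′ , τ , f , l =
    _ , modus-ponens (here refl) (there (here refl)) (axiomatic (weaken A H) (hypothesis A∈ τ)) ,
    (λ { (here refl) → here refl ; (there A∈) → there (there (there (f A∈))) }) ,
    s≤s (s≤s (s≤s (m≤n⇒m≤1+n (m≤n⇒m≤1+n l))))
  deduction H (axiomatic {A = A} a π) with deduction H π
  ... | Δ′ , τ , f , l =
    _ , modus-ponens (here refl) (there (here refl)) (axiomatic (weaken A H) (axiomatic a τ)) ,
    (λ { (here refl) → here refl ; (there A∈) → there (there (there (f A∈))) }) ,
    s≤s (s≤s (s≤s (m≤n⇒m≤1+n (m≤n⇒m≤1+n l))))
  deduction H (modus-ponens {A = A} {B} x y π) with deduction H π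
  ... | Δ′ , τ , f , l =
    _ , modus-ponens (here refl) (there (there (f y)))
          (modus-ponens (here refl) (there (f x)) (axiomatic (compose H A B) τ)) ,
    (λ { (here refl) → here refl ; (there A∈) → there (there (there (f A∈))) }) ,
    s≤s (s≤s (s≤s (m≤n⇒m≤1+n (m≤n⇒m≤1+n l))))

  ⇒I : A ∷ Γ ⊩ B within s → Γ ⊩ A ⇒ B within s * 5
  ⇒I (Δ , π , x ∷ [] , l) with deduction _ π
  ... | Δ′ , τ , f , l′ = Δ′ , τ , f x ∷ [] , ≤-trans l′ (*-monoˡ-≤ 5 l)

  ∧I : Γ ⊩ A within s → Γ ⊩ B within t → Γ ⊩ A ∧ᶠ B within suc (t + suc (s + 1))
  ∧I d e = ⇒E (⇒E (ax (pair _ _)) d) e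

  ∧E₁ : Γ ⊩ A ∧ᶠ B within s → Γ ⊩ A within suc (s + 1)
  ∧E₁ = ⇒E (ax (first _ _))

  ∧E₂ : Γ ⊩ A ∧ᶠ B within s → Γ ⊩ B within suc (s + 1)
  ∧E₂ = ⇒E (ax (second _ _))

  ∨I₁ : Γ ⊩ A within s → Γ ⊩ A ∨ᶠ B within suc (s + 1)
  ∨I₁ = ⇒E (ax (left _ _))

  ∨I₂ : Γ ⊩ B within s → Γ ⊩ A ∨ᶠ B within suc (s + 1)
  ∨I₂ = ⇒E (ax (right _ _))

  ∨E : Γ ⊩ A ∨ᶠ B within u → A ∷ Γ ⊩ C within s → B ∷ Γ ⊩ C within t →
       Γ ⊩ C within suc (u + suc (t * 5 + suc (s * 5 + 1)))
  ∨E d e f = ⇒E (⇒E (⇒E (ax (cases _ _ _)) (⇒I e)) (⇒I f)) d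

  ⊥E : Γ ⊩ ⊥ᶠ within s → Γ ⊩ A within 4 + s
  ⊥E {s = s} d = relax (≤-reflexive (eq s)) (⇒E (ax (stable _)) (⇒E (ax (weaken _ _)) d))
    where
    eq : ∀ s → suc (suc (s + 1) + 1) ≡ 4 + s
    eq = solve-∀

  by-contradiction : ∀ A → ¬ᶠ A ∷ Γ ⊩ ⊥ᶠ within s → Γ ⊩ A within suc (s * 5 + 1)
  by-contradiction A d = ⇒E (ax (stable A)) (⇒I d)

  by-cases : ∀ A → A ∷ Γ ⊩ ⊥ᶠ within s → ¬ᶠ A ∷ Γ ⊩ ⊥ᶠ within t →
             Γ ⊩ ⊥ᶠ within suc (s * 5 + t * 5)
  by-cases A d e = ⇒E (⇒I e) (⇒I d)

  ⊤ᶠ : Formula V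
  ⊤ᶠ = ⊥ᶠ ⇒ ⊥ᶠ

  ⊤I : Γ ⊩ ⊤ᶠ within 5
  ⊤I = ⇒I h₀

  ⋁-intro : ∀ {L} → A ∈ L → Γ ⊩ A within s → Γ ⊩ ⋁ L within length L * 2 + s
  ⋁-intro {s = s} {L = _ ∷ L} (here refl) d = relax
    (≤-trans (≤-reflexive (trans (cong suc (+-comm s 1)) refl)) (s≤s (s≤s (m≤n+m s (length L * 2)))))
    (∨I₁ d)
  ⋁-intro {L = _ ∷ L} (there A∈) d = relax (≤-reflexive (cong suc (+-comm _ 1))) (∨I₂ (⋁-intro A∈ d))

  -- Taking implications instead of derivations under hypotheses keeps the size linear in the number
  -- of disjuncts: iterating `∨E` would multiply by five at each disjunct. The 25 pays for the empty
  -- disjunction.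
  ⋁-elim : ∀ {L} → All (λ A → Γ ⊩ A ⇒ B within s) L → Γ ⊩ ⋁ L ⇒ B within length L * (3 + s) + 25
  ⋁-elim [] = relaxed (⇒I (⊥E h₀))
  ⋁-elim {s = s} {L = A ∷ L} (d ∷ ds) = relax
    (≤-reflexive (eq s (length L * (3 + s))))
    (⇒E (⇒E (ax (cases _ _ _)) d) (⋁-elim ds))
    where
    eq : ∀ s r → suc (r + 25 + suc (s + 1)) ≡ 3 + s + r + 25
    eq = solve-∀

  ⋁-elim-map : ∀ {H : Set} {P : H → Formula V} {hs} → (∀ {h} → h ∈ hs → P h ∷ Γ ⊩ B within s) →
               Γ ⊩ ⋁ (map P hs) ⇒ B within length hs * (3 + s * 5) + 25
  ⋁-elim-map {s = s} {P = P} {hs} f = relax (≤-reflexive (cong (λ l → l * (3 + s * 5) + 25) (List.length-map P hs)))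
    (⋁-elim (All.map⁺ (All.tabulate (λ h∈ → ⇒I (f h∈)))))

  ⋁-intro-map : ∀ {H : Set} {P : H → Formula V} {hs h} → h ∈ hs → Γ ⊩ P h within s →
                Γ ⊩ ⋁ (map P hs) within length hs * 2 + s
  ⋁-intro-map {s = s} {P = P} {hs} h∈ d =
    relax (≤-reflexive (cong (λ l → l * 2 + s) (List.length-map P hs))) (⋁-intro (∈-map⁺ P h∈) d)

  ⋁-mono : ∀ {H : Set} {P Q : H → Formula V} {hs} → (∀ {h} → h ∈ hs → P h ∷ Γ ⊩ Q h within s) →
           Γ ⊩ ⋁ (map P hs) within t →
           Γ ⊩ ⋁ (map Q hs) within suc (t + (length hs * (3 + (length hs * 2 + s) * 5) + 25))
  ⋁-mono f = ⇒E (⋁-elim-map (λ h∈ → ⋁-intro-map h∈ (f h∈)))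

-- The pigeonhole principle

pairs : ∀ {A : Set} → List A → List (A × A)
pairs []       = []
pairs (p ∷ ps) = map (p ,_) ps ++ pairs ps

length-pairs : ∀ {A : Set} (ps : List A) → length (pairs ps) ≤ length ps * length ps
length-pairs [] = z≤n
length-pairs (p ∷ ps) = begin
  length (map (p ,_) ps ++ pairs ps)         ≡⟨ List.length-++ (map (p ,_) ps) ⟩
  length (map (p ,_) ps) + length (pairs ps) ≡⟨ cong (_+ _) (List.length-map (p ,_) ps) ⟩
  length ps + length (pairs ps)              ≤⟨ +-monoʳ-≤ (length ps) (length-pairs ps) ⟩
  length ps + length ps * length ps          ≤⟨ m≤n+m _ (suc (length ps)) ⟩
  suc (length ps) + (length ps + length ps * length ps) ≡⟨ eq (length ps) ⟩
  suc (length ps) * suc (length ps)          ∎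
  where
  open ≤-Reasoning
  eq : ∀ n → suc n + (n + n * n) ≡ suc n * suc n
  eq = solve-∀

head-pairs : ∀ {A : Set} {p q : A} {ps} → q ∈ ps → (p , q) ∈ pairs (p ∷ ps)
head-pairs q∈ = ∈-++⁺ˡ (∈-map⁺ _ q∈)

tail-pairs : ∀ {A : Set} {p : A} {z ps} → z ∈ pairs ps → z ∈ pairs (p ∷ ps)
tail-pairs {p = p} {ps = ps} z∈ = ∈-++⁺ʳ (map (p ,_) ps) z∈

pairs-∈ : ∀ {A : Set} {p q : A} ps → (p , q) ∈ pairs ps → p ∈ ps × q ∈ ps
pairs-∈ (r ∷ ps) pq∈ with ∈-++⁻ (map (r ,_) ps) pq∈
... | inj₂ pq∈′ = let (p∈ , q∈) = pairs-∈ ps pq∈′ in there p∈ , there q∈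
... | inj₁ pq∈′ with ∈-map⁻ (r ,_) pq∈′
... | _ , q∈ , refl = here refl , there q∈

length-cartesianProductWith : ∀ {A B C : Set} (f : A → B → C) xs ys →
                              length (cartesianProductWith f xs ys) ≡ length xs * length ys
length-cartesianProductWith f [] ys = refl
length-cartesianProductWith f (x ∷ xs) ys =
  trans (List.length-++ (map (f x) ys))
        (cong₂ _+_ (List.length-map (f x) ys) (length-cartesianProductWith f xs ys))

-- Reduces an inequality of polynomials to an equation, which is what the ring solver proves; `d` is
-- the difference of the two sides.
slack : ∀ {m n} d → m + d ≡ n → m ≤ n
slack {m} d refl = m≤m+n m d

module _ {V A B : Set} where

  totality : (A → B → Formula V) → List A → List B → List (Formula V)
  totality P ps hs = map (λ p → ⋁ (map (P p) hs)) ps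

  exclusivity : (A → B → Formula V) → List A → List B → List (Formula V)
  exclusivity P ps hs = cartesianProductWith (λ (p , q) h → P p h ⇒ P q h ⇒ ⊥ᶠ) (pairs ps) hs

  pigeonhole : (A → B → Formula V) → List A → List B → List (Formula V)
  pigeonhole P ps hs = totality P ps hs ++ exclusivity P ps hs

  -- Cook's reduction: pigeon p₀ and hole h₀ are removed, and whoever sits in
  -- h₀ moves to the hole of p₀.
  relocate : (A → B → Formula V) → A → B → A → B → Formula V
  relocate P p₀ h₀ p h = P p h ∨ᶠ (P p h₀ ∧ᶠ P p₀ h)

  module _ (P : A → B → Formula V) {p₀ : A} {ps : List A} {h₀′ : B} {hs : List B} where

    private
      Θ = pigeonhole P (p₀ ∷ ps) (h₀′ ∷ hs)
      b = length hs

      total : ∀ {p} → p ∈ p₀ ∷ ps → ⋁ (map (P p) (h₀′ ∷ hs)) ∈ Θ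
      total p∈ = ∈-++⁺ˡ {xs = totality P (p₀ ∷ ps) (h₀′ ∷ hs)} (∈-map⁺ (λ p → ⋁ (map (P p) (h₀′ ∷ hs))) p∈)

      exclusive : ∀ {p q h} → (p , q) ∈ pairs (p₀ ∷ ps) → h ∈ h₀′ ∷ hs → (P p h ⇒ P q h ⇒ ⊥ᶠ) ∈ Θ
      exclusive pq∈ h∈ = ∈-++⁺ʳ (totality P (p₀ ∷ ps) (h₀′ ∷ hs)) (∈-cartesianProductWith⁺ _ pq∈ h∈)

    -- If p sits in the removed hole, then p₀ does not, so p₀ has one of the other holes, and p
    -- inherits it.
    relocate-total : ∀ {p} → p ∈ ps →
                     Θ ⊩ ⋁ (map (relocate P p₀ h₀′ p) hs) within suc b * suc b * 2000
    relocate-total {p} p∈ = relax (slack (935 + b * 2960 + b * b * 1700) (eq b))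
      (∨E (hyp (total (there p∈)))
        (∨E (hyp (there (total (here refl))))
          (⊥E (⇒E (⇒E (hyp (there (there (exclusive (head-pairs {ps = ps} p∈) (here refl))))) h₀) h₁))
          (⋁-mono {hs = hs} (λ _ → ∨I₂ (∧I h₂ h₀)) h₀))
        (⋁-mono {hs = hs} (λ _ → ∨I₁ h₀) h₀))
      where
      eq : ∀ b → suc (1 + suc (suc (1 + (b * (3 + (b * 2 + 3) * 5) + 25)) * 5 +
                   suc (suc (1 + suc (suc (1 + (b * (3 + (b * 2 + 7) * 5) + 25)) * 5 + 47)) * 5 + 1)))
                 + (935 + b * 2960 + b * b * 1700) ≡ suc b * suc b * 2000
      eq = solve-∀

    relocate-exclusive : ∀ {p q h} → (p , q) ∈ pairs ps → h ∈ hs →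
                         Θ ⊩ relocate P p₀ h₀′ p h ⇒ relocate P p₀ h₀′ q h ⇒ ⊥ᶠ within 50000
    relocate-exclusive pq∈ h∈ = relaxed
      (apply
        -- One instance for each way in which p and q can have come to h: both were there, p was
        -- there and q took the hole of p₀ or conversely, or both moved out of the removed hole.
        -- Stating them first keeps the case analysis of constant size.
        (hyp (exclusive (tail-pairs {ps = ps} pq∈) (there h∈))
          ▹ hyp (exclusive (head-pairs {ps = ps} (proj₁ (pairs-∈ ps pq∈))) (there h∈))
          ▹ hyp (exclusive (head-pairs {ps = ps} (proj₂ (pairs-∈ ps pq∈))) (there h∈))
          ▹ hyp (exclusive (tail-pairs {ps = ps} pq∈) (here refl)) ▹ ∅)
        (⇒I (⇒I (∨E h₁
          (∨E h₁ (⇒E (⇒E (hyp (4+ here refl)) h₁) h₀)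
                 (⇒E (⇒E (hyp (4+ there (here refl))) (∧E₂ h₀)) h₁))
          (∨E h₁ (⇒E (⇒E (hyp (4+ there (there (here refl)))) (∧E₂ h₁)) h₀)
                 (⇒E (⇒E (hyp (4+ there (there (there (here refl))))) (∧E₁ h₁)) (∧E₁ h₀)))))))
      where
      4+_ : ∀ {A C D E F} {L : List (Formula V)} → A ∈ L → A ∈ C ∷ D ∷ E ∷ F ∷ L
      4+ x = there (there (there (there x)))

    relocate-pigeonhole : ∀ N → length hs < N → length ps ≤ N →
                          Θ ⊢ pigeonhole (relocate P p₀ h₀′) ps hs within N * N * N * 52000
    relocate-pigeonhole N b<N a≤N = relax bound
      (each (All.map⁺ (All.tabulate relocate-total)) ▹▹ each (All.tabulate exclusive′))
      where
      P′ = relocate P p₀ h₀′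
      exclusive′ : ∀ {F} → F ∈ exclusivity P′ ps hs → Θ ⊩ F within 50000
      exclusive′ F∈ with ∈-cartesianProductWith⁻ _ (pairs ps) hs F∈
      ... | _ , _ , pq∈ , h∈ , refl = relocate-exclusive pq∈ h∈
      open ≤-Reasoning
      bound : length (exclusivity P′ ps hs) * 50000 + length (totality P′ ps hs) * (suc b * suc b * 2000)
              ≤ N * N * N * 52000
      bound = begin
        length (exclusivity P′ ps hs) * 50000 + length (totality P′ ps hs) * (suc b * suc b * 2000)
          ≡⟨ cong₂ (λ x y → x * 50000 + y * (suc b * suc b * 2000))
               (length-cartesianProductWith _ (pairs ps) hs) (List.length-map _ ps) ⟩
        length (pairs ps) * b * 50000 + length ps * (suc b * suc b * 2000)
          ≤⟨ +-mono-≤ (*-monoˡ-≤ 50000 (*-mono-≤ (≤-trans (length-pairs ps) (*-mono-≤ a≤N a≤N)) (<⇒≤ b<N)))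
                      (*-mono-≤ a≤N (*-monoˡ-≤ 2000 (*-mono-≤ b<N b<N))) ⟩
        N * N * N * 50000 + N * (N * N * 2000)
          ≡⟨ eq N ⟩
        N * N * N * 52000 ∎
        where
        eq : ∀ N → N * N * N * 50000 + N * (N * N * 2000) ≡ N * N * N * 52000
        eq = solve-∀

  -- One round of relocation per hole. N bounds the initial number of pigeons and stays fixed, so
  -- that all rounds have the same cost.
  pigeonhole-refutation : ∀ (P : A → B → Formula V) ps hs N → length hs < length ps → length ps ≤ N →
                          pigeonhole P ps hs ⊩ ⊥ᶠ within length hs * (N * N * N * 52000) + 1
  -- Without holes, totality for the first pigeon is the empty disjunction.
  pigeonhole-refutation P (p ∷ ps) []       N _         _   = h₀
  pigeonhole-refutation P (p ∷ ps) (h ∷ hs) N (s≤s b<a) a≤N =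
    relax (≤-reflexive (eq (length hs * (N * N * N * 52000)) (N * N * N * 52000)))
      (cut (relocate-pigeonhole P {p} {ps} {h} {hs} N (≤-trans (s≤s b<a′) a≤N) (<⇒≤ a≤N))
        (weaken-⊢ ∈-++⁺ˡ (pigeonhole-refutation (relocate P p h) ps hs N b<a (<⇒≤ a≤N))))
    where
    b<a′ = <⇒≤ b<a
    eq : ∀ x y → x + 1 + y ≡ y + x + 1
    eq = solve-∀

-- The pigeonhole principle with bit vectors as holes

minterm : ∀ {V k} → Vec (Formula V) k → Vec Bool k → Formula V
minterm []       []           = ⊤ᶠ
minterm (A ∷ As) (true  ∷ v) = A ∧ᶠ minterm As v
minterm (A ∷ As) (false ∷ v) = ¬ᶠ A ∧ᶠ minterm As v

vectors : ∀ k → List (Vec Bool k)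
vectors zero    = [] ∷ []
vectors (suc k) = map (true ∷_) (vectors k) ++ map (false ∷_) (vectors k)

length-vectors : ∀ k → length (vectors k) ≡ 2 ^ k
length-vectors zero = refl
length-vectors (suc k) = begin
  length (map (true ∷_) (vectors k) ++ map (false ∷_) (vectors k))
    ≡⟨ List.length-++ (map (true ∷_) (vectors k)) ⟩
  length (map (true ∷_) (vectors k)) + length (map (false ∷_) (vectors k))
    ≡⟨ cong₂ _+_ (List.length-map _ (vectors k)) (List.length-map _ (vectors k)) ⟩
  length (vectors k) + length (vectors k)
    ≡⟨ cong (λ w → w + w) (length-vectors k) ⟩
  2 ^ k + 2 ^ k
    ≡⟨ cong (2 ^ k +_) (sym (+-identityʳ (2 ^ k))) ⟩
  2 ^ suc k ∎
  where open ≡-Reasoning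

equivalences : ∀ {V k} → Vec (Formula V) k → Vec (Formula V) k → List (Formula V)
equivalences []       []       = []
equivalences (A ∷ As) (B ∷ Bs) = (A ⇒ B) ∷ (B ⇒ A) ∷ equivalences As Bs

equivalences∋⇒ : ∀ {V k} (As Bs : Vec (Formula V) k) i →
                 (Vec.lookup As i ⇒ Vec.lookup Bs i) ∈ equivalences As Bs
equivalences∋⇒ (A ∷ As) (B ∷ Bs) zero    = here refl
equivalences∋⇒ (A ∷ As) (B ∷ Bs) (suc i) = there (there (equivalences∋⇒ As Bs i))

equivalences∋⇐ : ∀ {V k} (As Bs : Vec (Formula V) k) i →
                 (Vec.lookup Bs i ⇒ Vec.lookup As i) ∈ equivalences As Bs
equivalences∋⇐ (A ∷ As) (B ∷ Bs) zero    = there (here refl)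
equivalences∋⇐ (A ∷ As) (B ∷ Bs) (suc i) = there (there (equivalences∋⇐ As Bs i))

numeral-≤ : ∀ {m n} → {_ : True (m ≤? n)} → m ≤ n
numeral-≤ {_} {_} {p} = toWitness p

1≤2^ : ∀ k → 1 ≤ 2 ^ k
1≤2^ k = m^n>0 2 k

n≤2^n : ∀ k → k ≤ 2 ^ k
n≤2^n zero    = z≤n
n≤2^n (suc k) = ≤-trans (+-mono-≤ (1≤2^ k) (n≤2^n k)) (≤-reflexive (cong (2 ^ k +_) (sym (+-identityʳ (2 ^ k)))))

module _ {V : Set} where

  private variable
    Γ : List (Formula V)
    C : Formula V
    s t k : ℕ

  cases-on : ∀ A → A ∷ Γ ⊩ C within s → ¬ᶠ A ∷ Γ ⊩ C within t → Γ ⊩ C within s * 25 + t * 25 + 107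
  cases-on {C = C} {s = s} {t = t} A d e = relax (≤-reflexive (eq s t))
    (by-contradiction C (by-cases A (⇒E h₁ (weaken-⊢ swap d)) (⇒E h₁ (weaken-⊢ swap e))))
    where
    swap : ∀ {A B} {Γ : List (Formula V)} → A ∷ Γ ⊆ A ∷ B ∷ Γ
    swap (here refl) = here refl
    swap (there x)   = there (there x)
    eq : ∀ s t → suc (suc (suc (s + 1) * 5 + suc (t + 1) * 5) * 5 + 1) ≡ s * 25 + t * 25 + 107
    eq = solve-∀

  minterms-total : ∀ (As : Vec (Formula V) k) →
                   Γ ⊩ ⋁ (map (minterm As) (vectors k)) within 2 ^ k * 2 ^ k * 6000
  minterms-total [] = relaxed (∨I₁ ⊤I)
  minterms-total {k = suc k} (A ∷ As) = relax bound
    -- The disjunction for `As` is derived before the case distinction, since `cases-on` would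
    -- multiply its cost.
    (cut (minterms-total As) (cases-on A
      (⇒E (⋁-elim-map {hs = vectors k} (λ v∈ → ⋁-intro-map (∈-++⁺ˡ (∈-map⁺ (true ∷_) v∈)) (∧I h₁ h₀))) h₁)
      (⇒E (⋁-elim-map {hs = vectors k} (λ v∈ →
        ⋁-intro-map (∈-++⁺ʳ (map (true ∷_) (vectors k)) (∈-map⁺ (false ∷_) v∈)) (∧I h₁ h₀))) h₁)))
    where
    cost : ℕ → ℕ → ℕ
    cost w l = suc (1 + (w * (3 + (l * 2 + 5) * 5) + 25)) * 25 + suc (1 + (w * (3 + (l * 2 + 5) * 5) + 25)) * 25 + 107
    bound′ : ∀ w → 1 ≤ w → cost w (w + (w + 0)) + w * w * 6000 ≤ (w + (w + 0)) * (w + (w + 0)) * 6000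
    bound′ w 1≤w = begin
      cost w (w + (w + 0)) + w * w * 6000         ≡⟨ eq₁ w ⟩
      1457 + w * 1400 + w * w * 7000              ≤⟨ +-monoˡ-≤ (w * w * 7000) (+-mono-≤
                                                       (*-monoˡ-≤ 1457 (*-mono-≤ 1≤w 1≤w))
                                                       (*-monoˡ-≤ 1400 (m≤m*n w w {{>-nonZero 1≤w}}))) ⟩
      w * w * 1457 + w * w * 1400 + w * w * 7000  ≡⟨ eq₂ (w * w) ⟩
      w * w * 9857                                ≤⟨ *-monoʳ-≤ (w * w) numeral-≤ ⟩
      w * w * 24000                               ≡⟨ eq₃ w ⟩
      (w + (w + 0)) * (w + (w + 0)) * 6000        ∎
      where
      open ≤-Reasoning
      eq₁ : ∀ w → suc (1 + (w * (3 + ((w + (w + 0)) * 2 + 5) * 5) + 25)) * 25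
                  + suc (1 + (w * (3 + ((w + (w + 0)) * 2 + 5) * 5) + 25)) * 25 + 107 + w * w * 6000
                  ≡ 1457 + w * 1400 + w * w * 7000
      eq₁ = solve-∀
      eq₂ : ∀ u → u * 1457 + u * 1400 + u * 7000 ≡ u * 9857
      eq₂ = solve-∀
      eq₃ : ∀ w → w * w * 24000 ≡ (w + (w + 0)) * (w + (w + 0)) * 6000
      eq₃ = solve-∀
    bound : cost (length (vectors k)) (length (vectors (suc k))) + 2 ^ k * 2 ^ k * 6000
            ≤ 2 ^ suc k * 2 ^ suc k * 6000
    bound = ≤-trans
      (≤-reflexive (cong (_+ 2 ^ k * 2 ^ k * 6000) (cong₂ cost (length-vectors k) (length-vectors (suc k)))))
      (bound′ (2 ^ k) (1≤2^ k))

  minterms-agree : ∀ (As Bs : Vec (Formula V) k) v →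
                   minterm As v ∷ minterm Bs v ∷ [] ⊢ equivalences As Bs within k * 100
  minterms-agree [] [] [] = ∅
  minterms-agree {k = suc k} (A ∷ As) (B ∷ Bs) (true ∷ v) = relax (slack 64 (eq k))
    (⇒I (∧E₁ h₂) ▹ ⇒I (∧E₁ h₁) ▹ apply (∧E₂ h₀ ▹ ∧E₂ h₁ ▹ ∅) (minterms-agree As Bs v))
    where
    eq : ∀ k → k * 100 + 6 + 15 + 15 + 64 ≡ suc k * 100
    eq = solve-∀
  minterms-agree {k = suc k} (A ∷ As) (B ∷ Bs) (false ∷ v) = relax (slack 4 (eq k))
    (⇒I (⊥E (⇒E (∧E₁ h₁) h₀)) ▹ ⇒I (⊥E (⇒E (∧E₁ h₂) h₀)) ▹
     apply (∧E₂ h₀ ▹ ∧E₂ h₁ ▹ ∅) (minterms-agree As Bs v))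
    where
    eq : ∀ k → k * 100 + 6 + 45 + 45 + 4 ≡ suc k * 100
    eq = solve-∀

  -- A pigeon p sits in the hole v when the formulas `S p` take the truth values v. Some v always
  -- applies, and two pigeons in one hole have equivalent tuples, which the hypothesis refutes.
  binary-pigeonhole : ∀ {A : Set} (S : A → Vec (Formula V) k) ps → length ps ≡ suc (2 ^ k) →
                      (∀ {p q} → (p , q) ∈ pairs ps → equivalences (S p) (S q) ++ Γ ⊩ ⊥ᶠ within s) →
                      Γ ⊩ ⊥ᶠ within 2 ^ k * 2 ^ k * (2 ^ k * 2 ^ k) * (s + 1) * 500000
  binary-pigeonhole {k = k} {Γ = Γ} {s = s} S ps size≡ distinct =
    relax bound
      (apply (each (All.map⁺ (All.tabulate (λ {p} _ → minterms-total (S p)))) ▹▹ each (All.tabulate exclusive))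
        (pigeonhole-refutation P ps (vectors k) (2 ^ k * 2)
          (≤-reflexive (trans (cong suc (length-vectors k)) (sym size≡))) size≤))
    where
    P : _ → Vec Bool k → Formula V
    P p v = minterm (S p) v
    exclusive : ∀ {F} → F ∈ exclusivity P ps (vectors k) → Γ ⊩ F within (s + (k * 100 + 2)) * 25
    exclusive F∈ with ∈-cartesianProductWith⁻ _ (pairs ps) (vectors k) F∈
    ... | (p , q) , v , pq∈ , v∈ , refl = relax (≤-reflexive (eq (s + (k * 100 + 2))))
      (⇒I (⇒I (cut (apply (h₁ ▹ h₀ ▹ ∅) (minterms-agree (S p) (S q) v))
                 (weaken-⊢ skip (distinct pq∈)))))
      where
      eq : ∀ x → x * 5 * 5 ≡ x * 25
      eq = solve-∀
      skip : ∀ {A B : Formula V} {Θ} → Θ ++ Γ ⊆ Θ ++ A ∷ B ∷ Γ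
      skip {Θ = Θ} x∈ with ∈-++⁻ Θ x∈
      ... | inj₁ y = ∈-++⁺ˡ y
      ... | inj₂ y = ∈-++⁺ʳ Θ (there (there y))
    w = 2 ^ k
    instance
      w≢0 = >-nonZero (1≤2^ k)
    size≤ : length ps ≤ w * 2
    size≤ = begin
      length ps ≡⟨ size≡ ⟩
      1 + w     ≤⟨ +-monoˡ-≤ w (1≤2^ k) ⟩
      w + w     ≡⟨ eq w ⟩
      w * 2     ∎
      where
      open ≤-Reasoning
      eq : ∀ w → w + w ≡ w * 2
      eq = solve-∀
    poly : ∀ w s → 1 ≤ w →
           w * (w * 2 * (w * 2) * (w * 2) * 52000) + 1
           + (w * 2 * (w * 2) * w * ((s + (w * 100 + 2)) * 25) + w * 2 * (w * w * 6000))
           ≤ w * w * (w * w) * (s + 1) * 500000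
    poly w s 1≤w = begin
      w * (w * 2 * (w * 2) * (w * 2) * 52000) + 1
      + (w * 2 * (w * 2) * w * ((s + (w * 100 + 2)) * 25) + w * 2 * (w * w * 6000))
        ≤⟨ +-mono-≤
             (+-monoʳ-≤ (w * (w * 2 * (w * 2) * (w * 2) * 52000)) (*-mono-≤ (*-mono-≤ 1≤w 1≤w) (*-mono-≤ 1≤w 1≤w)))
             (+-mono-≤ (*-monoʳ-≤ (w * 2 * (w * 2) * w)
                          (*-monoˡ-≤ 25 (+-mono-≤ (m≤m*n s w) (+-monoʳ-≤ (w * 100) (*-monoˡ-≤ 2 1≤w)))))
                       (m≤m*n (w * 2 * (w * w * 6000)) w)) ⟩
      w * (w * 2 * (w * 2) * (w * 2) * 52000) + w * w * (w * w)
      + (w * 2 * (w * 2) * w * ((s * w + (w * 100 + w * 2)) * 25) + w * 2 * (w * w * 6000) * w)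
        ≡⟨ eq₁ w s ⟩
      w * w * (w * w) * (s * 100 + 438201)
        ≤⟨ *-monoʳ-≤ (w * w * (w * w)) (+-mono-≤ (*-monoʳ-≤ s numeral-≤) numeral-≤) ⟩
      w * w * (w * w) * (s * 500000 + 500000)
        ≡⟨ eq₂ (w * w * (w * w)) s ⟩
      w * w * (w * w) * (s + 1) * 500000 ∎
      where
      open ≤-Reasoning
      instance
        w≢0′ = >-nonZero 1≤w
      eq₁ : ∀ w s → w * (w * 2 * (w * 2) * (w * 2) * 52000) + w * w * (w * w)
            + (w * 2 * (w * 2) * w * ((s * w + (w * 100 + w * 2)) * 25) + w * 2 * (w * w * 6000) * w)
            ≡ w * w * (w * w) * (s * 100 + 438201)
      eq₁ = solve-∀
      eq₂ : ∀ u s → u * (s * 500000 + 500000) ≡ u * (s + 1) * 500000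
      eq₂ = solve-∀
    pairs≤ : length (exclusivity P ps (vectors k)) ≤ w * 2 * (w * 2) * w
    pairs≤ = ≤-trans (≤-reflexive (trans (length-cartesianProductWith _ (pairs ps) (vectors k))
                                     (cong (length (pairs ps) *_) (length-vectors k))))
               (*-monoˡ-≤ w (≤-trans (length-pairs ps) (*-mono-≤ size≤ size≤)))
    bound : length (vectors k) * (w * 2 * (w * 2) * (w * 2) * 52000) + 1
            + (length (exclusivity P ps (vectors k)) * ((s + (k * 100 + 2)) * 25)
               + length (totality P ps (vectors k)) * (w * w * 6000))
            ≤ w * w * (w * w) * (s + 1) * 500000
    bound = ≤-trans
      (+-mono-≤ (≤-reflexive (cong (λ l → l * (w * 2 * (w * 2) * (w * 2) * 52000) + 1) (length-vectors k)))
        (+-mono-≤ (*-mono-≤ pairs≤ (*-monoˡ-≤ 25 (+-monoʳ-≤ s (+-monoˡ-≤ 2 (*-monoˡ-≤ 100 (n≤2^n k))))))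
          (*-monoˡ-≤ (w * w * 6000) (≤-trans (≤-reflexive (List.length-map _ ps)) size≤))))
      (poly w s (1≤2^ k))

-- The clauses of Φ

clauseFormula : ∀ {V} → Clause V → Formula V
clauseFormula C = ⋁ (map literalFormula C)

triangles : ∀ {n k} → Fin n → Fin n → CNF (Var n k)
triangles {k = k} v w = map (λ i → neg (X v i) ∷ neg (X w i) ∷ pos (Y v w) ∷ []) (allFin k)

memberships : ∀ {n k} → Fin n → Fin n → List (Literal (Var n k) × Literal (Var n k))
memberships {k = k} v w = map (λ j → pos (X v j) , pos (X w j)) (allFin k)

-- A copy of the function local to `Φ`, definitionally equal to it, so that individual clauses can
-- be addressed.
clausesOf : ∀ {n} → Graph n → (k : ℕ) → Fin n × Fin n → CNF (Var n k)
clausesOf G k (v , w) =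
  ((if Graph.adj G v w then pos (Y v w) else neg (Y v w)) ∷ []) ∷
  (triangles v w ++
   map (neg (Y v w) ∷_) (distribute (memberships v w)))

distinctPairs⁺ : ∀ {n} {v w : Fin n} → v ≢ w → (v , w) ∈ distinctPairs n
distinctPairs⁺ {n} v≢w = ∈-filter⁺ _ (∈-cartesianProduct⁺ (∈-allFin _) (∈-allFin _)) v≢w

distinctPairs⁻ : ∀ {n} {v w : Fin n} → (v , w) ∈ distinctPairs n → v ≢ w
distinctPairs⁻ {n} vw∈ = proj₂ (∈-filter⁻ _ {xs = cartesianProduct (allFin n) (allFin n)} vw∈)

Φ∋ : ∀ {n} (G : Graph n) {k v w C} → v ≢ w → C ∈ clausesOf G k (v , w) → C ∈ Φ G k
Φ∋ G {k} v≢w C∈ = ∈-concatMap⁺ (clausesOf G k) (lose (distinctPairs⁺ v≢w) C∈)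

length-distribute : ∀ {V} (ds : List (Literal V × Literal V)) → length (distribute ds) ≡ 2 ^ length ds
length-distribute [] = refl
length-distribute (d ∷ ds) = trans (length-cartesianProductWith _∷_ (proj₁ d ∷ proj₂ d ∷ []) (distribute ds))
                               (cong (2 *_) (length-distribute ds))

module _ {V : Set} where

  private variable
    Γ : List (Formula V)
    s t : ℕ

  resolve-pair : ∀ a b (C : Clause V) →
                 (literalFormula a ⇒ literalFormula b ⇒ ⊥ᶠ) ∷
                 clauseFormula (a ∷ C) ∷ clauseFormula (b ∷ C) ∷ [] ⊩ clauseFormula C within 1000
  resolve-pair a b C = relaxed (∨E h₁ (∨E h₃ (⊥E (⇒E (⇒E h₂ h₁) h₀)) h₀) h₀)

  exclusions : List (Literal V × Literal V) → List (Formula V)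
  exclusions = map λ (a , b) → literalFormula a ⇒ literalFormula b ⇒ ⊥ᶠ

  -- As a and b exclude each other, the clauses `a ∷ C` and `b ∷ C` resolve to `C`. Each pair halves
  -- the number of clauses, so the costs form a geometric series.
  distribute-refutation : ∀ ds → map clauseFormula (distribute ds) ++ exclusions ds ⊩ ⊥ᶠ within 2 ^ length ds * 2000
  distribute-refutation [] = relaxed h₀
  distribute-refutation ((a , b) ∷ ds) = relax bound
    (cut (each (All.map⁺ (All.tabulate resolve)))
      (weaken-⊢ sub (distribute-refutation ds)))
    where
    Θ = map clauseFormula (distribute ((a , b) ∷ ds)) ++ exclusions ((a , b) ∷ ds)
    clause∈ : ∀ {l C} → l ∈ a ∷ b ∷ [] → C ∈ distribute ds → clauseFormula (l ∷ C) ∈ Θ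
    clause∈ l∈ C∈ = ∈-++⁺ˡ (∈-map⁺ clauseFormula (∈-cartesianProductWith⁺ _∷_ l∈ C∈))
    resolve : ∀ {C} → C ∈ distribute ds → Θ ⊩ clauseFormula C within 1003
    resolve {C} C∈ = apply
      (hyp (∈-++⁺ʳ (map clauseFormula (distribute ((a , b) ∷ ds))) (here refl))
        ▹ hyp (clause∈ (here refl) C∈) ▹ hyp (clause∈ (there (here refl)) C∈) ▹ ∅)
      (resolve-pair a b C)
    sub : map clauseFormula (distribute ds) ++ exclusions ds ⊆ map clauseFormula (distribute ds) ++ Θ
    sub x∈ with ∈-++⁻ (map clauseFormula (distribute ds)) x∈
    ... | inj₁ y = ∈-++⁺ˡ y
    ... | inj₂ y = ∈-++⁺ʳ (map clauseFormula (distribute ds))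
                     (∈-++⁺ʳ (map clauseFormula (distribute ((a , b) ∷ ds))) (there y))
    bound : 2 ^ length ds * 2000 + length (map clauseFormula (distribute ds)) * 1003 ≤ 2 ^ suc (length ds) * 2000
    bound = begin
      2 ^ length ds * 2000 + length (map clauseFormula (distribute ds)) * 1003
        ≡⟨ cong (λ l → 2 ^ length ds * 2000 + l * 1003)
             (trans (List.length-map clauseFormula (distribute ds)) (length-distribute ds)) ⟩
      2 ^ length ds * 2000 + 2 ^ length ds * 1003
        ≤⟨ +-monoʳ-≤ (2 ^ length ds * 2000) (*-monoʳ-≤ (2 ^ length ds) numeral-≤) ⟩
      2 ^ length ds * 2000 + 2 ^ length ds * 2000
        ≡⟨ eq (2 ^ length ds) ⟩
      2 ^ suc (length ds) * 2000 ∎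
      where
      open ≤-Reasoning
      eq : ∀ w → w * 2000 + w * 2000 ≡ (w + (w + 0)) * 2000
      eq = solve-∀

module _ {n} (G : Graph n) {k : ℕ} where

  open Graph G using (adj)

  private
    Γ = formulas (Φ G k)

    unit : ∀ {v w} → v ≢ w → clauseFormula ((if adj v w then pos (Y v w) else neg (Y v w)) ∷ []) ∈ Γ
    unit v≢w = ∈-map⁺ clauseFormula (Φ∋ G v≢w (here refl))

  nonadjacent-exclusive : ∀ {v w} → v ≢ w → adj v w ≡ false → ∀ j →
                          Γ ⊩ var (X v j) ⇒ var (X w j) ⇒ ⊥ᶠ within 200000
  nonadjacent-exclusive {v} {w} v≢w v∤w j = relaxed
    (apply
      (hyp (∈-map⁺ clauseFormula (Φ∋ G v≢w (there (∈-++⁺ˡ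
          (∈-map⁺ (λ i → neg (X v i) ∷ neg (X w i) ∷ pos (Y v w) ∷ []) (∈-allFin j))))))
        ▹ hyp (subst (λ b → clauseFormula ((if b then pos (Y v w) else neg (Y v w)) ∷ []) ∈ Γ) v∤w (unit v≢w)) ▹ ∅)
      (⇒I (⇒I (∨E h₂ (⇒E h₀ h₂)
        (∨E h₀ (⇒E h₀ (hyp (there (there (here refl)))))
          (∨E h₀ (∨E (hyp (there (there (there (there (there (there (here refl)))))))) (⇒E h₀ h₁) h₀) h₀))))))

  -- The positive unit clause removes the negated edge variable from the covering clauses, and
  -- `distribute-refutation` does the rest. The context `Γ′` may contain local assumptions on which
  -- the disjointness depends.
  edge-covered : ∀ {v w Γ′ t} → Edge G v w → Γ ⊆ Γ′ →
                 (∀ j → Γ′ ⊩ var (X v j) ⇒ var (X w j) ⇒ ⊥ᶠ within t) →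
                 Γ′ ⊩ ⊥ᶠ within 2 ^ k * (t + 4000)
  edge-covered {v} {w} {Γ′} {t} vw Γ⊆Γ′ disjoint = relax bound
    (apply (each (All.map⁺ (All.tabulate clause)) ▹▹ each (All.map⁺ (All.map⁺ (All.tabulate λ {j} _ → disjoint j))))
      (distribute-refutation ds))
    where
    ds = memberships {k = k} v w
    v≢w : v ≢ w
    v≢w refl = case trans (sym vw) (Graph.irref G v) of λ ()
    clause : ∀ {C} → C ∈ distribute ds → Γ′ ⊩ clauseFormula C within 1000
    clause C∈ = relaxed (apply
      (hyp (Γ⊆Γ′ (∈-map⁺ clauseFormula (Φ∋ G v≢w
              (there (∈-++⁺ʳ (triangles v w) (∈-map⁺ (neg (Y v w) ∷_) C∈))))))
        ▹ hyp (Γ⊆Γ′ (subst (λ b → clauseFormula ((if b then pos (Y v w) else neg (Y v w)) ∷ []) ∈ Γ) vw (unit v≢w))) ▹ ∅)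
      (∨E h₀ (∨E h₂ (⊥E (⇒E h₁ h₀)) (⊥E h₀)) h₀))
    length-ds : length ds ≡ k
    length-ds = trans (List.length-map _ (allFin k)) (List.length-tabulate id)
    bound : 2 ^ length ds * 2000 + (length (exclusions ds) * t + length (map clauseFormula (distribute ds)) * 1000)
            ≤ 2 ^ k * (t + 4000)
    bound = begin
      2 ^ length ds * 2000 + (length (exclusions ds) * t + length (map clauseFormula (distribute ds)) * 1000)
        ≡⟨ cong₂ (λ x y → 2 ^ length ds * 2000 + (x * t + y * 1000))
             (List.length-map _ ds) (trans (List.length-map clauseFormula (distribute ds)) (length-distribute ds)) ⟩
      2 ^ length ds * 2000 + (length ds * t + 2 ^ length ds * 1000)
        ≡⟨ cong (λ l → 2 ^ l * 2000 + (l * t + 2 ^ l * 1000)) length-ds ⟩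
      2 ^ k * 2000 + (k * t + 2 ^ k * 1000)
        ≤⟨ +-monoʳ-≤ (2 ^ k * 2000) (+-mono-≤ (*-monoˡ-≤ t (n≤2^n k)) (*-monoʳ-≤ (2 ^ k) numeral-≤)) ⟩
      2 ^ k * 2000 + (2 ^ k * t + 2 ^ k * 2000)
        ≡⟨ eq (2 ^ k) t ⟩
      2 ^ k * (t + 4000) ∎
      where
      open ≤-Reasoning
      eq : ∀ w t → w * 2000 + (w * t + w * 2000) ≡ w * (t + 4000)
      eq = solve-∀

-- Twins

·-injective : ∀ {a b c d : Tree} → a · b ≡ c · d → a ≡ c × b ≡ d
·-injective refl = refl , refl

infix 4 _≟ᵗ_

_≟ᵗ_ : (a b : Tree) → Dec (a ≡ b)
nil   ≟ᵗ nil   = yes refl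
nil   ≟ᵗ c · d = no λ ()
a · b ≟ᵗ nil   = no λ ()
a · b ≟ᵗ c · d = map′ (λ (p , q) → cong₂ _·_ p q) ·-injective ((a ≟ᵗ c) ×-dec (b ≟ᵗ d))

bitCode-injective : ∀ {b c} → bitCode b ≡ bitCode c → b ≡ c
bitCode-injective {true}  {true}  _ = refl
bitCode-injective {false} {false} _ = refl

bitsCode : List Bool → Tree
bitsCode bs = listCode (map bitCode bs)

bitsCode-injective : ∀ {n} {f g : Fin n → Bool} → bitsCode (tabulate f) ≡ bitsCode (tabulate g) → ∀ i → f i ≡ g i
bitsCode-injective p zero    = bitCode-injective (proj₁ (·-injective p))
bitsCode-injective p (suc i) = bitsCode-injective (proj₂ (·-injective p)) i

lookup-injective : ∀ {A : Set} {xs : List A} → Unique xs → ∀ {i j} → List.lookup xs i ≡ List.lookup xs j → i ≡ j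
lookup-injective (_ ∷ u)  {zero}  {zero}  _ = refl
lookup-injective (p ∷ _)  {zero}  {suc j} e = contradiction e (All.lookup p (∈-lookup j))
lookup-injective (p ∷ _)  {suc i} {zero}  e = contradiction (sym e) (All.lookup p (∈-lookup i))
lookup-injective (_ ∷ u)  {suc i} {suc j} e = cong suc (lookup-injective u e)

∈-subset⁺ : ∀ {n} {f : Fin n → Bool} {i} → f i ≡ true → i Subset.∈ Vec.tabulate f
∈-subset⁺ {f = f} {i} p = Vec.lookup⇒[]= i (Vec.tabulate f) (trans (Vec.lookup∘tabulate f i) p)

∈-subset⁻ : ∀ {n} {f : Fin n → Bool} {i} → i Subset.∈ Vec.tabulate f → f i ≡ true
∈-subset⁻ {f = f} {i} p = trans (sym (Vec.lookup∘tabulate f i)) (Vec.[]=⇒lookup p)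

does-true : ∀ {P : Set} (P? : Dec P) → P → does P? ≡ true
does-true (yes _) _ = refl
does-true (no ¬p) p = contradiction p ¬p

does-true⁻ : ∀ {P : Set} (P? : Dec P) → does P? ≡ true → P
does-true⁻ (yes p) _ = p

does-false : ∀ {P : Set} (P? : Dec P) → ¬ P → does P? ≡ false
does-false (yes p) ¬p = contradiction p ¬p
does-false (no _)  _  = refl

≡-does : ∀ {P : Set} {b} (P? : Dec P) → (b ≡ true → P) → (P → b ≡ true) → b ≡ does P?
≡-does (yes p)         f g = g p
≡-does {b = false} (no ¬p) f g = refl
≡-does {b = true}  (no ¬p) f g = contradiction (f refl) ¬p

induced : ∀ {n} → Graph n → (L : List (Fin n)) → Graph (length L)
induced G L = record
  { adj   = λ i j → Graph.adj G (List.lookup L i) (List.lookup L j)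
  ; sym   = λ i j → Graph.sym G (List.lookup L i) (List.lookup L j)
  ; irref = λ i → Graph.irref G (List.lookup L i)
  }

edge-≢ : ∀ {n} (G : Graph n) {v w} → Edge G v w → v ≢ w
edge-≢ G {v} vw refl = case trans (sym vw) (Graph.irref G v) of λ ()

induced-cover : ∀ {n} (G : Graph n) {L k} → Unique L → EdgeCliqueCover G k → EdgeCliqueCover (induced G L) k
induced-cover G {L} u (V , cliques , covers) =
  (λ i → Vec.tabulate (λ a → Vec.lookup (V i) (List.lookup L a))) ,
  (λ i a b a∈ b∈ a≢b → cliques i _ _ (Vec.lookup⇒[]= _ _ (∈-subset⁻ a∈)) (Vec.lookup⇒[]= _ _ (∈-subset⁻ b∈))
                         (a≢b ∘ lookup-injective u)) ,
  (λ a b ab → let (i , a∈ , b∈) = covers _ _ ab in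
              i , ∈-subset⁺ (Vec.[]=⇒lookup a∈) , ∈-subset⁺ (Vec.[]=⇒lookup b∈))

-- One vertex per class is kept, but the first and the last one if the class
-- is a component, since its edges still need a clique; isolated vertices go.
select : Bool → Bool → Bool → Bool
select complete earlier later =
  if complete then (if earlier then not later else later) else not earlier

module Reduction {n} (G : Graph n) where

  open Graph G using (adj)

  closed : Fin n → Fin n → Bool
  closed v w = if does (v Fin.≟ w) then true else adj v w

  row : Fin n → Tree
  row v = bitsCode (tabulate (closed v))

  closed-refl : ∀ v → closed v v ≡ true
  closed-refl v rewrite does-true (v Fin.≟ v) refl = refl

  closed-≢ : ∀ {v w} → v ≢ w → closed v w ≡ adj v w
  closed-≢ {v} {w} v≢w rewrite does-false (v Fin.≟ w) v≢w = refl

  closed-sym : ∀ v w → closed v w ≡ closed w v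
  closed-sym v w with v Fin.≟ w
  ... | yes refl = sym (closed-refl v)
  ... | no v≢w   = trans (Graph.sym G v w) (sym (closed-≢ (v≢w ∘ sym)))

  edge-closed : ∀ {v w} → Edge G v w → closed v w ≡ true
  edge-closed vw = trans (closed-≢ (edge-≢ G vw)) vw

  -- Stated for the codes of the rows, because these are what the kernelization program compares.
  Twin : Fin n → Fin n → Set
  Twin u v = row u ≡ row v

  twin? : ∀ u v → Dec (Twin u v)
  twin? u v = row u ≟ᵗ row v

  twin-closed : ∀ {u v} → Twin u v → ∀ w → closed u w ≡ closed v w
  twin-closed uv w = bitsCode-injective uv w

  closed-twin : ∀ {u v} → (∀ w → closed u w ≡ closed v w) → Twin u v
  closed-twin same = cong bitsCode (List.tabulate-cong same)

  twin-closed-true : ∀ {u v} → Twin u v → closed u v ≡ true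
  twin-closed-true {u} {v} uv = trans (twin-closed uv v) (closed-refl v)

  twin-edge : ∀ {u v} → Twin u v → u ≢ v → Edge G u v
  twin-edge uv u≢v = trans (sym (closed-≢ u≢v)) (twin-closed-true uv)

  edge-sym : ∀ {v w} → Edge G v w → Edge G w v
  edge-sym {v} {w} vw = trans (sym (Graph.sym G v w)) vw

  -- The class of v is a connected component.
  Complete : Fin n → Set
  Complete v = ∀ w → closed v w ≡ true → Twin w v

  complete? : ∀ v → Dec (Complete v)
  complete? v = Fin.all? λ w → (closed v w Bool.≟ true) →-dec twin? w v

  Earlier Later : Fin n → Set
  Earlier v = ∃[ u ] (u Fin.< v × Twin u v)
  Later v   = ∃[ u ] (v Fin.< u × Twin u v)

  earlier? : ∀ v → Dec (Earlier v)
  earlier? v = Fin.any? λ u → (u Fin.<? v) ×-dec twin? u v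

  later? : ∀ v → Dec (Later v)
  later? v = Fin.any? λ u → (v Fin.<? u) ×-dec twin? u v

  keep : Fin n → Bool
  keep v = select (does (complete? v)) (does (earlier? v)) (does (later? v))

  -- An isolated vertex is a complete class with neither an earlier nor a later member, so neither
  -- constructor applies to it.
  data Kept (v : Fin n) : Set where
    first : ¬ Earlier v → (Complete v → Later v) → Kept v
    last  : Earlier v → ¬ Later v → Complete v → Kept v

  keep⁻ : ∀ {v} → keep v ≡ true → Kept v
  keep⁻ {v} = go (complete? v) (earlier? v) (later? v)
    where
    go : (c? : Dec (Complete v)) (e? : Dec (Earlier v)) (l? : Dec (Later v)) →
         select (does c?) (does e?) (does l?) ≡ true → Kept v
    go (yes c) (yes e) (no ¬l) _ = last e ¬l c
    go (yes c) (no ¬e) (yes l) _ = first ¬e (λ _ → l)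
    go (no ¬c) (no ¬e) l?      _ = first ¬e (λ c → contradiction c ¬c)

  keep⁺ : ∀ {v} → Kept v → keep v ≡ true
  keep⁺ {v} = go (complete? v) (earlier? v) (later? v)
    where
    go : (c? : Dec (Complete v)) (e? : Dec (Earlier v)) (l? : Dec (Later v)) →
         Kept v → select (does c?) (does e?) (does l?) ≡ true
    go c? e? l? (last e ¬l c)
      rewrite does-true c? c | does-true e? e | does-false l? ¬l = refl
    go c? e? l? (first ¬e later) rewrite does-false e? ¬e with c?
    ... | yes c = does-true l? (later c)
    ... | no ¬c = refl

  abstract

    -- Outside this block the definition is available through `kept-filter` only, for the arguments
    -- about the program and about sizes.
    kept : List (Fin n)
    kept = filter (λ v → keep v Bool.≟ true) (allFin n)

    kept-unique : Unique kept
    kept-unique = Unique.filter⁺ _ (Unique.allFin⁺ n)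

    ∈-kept⁺ : ∀ {v} → Kept v → v ∈ kept
    ∈-kept⁺ {v} p = ∈-filter⁺ _ (∈-allFin v) (keep⁺ p)

    ∈-kept⁻ : ∀ {v} → v ∈ kept → Kept v
    ∈-kept⁻ v∈ = keep⁻ (proj₂ (∈-filter⁻ _ {xs = allFin n} v∈))

    kept-filter : kept ≡ filter (λ v → keep v Bool.≟ true) (allFin n)
    kept-filter = refl

  firstTwin : ∀ v → ∃[ u ] (Twin u v × ¬ Earlier u)
  firstTwin v = go v (<-wellFounded v)
    where
    go : ∀ v → Acc Fin._<_ v → ∃[ u ] (Twin u v × ¬ Earlier u)
    go v (acc rec) with earlier? v
    ... | no ¬e             = v , refl , ¬e
    ... | yes (u , u<v , t) = let (x , t′ , ¬e) = go u (rec u<v) in x , trans t′ t , ¬e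

  lastTwin : ∀ v → ∃[ u ] (Twin u v × ¬ Later u)
  lastTwin v = go v (>-wellFounded v)
    where
    go : ∀ v → Acc Fin._>_ v → ∃[ u ] (Twin u v × ¬ Later u)
    go v (acc rec) with later? v
    ... | no ¬l             = v , refl , ¬l
    ... | yes (u , v<u , t) = let (x , t′ , ¬l) = go u (rec v<u) in x , trans t′ t , ¬l

  complete-twin : ∀ {u v} → Twin u v → Complete u → Complete v
  complete-twin uv c w vw = trans (c w (trans (twin-closed uv w) vw)) uv

  first-≤ : ∀ {u v} → ¬ Earlier u → Twin u v → u ≢ v → u Fin.< v
  first-≤ {u} {v} ¬e uv u≢v with Fin.<-cmp u v
  ... | tri< u<v _ _ = u<v
  ... | tri≈ _ u≡v _ = contradiction u≡v u≢v
  ... | tri> _ _ v<u = contradiction (v , v<u , sym uv) ¬e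

  last-≤ : ∀ {u v} → ¬ Later u → Twin u v → u ≢ v → v Fin.< u
  last-≤ {u} {v} ¬l uv u≢v with Fin.<-cmp u v
  ... | tri< u<v _ _ = contradiction (v , u<v , sym uv) ¬l
  ... | tri≈ _ u≡v _ = contradiction u≡v u≢v
  ... | tri> _ _ v<u = v<u

  firsts-≡ : ∀ {u v} → ¬ Earlier u → ¬ Earlier v → Twin u v → u ≡ v
  firsts-≡ {u} {v} ¬e ¬e′ uv with u Fin.≟ v
  ... | yes p  = p
  ... | no u≢v = contradiction (u , first-≤ ¬e uv u≢v , uv) ¬e′

  lasts-≡ : ∀ {u v} → ¬ Later u → ¬ Later v → Twin u v → u ≡ v
  lasts-≡ {u} {v} ¬l ¬l′ uv with u Fin.≟ v
  ... | yes p  = p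
  ... | no u≢v = contradiction (u , last-≤ ¬l uv u≢v , uv) ¬l′

  -- The only reason to drop a first vertex is that it is alone in its component. Here, if the class
  -- is a component, then v is a later member, or w is one in case u is v.
  firstTwin-kept : ∀ {u v w} → Edge G v w → Twin u v → ¬ Earlier u → Kept u
  firstTwin-kept {u} {v} {w} vw uv ¬e = first ¬e later
    where
    later : Complete u → Later u
    later c with u Fin.≟ v
    ... | no u≢v   = v , first-≤ ¬e uv u≢v , sym uv
    ... | yes refl = let t = c w (edge-closed vw) in w , first-≤ ¬e (sym t) (edge-≢ G vw) , t

  keptTwin : ∀ {v w} → Edge G v w → ∃[ u ] (Twin u v × Kept u × ¬ Earlier u)
  keptTwin {v} vw = let (u , uv , ¬e) = firstTwin v in u , uv , firstTwin-kept vw uv ¬e , ¬e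

  -- With `closed` in place of adjacency, v and v′ may coincide; this covers the edges inside a
  -- class.
  twins-edge : ∀ {u u′ v v′} → Twin u v → Twin u′ v′ → u ≢ u′ → closed v v′ ≡ true → Edge G u u′
  twins-edge {u} {u′} {v} {v′} uv u′v′ u≢u′ vv′ = begin
    adj u u′     ≡⟨ closed-≢ u≢u′ ⟨
    closed u u′  ≡⟨ twin-closed uv u′ ⟩
    closed v u′  ≡⟨ closed-sym v u′ ⟩
    closed u′ v  ≡⟨ twin-closed u′v′ v ⟩
    closed v′ v  ≡⟨ closed-sym v′ v ⟩
    closed v v′  ≡⟨ vv′ ⟩
    true         ∎
    where open ≡-Reasoning

  -- Guarantees that u lies in some clique of a cover of the reduced graph. In a component, the last
  -- vertex of the class is the neighbour; otherwise u has a neighbour in another class, whose first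
  -- vertex is kept.
  kept-neighbour : ∀ {u} → ¬ Earlier u → Kept u → ∃[ w ] (Kept w × Edge G u w)
  kept-neighbour ¬e (last e _ _) = contradiction e ¬e
  kept-neighbour {u} ¬e (first _ later) with complete? u
  ... | yes c =
    let (w , wu , ¬l) = lastTwin u
        (x , u<x , xu) = later c
        u≢w = λ u≡w → ¬l (subst Later u≡w (x , u<x , xu))
    in w , last (u , first-≤ ¬e (sym wu) u≢w , sym wu) ¬l (complete-twin (sym wu) c) ,
       twin-edge (sym wu) u≢w
  ... | no ¬c with Fin.any? (λ z → (closed u z Bool.≟ true) ×-dec ¬? (twin? z u))
  ... | no none = contradiction
        (λ w uw → case twin? w u of λ { (yes t) → t ; (no ¬t) → contradiction (w , uw , ¬t) none }) ¬c
  ... | yes (z , uz , ¬t) =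
    let u≢z = λ { refl → ¬t refl }
        (w , wz , kw , _) = keptTwin (edge-sym (trans (sym (closed-≢ u≢z)) uz))
    in w , kw , twins-edge refl wz (λ u≡w → ¬t (trans (sym wz) (cong row (sym u≡w)))) uz

  kept-nonisolated : ∀ {u} → Kept u → ∃[ w ] Edge G u w
  kept-nonisolated k@(first ¬e _) = let (w , _ , uw) = kept-neighbour ¬e k in w , uw
  kept-nonisolated (last (u , u<v , t) _ _) = u , twin-edge (sym t) (λ { refl → Fin.<-irrefl refl u<v })

  -- Every vertex joins all cliques that contain a kept twin of it. The sets remain cliques, since
  -- adjacency of distinct vertices depends on their classes only.
  kept-cover : ∀ {k} → EdgeCliqueCover (induced G kept) k → EdgeCliqueCover G k
  kept-cover {k} (V , cliques , covers) = (λ i → Vec.tabulate (member i)) , cliques′ , covers′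
    where
    ι = List.lookup kept
    Member : Fin k → Fin n → Set
    Member i v = ∃[ a ] (Twin (ι a) v × Vec.lookup (V i) a ≡ true)
    member? : ∀ i v → Dec (Member i v)
    member? i v = Fin.any? λ a → twin? (ι a) v ×-dec (Vec.lookup (V i) a Bool.≟ true)
    member : Fin k → Fin n → Bool
    member i v = does (member? i v)

    cliques′ : ∀ i → Clique G (Vec.tabulate (member i))
    cliques′ i v w v∈ w∈ v≢w
      with does-true⁻ (member? i v) (∈-subset⁻ v∈) | does-true⁻ (member? i w) (∈-subset⁻ w∈)
    ... | a , av , a∈ | b , bw , b∈ = twins-edge (sym av) (sym bw) v≢w ab
      where
      ab : closed (ι a) (ι b) ≡ true
      ab with a Fin.≟ b
      ... | yes refl = closed-refl (ι a)
      ... | no a≢b   = edge-closed (cliques i a b (Vec.lookup⇒[]= a _ a∈) (Vec.lookup⇒[]= b _ b∈) a≢b)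

    index : ∀ {u} → Kept u → ∃[ a ] ι a ≡ u
    index p = Any.index (∈-kept⁺ p) , sym (Any.lookup-index (∈-kept⁺ p))

    keptEdge-covered : ∀ {u u′} → Kept u → Kept u′ → Edge G u u′ →
                       ∃[ i ] ((∃[ a ] (ι a ≡ u × Vec.lookup (V i) a ≡ true)) ×
                               (∃[ b ] (ι b ≡ u′ × Vec.lookup (V i) b ≡ true)))
    keptEdge-covered p q e with index p | index q
    ... | a , refl | b , refl = let (i , a∈ , b∈) = covers a b e in
      i , (a , refl , Vec.[]=⇒lookup a∈) , (b , refl , Vec.[]=⇒lookup b∈)

    covers′ : ∀ v w → Edge G v w → ∃[ i ] (v Subset.∈ Vec.tabulate (member i) × w Subset.∈ Vec.tabulate (member i))
    covers′ v w vw with keptTwin vw | keptTwin (edge-sym vw)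
    ... | u , uv , ku , ¬e | u′ , u′w , ku′ , _ with u Fin.≟ u′
    ... | no u≢u′ =
      let (i , (a , a≡ , a∈) , (b , b≡ , b∈)) = keptEdge-covered ku ku′ (twins-edge uv u′w u≢u′ (edge-closed vw))
      in i , ∈-subset⁺ (does-true (member? i v) (a , trans (cong row a≡) uv , a∈)) ,
             ∈-subset⁺ (does-true (member? i w) (b , trans (cong row b≡) u′w , b∈))
    -- The edge lies inside one class, so any clique containing the representative u will do; the
    -- one that covers an edge from u to a kept neighbour exists.
    ... | yes refl =
      let (x , kx , ux) = kept-neighbour ¬e ku
          (i , (a , a≡ , a∈) , _) = keptEdge-covered ku kx ux
      in i , ∈-subset⁺ (does-true (member? i v) (a , trans (cong row a≡) uv , a∈)) ,
             ∈-subset⁺ (does-true (member? i w) (a , trans (cong row a≡) u′w , a∈))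

-- Instances with too many classes

pairs-distinct : ∀ {A : Set} {p q : A} {ps} → Unique ps → (p , q) ∈ pairs ps → p ≢ q
pairs-distinct {ps = r ∷ ps} (r∉ ∷ u) pq∈ with ∈-++⁻ (map (r ,_) ps) pq∈
... | inj₂ pq∈′ = pairs-distinct u pq∈′
... | inj₁ pq∈′ with ∈-map⁻ (r ,_) pq∈′
... | _ , q∈ , refl = All.lookup r∉ q∈

equivalences-sym : ∀ {V k} (As Bs : Vec (Formula V) k) → equivalences As Bs ⊆ equivalences Bs As
equivalences-sym []       []       ()
equivalences-sym (A ∷ As) (B ∷ Bs) (here refl)         = there (here refl)
equivalences-sym (A ∷ As) (B ∷ Bs) (there (here refl)) = here refl
equivalences-sym (A ∷ As) (B ∷ Bs) (there (there x))   = there (there (equivalences-sym As Bs x))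

-- Abstract so that the numeral is never unfolded.
abstract

  overfullCost : ℕ
  overfullCost = 150000000500000

  overfullCost-≥ : 150000000500000 ≤ overfullCost
  overfullCost-≥ = ≤-refl

module Counting {n} (G : Graph n) (k : ℕ) where

  open Graph G using (adj)
  open Reduction G

  private
    F = Formula (Var n k)
    Γ = formulas (Φ G k)
    x : Fin n → Fin k → F
    x v j = var (X v j)

  Separated : (A B : Fin k → F) → Set
  Separated A B = equivalences (Vec.tabulate A) (Vec.tabulate B) ++ Γ ⊩ ⊥ᶠ within 2 ^ k * 300000000

  separated-sym : ∀ {A B} → Separated A B → Separated B A
  separated-sym {A} {B} = weaken-⊢ sub
    where
    sub : equivalences (Vec.tabulate A) (Vec.tabulate B) ++ Γ ⊆ equivalences (Vec.tabulate B) (Vec.tabulate A) ++ Γ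
    sub y∈ with ∈-++⁻ (equivalences (Vec.tabulate A) (Vec.tabulate B)) y∈
    ... | inj₁ z∈ = ∈-++⁺ˡ (equivalences-sym (Vec.tabulate A) (Vec.tabulate B) z∈)
    ... | inj₂ z∈ = ∈-++⁺ʳ (equivalences (Vec.tabulate B) (Vec.tabulate A)) z∈

  -- Some clique j covers the edge y z, so it is enough to contradict the equivalence of A j and B j
  -- for every such j. In the refutations passed to it, `h₀` to `h₃` start out as z ∈ V_j, y ∈ V_j,
  -- A j ⇒ B j and B j ⇒ A j.
  separate : ∀ {A B y z} → Edge G y z →
             (∀ j → x z j ∷ x y j ∷ (A j ⇒ B j) ∷ (B j ⇒ A j) ∷ Γ ⊩ ⊥ᶠ within 10000000) → Separated A B
  separate {A} {B} {y} {z} yz refute = relax (*-monoʳ-≤ (2 ^ k) numeral-≤)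
    (edge-covered G yz (∈-++⁺ʳ E) λ j → ⇒I (⇒I (weaken-⊢ (sub j) (refute j))))
    where
    E = equivalences (Vec.tabulate A) (Vec.tabulate B)
    lookups : ∀ {A B : Fin k → F} j → (Vec.lookup (Vec.tabulate A) j ⇒ Vec.lookup (Vec.tabulate B) j) ≡ (A j ⇒ B j)
    lookups {A} {B} j = cong₂ _⇒_ (Vec.lookup∘tabulate A j) (Vec.lookup∘tabulate B j)
    sub : ∀ j → x z j ∷ x y j ∷ (A j ⇒ B j) ∷ (B j ⇒ A j) ∷ Γ ⊆ x z j ∷ x y j ∷ E ++ Γ
    sub j (here refl)                         = here refl
    sub j (there (here refl))                 = there (here refl)
    sub j (there (there (here refl)))         = there (there (∈-++⁺ˡ
      (subst (_∈ E) (lookups {A} {B} j) (equivalences∋⇒ (Vec.tabulate A) (Vec.tabulate B) j))))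
    sub j (there (there (there (here refl)))) = there (there (∈-++⁺ˡ
      (subst (_∈ E) (lookups {B} {A} j) (equivalences∋⇐ (Vec.tabulate A) (Vec.tabulate B) j))))
    sub j (there (there (there (there y∈))))  = there (there (∈-++⁺ʳ E y∈))

  disjoint : ∀ {v w Γ′} → closed v w ≡ false → Γ ⊆ Γ′ → ∀ j → Γ′ ⊩ x v j ⇒ x w j ⇒ ⊥ᶠ within 200000
  disjoint {v} vw sub j = weaken-⊢ sub (nonadjacent-exclusive G v≢w (trans (sym (closed-≢ v≢w)) vw) j)
    where
    v≢w = λ { refl → case trans (sym vw) (closed-refl v) of λ () }

  complete-closed : ∀ {v w} → Complete v → ¬ Twin w v → closed v w ≡ false
  complete-closed {w = w} c ¬t = Bool.¬-not (¬t ∘ c w)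

  skip₄ : ∀ {A B C D : F} {Θ} → Θ ⊆ A ∷ B ∷ C ∷ D ∷ Θ
  skip₄ = there ∘ there ∘ there ∘ there

  -- If the sets agreed, q would lie in every clique of p. A clique covering the edge p w would then
  -- contain the nonadjacent vertices q and w. If w is p itself, any clique covering an edge at p
  -- gives the contradiction.
  separate-distinguished : ∀ {p q w} → Kept p → closed p w ≡ true → closed q w ≡ false → Separated (x p) (x q)
  separate-distinguished {p} {q} {w} kp pw qw with p Fin.≟ w
  ... | yes refl =
    let (y , py) = kept-nonisolated kp
    in separate py λ j → relaxed (⇒E (⇒E (disjoint qw skip₄ j) (⇒E h₂ h₁)) h₁)
  ... | no p≢w =
    separate pw λ j → relaxed (⇒E (⇒E (disjoint qw skip₄ j) (⇒E h₂ h₁)) h₀)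

  separate-nontwins : ∀ {p q} → Kept p → Kept q → ¬ Twin p q → Separated (x p) (x q)
  separate-nontwins {p} {q} kp kq ¬t
    with Fin.¬∀⟶∃¬ n _ (λ w → closed p w Bool.≟ closed q w) (¬t ∘ closed-twin)
  ... | w , pw≢qw with closed p w in pw | closed q w in qw
  ... | true  | true  = contradiction refl pw≢qw
  ... | true  | false = separate-distinguished kp pw qw
  ... | false | true  = separated-sym {x q} {x p} (separate-distinguished kq qw pw)
  ... | false | false = contradiction refl pw≢qw

  Last : Fin n → Set
  Last v = Earlier v × ¬ Later v × Complete v

  last-kept : ∀ {v} → Last v → Kept v
  last-kept (e , ¬l , c) = last e ¬l c

  -- With T(v) = {i : v ∈ V_i}, the cliques of T(v) meet only the class of v if
  -- that class is a component.  So for b and w ≠ b last in two components, no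
  -- first vertex has the set T(w) ∪ T(b), and b itself can take the empty set.
  module Occupants (b : Fin n) (b-last : Last b) where

    occupant : Fin n → Fin k → F
    occupant w j = if does (w Fin.≟ b) then ⊥ᶠ else (if does (earlier? w) then x w j ∨ᶠ x b j else x w j)

    lasts-disjoint : ∀ {v w} → Last v → Last w → v ≢ w → closed v w ≡ false
    lasts-disjoint (_ , ¬l , c) (_ , ¬l′ , _) v≢w = complete-closed c (v≢w ∘ sym ∘ lasts-≡ ¬l′ ¬l)

    data Role (w : Fin n) : (Fin k → F) → Set where
      spare : w ≡ b → Role w (λ _ → ⊥ᶠ)
      lasts : w ≢ b → Last w → Role w (λ j → x w j ∨ᶠ x b j)
      firsts : ¬ Earlier w → Kept w → Role w (x w)

    separate-roles : ∀ {p q A B} → p ≢ q → Role p A → Role q B → Separated A B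
    separate-roles p≢q (spare p≡b) (spare q≡b) = contradiction (trans p≡b (sym q≡b)) p≢q
    separate-roles p≢q (spare p≡b) (lasts _ lq) =
      separate (proj₂ (kept-nonisolated (last-kept lq))) λ j → relaxed (⇒E h₃ (∨I₁ h₁))
    separate-roles p≢q (spare p≡b) (firsts _ kq) =
      separate (proj₂ (kept-nonisolated kq)) λ j → relaxed (⇒E h₃ h₁)
    -- The vertices p, q and b belong to three different components, so a clique of p contains
    -- neither q nor b.
    separate-roles p≢q (lasts p≢b lp) (lasts q≢b lq) =
      separate (proj₂ (kept-nonisolated (last-kept lp))) λ j → relaxed
        (∨E (⇒E h₂ (∨I₁ h₁))
          (⇒E (⇒E (disjoint (lasts-disjoint lp lq p≢q) (there ∘ skip₄) j) h₂) h₀)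
          (⇒E (⇒E (disjoint (lasts-disjoint lp b-last p≢b) (there ∘ skip₄) j) h₂) h₀))
    -- The first vertex q cannot belong to the components of both p and b. Equality would put q into
    -- a clique of whichever of the two lies in another component.
    separate-roles {p} {q} p≢q (lasts p≢b lp) (firsts ¬e kq) with twin? q b
    ... | yes t = separate (proj₂ (kept-nonisolated (last-kept lp))) λ j → relaxed
        (⇒E (⇒E (disjoint (complete-closed (proj₂ (proj₂ lp)) ¬t) skip₄ j) h₁) (⇒E h₂ (∨I₁ h₁)))
      where
      ¬t : ¬ Twin q p
      ¬t t′ = p≢b (lasts-≡ (proj₁ (proj₂ lp)) (proj₁ (proj₂ b-last)) (trans (sym t′) t))
    ... | no ¬t = separate (proj₂ (kept-nonisolated (last-kept b-last))) λ j → relaxed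
        (⇒E (⇒E (disjoint (complete-closed (proj₂ (proj₂ b-last)) ¬t) skip₄ j) h₁) (⇒E h₂ (∨I₂ h₁)))
    separate-roles p≢q (firsts ¬e kp) (firsts ¬e′ kq) =
      separate-nontwins kp kq (p≢q ∘ firsts-≡ ¬e ¬e′)
    separate-roles p≢q r@(lasts _ _) s@(spare _)    = separated-sym (separate-roles (p≢q ∘ sym) s r)
    separate-roles p≢q r@(firsts _ _) s@(spare _)   = separated-sym (separate-roles (p≢q ∘ sym) s r)
    separate-roles p≢q r@(firsts _ _) s@(lasts _ _) = separated-sym (separate-roles (p≢q ∘ sym) s r)

    role : ∀ {w} → Kept w → Role w (occupant w)
    role {w} kw with w Fin.≟ b | earlier? w | kw
    ... | yes w≡b | _     | _             = spare w≡b
    ... | no w≢b  | yes e | last e′ ¬l c  = lasts w≢b (e′ , ¬l , c)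
    ... | no w≢b  | yes e | first ¬e _    = contradiction e ¬e
    ... | no w≢b  | no ¬e | _             = firsts ¬e kw

  kept-separable : Σ[ S ∈ (Fin n → Fin k → F) ] (∀ {p q} → Kept p → Kept q → p ≢ q → Separated (S p) (S q))
  kept-separable with Fin.any? (λ v → earlier? v ×-dec (¬? (later? v) ×-dec complete? v))
  ... | yes (b , b-last) = let open Occupants b b-last in
    occupant , λ kp kq p≢q → separate-roles p≢q (role kp) (role kq)
  ... | no none = x , λ kp kq p≢q → separate-nontwins kp kq (p≢q ∘ firsts-≡ (¬earlier kp) (¬earlier kq))
    where
    ¬earlier : ∀ {v} → Kept v → ¬ Earlier v
    ¬earlier (first ¬e _)   = ¬e
    ¬earlier (last e ¬l c) _ = none (_ , e , ¬l , c)

  overfull-refutation : 2 ^ k < length kept → Γ ⊩ ⊥ᶠ within (2 ^ k) ^ 5 * overfullCost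
  overfull-refutation overfull with kept-separable
  ... | S , separated = relax (bound (2 ^ k) (1≤2^ k))
    (binary-pigeonhole (Vec.tabulate ∘ S) ps size≡ λ {p} {q} pq∈ →
      separated (∈-kept⁻ (ps⊆ (proj₁ (pairs-∈ ps pq∈)))) (∈-kept⁻ (ps⊆ (proj₂ (pairs-∈ ps pq∈))))
                (pairs-distinct (Unique.take⁺ (suc (2 ^ k)) kept-unique) pq∈))
    where
    -- Just one pigeon more than there are holes, so that the size depends on k alone and not on the
    -- graph.
    ps = take (suc (2 ^ k)) kept
    size≡ : length ps ≡ suc (2 ^ k)
    size≡ = trans (List.length-take (suc (2 ^ k)) kept) (m≤n⇒m⊓n≡m overfull)
    ps⊆ : ps ⊆ kept
    ps⊆ {v} v∈ = subst (v ∈_) (List.take++drop≡id (suc (2 ^ k)) kept) (∈-++⁺ˡ v∈)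
    -- Replacing the summand 1 by w gives the factor w · 300000001, and 300000001 · 500000 is the
    -- value of `overfullCost`.
    bound : ∀ w → 1 ≤ w → w * w * (w * w) * (w * 300000000 + 1) * 500000 ≤ w ^ 5 * overfullCost
    bound w 1≤w = begin
      w * w * (w * w) * (w * 300000000 + 1) * 500000
        ≤⟨ *-monoˡ-≤ 500000 (*-monoʳ-≤ (w * w * (w * w)) (+-monoʳ-≤ (w * 300000000) 1≤w)) ⟩
      w * w * (w * w) * (w * 300000000 + w) * 500000
        ≡⟨ eq w ⟩
      w ^ 5 * 150000000500000
        ≤⟨ *-monoʳ-≤ (w ^ 5) overfullCost-≥ ⟩
      w ^ 5 * overfullCost ∎
      where
      open ≤-Reasoning
      eq : ∀ w → w * w * (w * w) * (w * 300000000 + w) * 500000 ≡ w * (w * (w * (w * (w * 1)))) * 150000000500000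
      eq = solve-∀

-- Soundness of Frege proofs

eval : ∀ {V} → (V → Bool) → Formula V → Bool
eval ρ (var v)  = ρ v
eval ρ ⊥ᶠ       = false
eval ρ (A ⇒ B)  = not (eval ρ A) ∨ eval ρ B
eval ρ (A ∧ᶠ B) = eval ρ A ∧ eval ρ B
eval ρ (A ∨ᶠ B) = eval ρ A ∨ eval ρ B

axiom-valid : ∀ {V A} (ρ : V → Bool) → Axiom A → eval ρ A ≡ true
axiom-valid ρ (weaken A B) with eval ρ A | eval ρ B
... | false | _     = refl
... | true  | false = refl
... | true  | true  = refl
axiom-valid ρ (compose A B C) with eval ρ A | eval ρ B | eval ρ C
... | false | false | _     = refl
... | false | true  | _     = refl
... | true  | false | _     = refl
... | true  | true  | false = refl
... | true  | true  | true  = refl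
axiom-valid ρ (pair A B) with eval ρ A | eval ρ B
... | false | _     = refl
... | true  | false = refl
... | true  | true  = refl
axiom-valid ρ (first A B) with eval ρ A | eval ρ B
... | false | _     = refl
... | true  | false = refl
... | true  | true  = refl
axiom-valid ρ (second A B) with eval ρ A | eval ρ B
... | false | _     = refl
... | true  | false = refl
... | true  | true  = refl
axiom-valid ρ (left A B) with eval ρ A | eval ρ B
... | false | _     = refl
... | true  | _     = refl
axiom-valid ρ (right A B) with eval ρ A | eval ρ B
... | false | false = refl
... | true  | false = refl
... | false | true  = refl
... | true  | true  = refl
axiom-valid ρ (cases A B C) with eval ρ A | eval ρ B | eval ρ C
... | false | false | _     = refl
... | false | true  | false = refl
... | false | true  | true  = refl
... | true  | _     | false = refl
... | true  | false | true  = refl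
... | true  | true  | true  = refl
axiom-valid ρ (stable A) with eval ρ A
... | false = refl
... | true  = refl

frege-sound : ∀ {V Γ Δ} (ρ : V → Bool) → (∀ {A} → A ∈ Γ → eval ρ A ≡ true) → Frege Γ Δ →
              ∀ {A} → A ∈ Δ → eval ρ A ≡ true
frege-sound ρ sat (hypothesis A∈ π)    (here refl) = sat A∈
frege-sound ρ sat (axiomatic a π)      (here refl) = axiom-valid ρ a
frege-sound ρ sat (modus-ponens x y π) (here refl)
  with frege-sound ρ sat π x
... | p rewrite frege-sound ρ sat π y = p
frege-sound ρ sat (hypothesis _ π)     (there A∈) = frege-sound ρ sat π A∈
frege-sound ρ sat (axiomatic _ π)      (there A∈) = frege-sound ρ sat π A∈
frege-sound ρ sat (modus-ponens _ _ π) (there A∈) = frege-sound ρ sat π A∈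

clause-true : ∀ {V} (ρ : V → Bool) {C l} → l ∈ C → eval ρ (literalFormula l) ≡ true →
              eval ρ (clauseFormula C) ≡ true
clause-true ρ (here refl) p rewrite p = refl
clause-true ρ (there l∈)  p rewrite clause-true ρ l∈ p = Bool.∨-zeroʳ _

distribute-true : ∀ {V} (ρ : V → Bool) {ds a b C} → (a , b) ∈ ds →
                  eval ρ (literalFormula a) ≡ true → eval ρ (literalFormula b) ≡ true →
                  C ∈ distribute ds → eval ρ (clauseFormula C) ≡ true
distribute-true ρ {d ∷ ds} ab∈ a b C∈
  with ∈-cartesianProductWith⁻ _∷_ (proj₁ d ∷ proj₂ d ∷ []) (distribute ds) C∈ | ab∈
... | _ , D , here refl , D∈ , refl         | here refl = clause-true ρ {proj₁ d ∷ D} {proj₁ d} (here refl) a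
... | _ , D , there (here refl) , D∈ , refl | here refl = clause-true ρ {proj₂ d ∷ D} {proj₂ d} (here refl) b
... | l , D , _ , D∈ , refl                 | there ab∈′
  rewrite distribute-true ρ ab∈′ a b D∈ = Bool.∨-zeroʳ _

Φ-satisfied : ∀ {n} (G : Graph n) {k} → EdgeCliqueCover G k →
              ∃[ ρ ] (∀ {A} → A ∈ formulas (Φ G k) → eval ρ A ≡ true)
Φ-satisfied {n} G {k} (V , cliques , covers) = ρ , sat
  where
  ρ : Var n k → Bool
  ρ (Y v w) = Graph.adj G v w
  ρ (X v i) = Vec.lookup (V i) v

  triangle : ∀ v w i → v ≢ w → eval ρ (clauseFormula (neg (X v i) ∷ neg (X w i) ∷ pos (Y v w) ∷ [])) ≡ true
  triangle v w i v≢w with Vec.lookup (V i) v in v∈ | Vec.lookup (V i) w in w∈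
  ... | false | _     = refl
  ... | true  | false = refl
  ... | true  | true
    rewrite cliques i v w (Vec.lookup⇒[]= v (V i) v∈) (Vec.lookup⇒[]= w (V i) w∈) v≢w = refl

  cover : ∀ v w {C} → C ∈ distribute (memberships v w) → eval ρ (clauseFormula (neg (Y v w) ∷ C)) ≡ true
  cover v w {C} C∈ with Graph.adj G v w in vw
  ... | false = refl
  ... | true  = let (i , v∈ , w∈) = covers v w vw in
    distribute-true ρ {memberships v w} (∈-map⁺ _ (∈-allFin i)) (Vec.[]=⇒lookup v∈) (Vec.[]=⇒lookup w∈) C∈

  clause : ∀ {v w C} → v ≢ w → C ∈ clausesOf G k (v , w) → eval ρ (clauseFormula C) ≡ true
  clause {v} {w} v≢w (here refl) with Graph.adj G v w in vw
  ... | true  rewrite vw = refl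
  ... | false rewrite vw = refl
  clause {v} {w} v≢w (there C∈)
    with ∈-++⁻ (triangles v w) C∈
  ... | inj₁ C∈′ with ∈-map⁻ _ C∈′
  ... | i , _ , refl = triangle v w i v≢w
  clause {v} {w} v≢w (there C∈) | inj₂ C∈′ with ∈-map⁻ _ C∈′
  ... | D , D∈ , refl = cover v w D∈

  sat : ∀ {A} → A ∈ formulas (Φ G k) → eval ρ A ≡ true
  sat A∈ with ∈-map⁻ clauseFormula A∈
  ... | C , C∈ , refl with find (∈-concatMap⁻ (clausesOf G k) {xs = distinctPairs n} C∈)
  ... | (v , w) , vw∈ , C∈′ = clause (distinctPairs⁻ vw∈) C∈′

-- Lets the refutation of overfull instances serve also as the proof that they are negative, so that
-- the counting need not be repeated for actual covers.
refuted-negative : ∀ {n} (G : Graph n) {k s} → formulas (Φ G k) ⊩ ⊥ᶠ within s → ¬ EdgeCliqueCover G k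
refuted-negative G (Δ , π , ⊥∈ ∷ [] , _) cover with Φ-satisfied G cover
... | ρ , sat = case frege-sound ρ sat π ⊥∈ of λ ()

-- Negative instances for a fixed parameter

treeSize : ℕ → ℕ → ℕ
treeSize zero    s = s
treeSize (suc m) s = suc (treeSize m s * 5 + treeSize m s * 5)

treeSize-suc : ∀ m s → treeSize m s ≤ treeSize (suc m) s
treeSize-suc m s = ≤-trans (m≤m*n (treeSize m s) 5)
  (≤-trans (m≤m+n (treeSize m s * 5) (treeSize m s * 5)) (n≤1+n _))

treeSize-mono : ∀ {m m′} s → m ≤ m′ → treeSize m s ≤ treeSize m′ s
treeSize-mono s m≤m′ = go (≤⇒≤′ m≤m′)
  where
  go : ∀ {m m′} → m ≤′ m′ → treeSize m s ≤ treeSize m′ s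
  go ≤′-refl       = ≤-refl
  go (≤′-step m≤m′) = ≤-trans (go m≤m′) (treeSize-suc _ s)

Decided : ∀ {V} → List (Formula V) → Formula V → Set
Decided Λ A = A ∈ Λ ⊎ ¬ᶠ A ∈ Λ

-- The formulas are queried one by one, and a leaf receives the answers on its branch as the list Λ.
decision-tree : ∀ {V} (As : List (Formula V)) {Γ s} →
                (∀ Λ → All (Decided Λ) As → Λ ++ Γ ⊩ ⊥ᶠ within s) →
                Γ ⊩ ⊥ᶠ within treeSize (length As) s
decision-tree []       leaf = leaf [] []
decision-tree (A ∷ As) {Γ} {s} leaf = by-cases A (branch inj₁) (branch inj₂)
  where
  branch : ∀ {B} → (∀ {Λ} → B ∈ Λ → Decided Λ A) → B ∷ Γ ⊩ ⊥ᶠ within treeSize (length As) s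
  branch {B} decided = decision-tree As λ Λ ds →
    subst (λ Γ′ → Γ′ ⊩ ⊥ᶠ within s) (List.++-assoc Λ (B ∷ []) Γ)
      (leaf (Λ ++ B ∷ []) (decided (∈-++⁺ʳ Λ (here refl)) ∷
        All.map (λ { (inj₁ A∈) → inj₁ (∈-++⁺ˡ A∈) ; (inj₂ A∈) → inj₂ (∈-++⁺ˡ A∈) }) ds))

module _ {n} (G : Graph n) (k : ℕ) {L : List (Fin n)} (unique : Unique L)
         (negative : ¬ EdgeCliqueCover (induced G L) k) where

  private
    Γ = formulas (Φ G k)
    H = induced G L
    ι = List.lookup L
    vertexPairs = cartesianProduct (allFin (length L)) (allFin k)
    x : Fin (length L) × Fin k → Formula (Var n k)
    x (a , i) = var (X (ι a) i)

    module Leaf (Λ : List (Formula (Var n k))) (decided : All (Decided Λ) (map x vertexPairs)) where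

      Θ = Λ ++ Γ

      decide : ∀ a i → Decided Λ (x (a , i))
      decide a i = All.lookup decided (∈-map⁺ x (∈-cartesianProduct⁺ (∈-allFin a) (∈-allFin i)))

      _∈ᵇ_ : Fin (length L) → Fin k → Bool
      a ∈ᵇ i = case decide a i of λ { (inj₁ _) → true ; (inj₂ _) → false }

      chosen : ∀ {a i} → (a ∈ᵇ i) ≡ true → x (a , i) ∈ Λ
      chosen {a} {i} p with decide a i
      ... | inj₁ x∈ = x∈

      rejected : ∀ {a i} → (a ∈ᵇ i) ≢ true → ¬ᶠ x (a , i) ∈ Λ
      rejected {a} {i} p with decide a i
      ... | inj₁ _   = contradiction refl p
      ... | inj₂ ¬x∈ = ¬x∈

      -- The answers describe sets V_i in the induced graph. As that graph has no cover, either some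
      -- V_i contains two nonadjacent vertices or some edge is in none of them, and the clauses for
      -- that pair are violated.
      refutation : Θ ⊩ ⊥ᶠ within 2 ^ k * 300000
      refutation
        with Fin.any? (λ i → Fin.any? (λ a → Fin.any? (λ b → ((a ∈ᵇ i) Bool.≟ true) ×-dec
               (((b ∈ᵇ i) Bool.≟ true) ×-dec (¬? (a Fin.≟ b) ×-dec (Graph.adj H a b Bool.≟ false))))))
      ... | yes (i , a , b , a∈ , b∈ , a≢b , ab) = relax (≤-trans numeral-≤ (*-monoˡ-≤ 300000 (1≤2^ k)))
        (⇒E (⇒E (weaken-⊢ (∈-++⁺ʳ Λ) (nonadjacent-exclusive G (a≢b ∘ lookup-injective unique) ab i))
          (hyp (∈-++⁺ˡ (chosen a∈)))) (hyp (∈-++⁺ˡ (chosen b∈))))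
      ... | no cliques
        with Fin.any? (λ a → Fin.any? (λ b → (Graph.adj H a b Bool.≟ true) ×-dec
               Fin.all? (λ i → ¬? (((a ∈ᵇ i) Bool.≟ true) ×-dec ((b ∈ᵇ i) Bool.≟ true)))))
      ... | yes (a , b , ab , uncovered) = relax (*-monoʳ-≤ (2 ^ k) numeral-≤)
        (edge-covered G ab (∈-++⁺ʳ Λ) exclusive)
        where
        exclusive : ∀ i → Θ ⊩ x (a , i) ⇒ x (b , i) ⇒ ⊥ᶠ within 100
        exclusive i with (a ∈ᵇ i) Bool.≟ true
        ... | no a∉  = relaxed (⇒I (⇒I (⇒E (hyp (there (there (∈-++⁺ˡ (rejected a∉))))) h₁)))
        ... | yes a∈ = relaxed (⇒I (⇒I (⇒E (hyp (there (there (∈-++⁺ˡ (rejected (uncovered i ∘ (a∈ ,_))))))) h₀)))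
      ... | no covers = contradiction
        ((λ i → Vec.tabulate (_∈ᵇ i)) ,
         (λ i a b a∈ b∈ a≢b → Bool.¬-not λ ab → cliques (i , a , b , ∈-subset⁻ a∈ , ∈-subset⁻ b∈ , a≢b , ab)) ,
         (λ a b ab → covered a b ab)) negative
        where
        covered : ∀ a b → Edge H a b →
                  ∃[ i ] (a Subset.∈ Vec.tabulate (_∈ᵇ i) × b Subset.∈ Vec.tabulate (_∈ᵇ i))
        covered a b ab with Fin.any? (λ i → ((a ∈ᵇ i) Bool.≟ true) ×-dec ((b ∈ᵇ i) Bool.≟ true))
        ... | yes (i , a∈ , b∈) = i , ∈-subset⁺ a∈ , ∈-subset⁺ b∈
        ... | no none           = contradiction (a , b , ab , λ i p → none (i , p)) covers

  induced-refutation : Γ ⊩ ⊥ᶠ within treeSize (length L * k) (2 ^ k * 300000)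
  induced-refutation = relax (≤-reflexive (cong (λ m → treeSize m (2 ^ k * 300000)) size≡))
    (decision-tree (map x vertexPairs) Leaf.refutation)
    where
    size≡ : length (map x vertexPairs) ≡ length L * k
    size≡ = begin
      length (map x vertexPairs)                    ≡⟨ List.length-map x vertexPairs ⟩
      length vertexPairs                            ≡⟨ length-cartesianProductWith _,_ (allFin (length L)) (allFin k) ⟩
      length (allFin (length L)) * length (allFin k)
        ≡⟨ cong₂ _*_ (List.length-tabulate {n = length L} id) (List.length-tabulate {n = k} id) ⟩
      length L * k                                  ∎
      where open ≡-Reasoning

refutationSize : ℕ → ℕ
refutationSize k = (2 ^ k) ^ 5 * overfullCost + treeSize (2 ^ k * k) (2 ^ k * 300000)

negative-refutation : ∀ {n} (G : Graph n) k → ¬ EdgeCliqueCover G k →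
                      formulas (Φ G k) ⊩ ⊥ᶠ within refutationSize k
negative-refutation G k negative with 2 ^ k <? length (Reduction.kept G)
... | yes overfull = relax (m≤m+n _ _) (Counting.overfull-refutation G k overfull)
... | no fits      = relax
  (≤-trans (treeSize-mono _ (*-monoˡ-≤ k (≮⇒≥ fits))) (m≤n+m _ _))
  (induced-refutation G k (Reduction.kept-unique G) (negative ∘ Reduction.kept-cover G))

-- Serves to move refutations to the variables `V ⊎ ℕ` of extended Frege proofs; the number of lines
-- is preserved.
instantiate : ∀ {V W Γ Δ} (σ : V → Formula W) → Frege Γ Δ → Frege (map (_[ σ ]) Γ) (map (_[ σ ]) Δ)
instantiate σ start                = start
instantiate σ (hypothesis A∈ π)    = hypothesis (∈-map⁺ (_[ σ ]) A∈) (instantiate σ π)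
instantiate σ (axiomatic a π)      = axiomatic (ax-instance a) (instantiate σ π)
  where
  ax-instance : ∀ {A} → Axiom A → Axiom (A [ σ ])
  ax-instance (weaken A B)    = weaken _ _
  ax-instance (compose A B C) = compose _ _ _
  ax-instance (pair A B)      = pair _ _
  ax-instance (first A B)     = first _ _
  ax-instance (second A B)    = second _ _
  ax-instance (left A B)      = left _ _
  ax-instance (right A B)     = right _ _
  ax-instance (cases A B C)   = cases _ _ _
  ax-instance (stable A)      = stable _
instantiate σ (modus-ponens x y π) =
  modus-ponens (∈-map⁺ (_[ σ ]) x) (∈-map⁺ (_[ σ ]) y) (instantiate σ π)

clauseFormula-rename : ∀ {V W} (ρ : V → W) C →
                       clauseFormula (map (renameLiteral ρ) C) ≡ clauseFormula C [ (λ v → var (ρ v)) ]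
clauseFormula-rename ρ []          = refl
clauseFormula-rename ρ (pos v ∷ C) = cong (var (ρ v) ∨ᶠ_) (clauseFormula-rename ρ C)
clauseFormula-rename ρ (neg v ∷ C) = cong ((var (ρ v) ⇒ ⊥ᶠ) ∨ᶠ_) (clauseFormula-rename ρ C)

formulas-rename : ∀ {V W} (ρ : V → W) Ψ → formulas (rename ρ Ψ) ≡ map (_[ (λ v → var (ρ v)) ]) (formulas Ψ)
formulas-rename ρ []      = refl
formulas-rename ρ (C ∷ Ψ) = cong₂ _∷_ (clauseFormula-rename ρ C) (formulas-rename ρ Ψ)

extended : ∀ {V} {Γ Δ : List (Formula V)} → Frege Γ Δ → ExtendedFrege Γ Δ
extended start                = start
extended (hypothesis A∈ π)    = hypothesis A∈ (extended π)
extended (axiomatic a π)      = axiomatic a (extended π)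
extended (modus-ponens x y π) = modus-ponens x y (extended π)

extended-refutation : ∀ {V s} {Ψ : CNF V} → FregeRefutation Ψ s → ExtendedFregeRefutation Ψ s
extended-refutation {V} {Ψ = Ψ} (Δ , π , ⊥∈ ∷ [] , size≡) =
  map (_[ σ ]) Δ ,
  extended (subst (λ Γ → Frege Γ (map (_[ σ ]) Δ)) (sym (formulas-rename inj₁ Ψ)) (instantiate σ π)) ,
  ∈-map⁺ (_[ σ ]) ⊥∈ ,
  trans (List.length-map (_[ σ ]) Δ) size≡
  where
  σ : V → Formula (V ⊎ ℕ)
  σ v = var (inj₁ v)

fixed-parameter : (k : ℕ) →
  (Σ[ p ∈ Polynomial ] (∀ {n} (G : Graph n) → ¬ EdgeCliqueCover G k →
    ∃[ s ] (ExtendedFregeRefutation (Φ G k) s × s ≤ ⟦ p ⟧ (length (Φ G k)))))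
  × (∃[ f ] (Quasipolynomial f × (∀ {n} (G : Graph n) → ¬ EdgeCliqueCover G k →
    ∃[ s ] (FregeRefutation (Φ G k) s × s ≤ f (length (Φ G k))))))
fixed-parameter k =
  (refutationSize k ∷ [] , λ G negative →
    let (Δ , π , g , l) = negative-refutation G k negative in
    length Δ , extended-refutation (Δ , π , g , refl) , ≤-trans l (m≤m+n (refutationSize k) _)) ,
  ((λ _ → refutationSize k) ,
   -- A constant is quasipolynomial: with B = 0 the power of two is 1, and c = 1 is the least
   -- exponent allowed.
   (1 , ≤-refl , refutationSize k , 0 , 0 , λ _ _ → ≤-reflexive (sym (*-identityʳ (refutationSize k)))) ,
   λ G negative → let (Δ , π , g , l) = negative-refutation G k negative in length Δ , (Δ , π , g , refl) , l)

-- Witnesses for the reduction steps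

rename-id : ∀ {V} (Ψ : CNF V) → rename id Ψ ≡ Ψ
rename-id Ψ = trans (List.map-cong (λ C → trans (List.map-cong literal C) (List.map-id C)) Ψ) (List.map-id Ψ)
  where
  literal : ∀ {V} (l : Literal V) → renameLiteral id l ≡ l
  literal (pos v) = refl
  literal (neg v) = refl

literals : ∀ {V W} → (V → W) → Literal V × Literal V → Clause W
literals ρ (a , b) = renameLiteral ρ a ∷ renameLiteral ρ b ∷ []

distribute-rename : ∀ {V W} (ρ : V → W) {ds C} → C ∈ distribute ds →
                    map (renameLiteral ρ) C ∈ distribute (map (λ (a , b) → renameLiteral ρ a , renameLiteral ρ b) ds)
distribute-rename ρ {[]}    (here refl) = here refl
distribute-rename ρ {d ∷ ds} C∈
  with ∈-cartesianProductWith⁻ _∷_ (proj₁ d ∷ proj₂ d ∷ []) (distribute ds) C∈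
... | _ , D , here refl , D∈ , refl         =
  ∈-cartesianProductWith⁺ _∷_ {xs = literals ρ d} (here refl) (distribute-rename ρ {ds} D∈)
... | _ , D , there (here refl) , D∈ , refl =
  ∈-cartesianProductWith⁺ _∷_ {xs = literals ρ d} (there (here refl)) (distribute-rename ρ {ds} D∈)

module _ {n} (G : Graph n) {L : List (Fin n)} (unique : Unique L) {k : ℕ} where

  private
    H = induced G L
    ι = List.lookup L

  embed : Var (length L) k → Var n k
  embed (Y a b) = Y (ι a) (ι b)
  embed (X a i) = X (ι a) i

  clausesOf-induced : ∀ {a b C} → C ∈ clausesOf H k (a , b) →
                      map (renameLiteral embed) C ∈ clausesOf G k (ι a , ι b)
  clausesOf-induced {a} {b} (here refl) with Graph.adj G (ι a) (ι b)
  ... | true  = here refl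
  ... | false = here refl
  clausesOf-induced {a} {b} (there C∈)
    with ∈-++⁻ (triangles a b) C∈
  ... | inj₁ C∈′ with ∈-map⁻ _ C∈′
  ... | i , i∈ , refl = there (∈-++⁺ˡ (∈-map⁺ (λ i → neg (X (ι a) i) ∷ neg (X (ι b) i) ∷ pos (Y (ι a) (ι b)) ∷ []) i∈))
  clausesOf-induced {a} {b} (there C∈) | inj₂ C∈′ with ∈-map⁻ _ C∈′
  ... | D , D∈ , refl = there (∈-++⁺ʳ (triangles (ι a) (ι b))
    (∈-map⁺ (neg (Y (ι a) (ι b)) ∷_)
      (subst (λ ds → map (renameLiteral embed) D ∈ distribute ds) (sym (List.map-∘ (allFin k)))
        (distribute-rename embed {memberships a b} D∈))))

  Φ-induced : ∀ {C} → C ∈ Φ H k → map (renameLiteral embed) C ∈ Φ G k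
  Φ-induced C∈ with find (∈-concatMap⁻ (clausesOf H k) {xs = distinctPairs (length L)} C∈)
  ... | (a , b) , ab∈ , C∈′ = Φ∋ G (distinctPairs⁻ ab∈ ∘ lookup-injective unique) (clausesOf-induced C∈′)

  formulas-induced : ∀ {A} → A ∈ map (_[ (λ v → var (embed v)) ]) (formulas (Φ H k)) → A ∈ formulas (Φ G k)
  formulas-induced A∈ with ∈-map⁻ _ A∈
  ... | _ , B∈ , refl with ∈-map⁻ clauseFormula B∈
  ... | C , C∈ , refl = subst (_∈ formulas (Φ G k)) (clauseFormula-rename embed C)
    (∈-map⁺ clauseFormula (Φ-induced C∈))

hypotheses : ∀ {V} (Γ : List (Formula V)) → Γ ⊢ Γ within length Γ
hypotheses Γ = relax (≤-reflexive (*-identityʳ (length Γ))) (each (All.tabulate hyp))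

clausesOf-length : ∀ {n} (G : Graph n) k vw → 2 ^ k ≤ length (clausesOf G k vw)
clausesOf-length G k (v , w) = m≤n⇒m≤1+n (begin
  2 ^ k                                ≡⟨ cong (2 ^_) (sym length-ds) ⟩
  2 ^ length ds                        ≡⟨ length-distribute ds ⟨
  length (distribute ds)               ≡⟨ List.length-map _ (distribute ds) ⟨
  length covers                        ≤⟨ m≤n+m _ (length (triangles {k = k} v w)) ⟩
  length (triangles {k = k} v w) + length covers     ≡⟨ List.length-++ (triangles {k = k} v w) ⟨
  length (triangles {k = k} v w ++ covers)         ∎)
  where
  open ≤-Reasoning
  ds = memberships {k = k} v w
  length-ds : length ds ≡ k
  length-ds = trans (List.length-map _ (allFin k)) (List.length-tabulate {n = k} id)
  covers = map (neg (Y v w) ∷_) (distribute ds)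

length-concatMap-≥ : ∀ {A B : Set} (f : A → List B) {x xs} → x ∈ xs → length (f x) ≤ length (concatMap f xs)
length-concatMap-≥ f {xs = y ∷ ys} (here refl) = ≤-trans (m≤m+n _ _) (≤-reflexive (sym (List.length-++ (f y))))
length-concatMap-≥ f {xs = y ∷ ys} (there x∈)  =
  ≤-trans (length-concatMap-≥ f x∈) (≤-trans (m≤n+m _ (length (f y))) (≤-reflexive (sym (List.length-++ (f y)))))

Φ-length : ∀ {n} (G : Graph n) k {v w} → v ≢ w → 2 ^ k ≤ length (Φ G k)
Φ-length G k v≢w = ≤-trans (clausesOf-length G k _) (length-concatMap-≥ (clausesOf G k) (distinctPairs⁺ v≢w))

-- No case distinction is required: the single alternative has the condition `⊤ᶠ`, and the next
-- instance is taken without renaming. At most 8 lines prove the tautology.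
step-witnessed : ∀ {x x′ s bound} (σ : InstanceVar x′ → Formula (InstanceVar x)) →
                 formulas (Φᴵ x) ⊢ map (_[ σ ]) (formulas (Φᴵ x′)) within s → 8 + s ≤ bound →
                 StepWitnessed 1 bound x x′
step-witnessed {x} {x′} {s} {bound} σ d s≤ with weaken-⊢ {Γ′ = ⊤ᶠ ∷ formulas (Φᴵ x)} there d
... | Δ , π , goals , l =
  stepCase ∷ [] , length Δ₀ , ≤-refl , (Δ₀ , π₀ , goals₀ , refl) ,
  ≤-trans (+-mono-≤ l₀ (≤-trans (≤-reflexive (+-identityʳ (length Δ))) l)) s≤
  where
  stepCase : StepCase x x′
  stepCase = record
    { Ξ          = ⊤ᶠ
    ; η          = Φᴵ x′
    ; isomorphic = id , id , sym (rename-id (Φᴵ x′))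
    ; caseSize   = length Δ
    ; witness    = σ , Δ , π , goals , refl
    }
  tautology : [] ⊩ ⋁ (⊤ᶠ ∷ []) within 8
  tautology = relaxed (∨I₁ ⊤I)
  Δ₀     = proj₁ tautology
  π₀     = proj₁ (proj₂ tautology)
  goals₀ = proj₁ (proj₂ (proj₂ tautology))
  l₀     = proj₂ (proj₂ (proj₂ tautology))

-- That is 100 + m + `overfullCost` · m⁵. A deletion step lists at most m clauses, a refusal costs
-- `overfullCost` · (2^k)⁵ with 2^k ≤ m, and 100 absorbs the fixed overhead.
soundnessPolynomial : Polynomial
soundnessPolynomial = 100 ∷ 1 ∷ 0 ∷ 0 ∷ 0 ∷ overfullCost ∷ []

soundnessPolynomial-≥ : ∀ m → m + m ^ 5 * overfullCost + 100 ≤ ⟦ soundnessPolynomial ⟧ m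
soundnessPolynomial-≥ m = ≤-reflexive (eq m overfullCost)
  where
  eq : ∀ m c → m + m * (m * (m * (m * (m * 1)))) * c + 100
       ≡ 100 + m * (1 + m * (0 + m * (0 + m * (0 + m * (c + m * 0)))))
  eq = solve-∀

induced-step : ∀ {n} (G : Graph n) k {L} → Unique L → let x = ⟨ G , k ⟩ in
               StepWitnessed 1 (⟦ soundnessPolynomial ⟧ ∣Φ x ∣) x ⟨ induced G L , k ⟩
induced-step G k {L} unique = step-witnessed {⟨ G , k ⟩} {⟨ induced G L , k ⟩} (λ v → var (embed G unique v))
  (let (Δ , π , goals , l) = hypotheses (formulas (Φ G k)) in
   Δ , π , All.tabulate (λ A∈ → All.lookup goals (formulas-induced G unique A∈)) , l)
  (≤-trans (+-monoʳ-≤ 8 (≤-reflexive (List.length-map clauseFormula (Φ G k))))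
    (≤-trans (bound m (m ^ 5 * overfullCost)) (soundnessPolynomial-≥ m)))
  where
  m = length (Φ G k)
  bound : ∀ m p → 8 + m ≤ m + p + 100
  bound m p = slack (p + 92) (eq m p)
    where
    eq : ∀ m p → 8 + m + (p + 92) ≡ m + p + 100
    eq = solve-∀

-- The kernelization program

module Bounded (P : Program) where

  open Program P
  open Semantics P

  Eval : ∀ {n} → Vec Tree n → Expr arity n → Tree → ℕ → Set
  Eval ρ e v T = ∃[ t ] (ρ ⊢ e ⇓ v ⟨ t ⟩ × t ≤ T)

  EvalAll : ∀ {n l} → Vec Tree n → Vec (Expr arity n) l → Vec Tree l → ℕ → Set
  EvalAll ρ es vs T = ∃[ t ] (ρ ⊢* es ⇓ vs ⟨ t ⟩ × t ≤ T)

  module _ {n} {ρ : Vec Tree n} where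

    within : ∀ {e v S T} → S ≤ T → Eval ρ e v S → Eval ρ e v T
    within S≤T (t , d , t≤S) = t , d , ≤-trans t≤S S≤T

    var! : ∀ {i} → Eval ρ (var i) (Vec.lookup ρ i) 1
    var! = 1 , var _ , ≤-refl

    nil! : Eval ρ nil nil 1
    nil! = 1 , nil , ≤-refl

    cons! : ∀ {e₁ e₂ a b S T} → Eval ρ e₁ a S → Eval ρ e₂ b T → Eval ρ (cons e₁ e₂) (a · b) (suc (S + T))
    cons! (_ , d , p) (_ , e , q) = _ , cons d e , s≤s (+-mono-≤ p q)

    case-nil! : ∀ {e e₁ e₂ v S T} → Eval ρ e nil S → Eval ρ e₁ v T → Eval ρ (case e e₁ e₂) v (suc (S + T))
    case-nil! (_ , d , p) (_ , e , q) = _ , case-nil d e , s≤s (+-mono-≤ p q)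

    case-cons! : ∀ {e e₁ e₂ a b v S T} → Eval ρ e (a · b) S → Eval (a ∷ b ∷ ρ) e₂ v T →
                 Eval ρ (case e e₁ e₂) v (suc (S + T))
    case-cons! (_ , d , p) (_ , e , q) = _ , case-cons d e , s≤s (+-mono-≤ p q)

    call! : ∀ {f es vs v S T} → EvalAll ρ es vs S → Eval vs (body f) v T → Eval ρ (call f es) v (suc (S + T))
    call! (_ , d , p) (_ , e , q) = _ , call d e , s≤s (+-mono-≤ p q)

    []! : EvalAll ρ [] [] 0
    []! = 0 , [] , ≤-refl

    infixr 5 _∷!_
    _∷!_ : ∀ {l e v S T} {es : Vec (Expr arity n) l} {vs} → Eval ρ e v S → EvalAll ρ es vs T →
           EvalAll ρ (e ∷ es) (v ∷ vs) (S + T)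
    (_ , d , p) ∷! (_ , e , q) = _ , d ∷ e , +-mono-≤ p q

    true! : Eval ρ (cons nil nil) (bitCode true) 3
    true! = cons! nil! nil!

kernelArity : Fin 14 → ℕ
kernelArity = Vec.lookup (2 ∷ 2 ∷ 3 ∷ 2 ∷ 2 ∷ 4 ∷ 3 ∷ 2 ∷ 3 ∷ 1 ∷ 2 ∷ 2 ∷ 1 ∷ 2 ∷ [])

pattern #0  = zero
pattern #1  = suc #0
pattern #2  = suc #1
pattern #3  = suc #2
pattern #4  = suc #3
pattern #5  = suc #4
pattern #6  = suc #5
pattern #7  = suc #6
pattern #8  = suc #7
pattern #9  = suc #8
pattern #10 = suc #9
pattern #11 = suc #10
pattern #12 = suc #11
pattern #13 = suc #12

pattern equal# = #0
pattern member# = #1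
pattern component# = #2
pattern setBit# = #3
pattern close# = #4
pattern keepRow# = #5
pattern mask# = #6
pattern pick# = #7
pattern prune# = #8
pattern halve# = #9
pattern fits# = #10
pattern restrict# = #11
pattern maskOf# = #12
pattern finish# = #13

module _ where

  private
    variable m : ℕ

    true# : Expr kernelArity m
    true# = cons nil nil

    not# : Expr kernelArity m → Expr kernelArity m
    not# e = case e true# nil

    x₀ : Expr kernelArity (1 + m)
    x₀ = var #0
    x₁ : Expr kernelArity (2 + m)
    x₁ = var #1
    x₂ : Expr kernelArity (3 + m)
    x₂ = var #2
    x₃ : Expr kernelArity (4 + m)
    x₃ = var #3
    x₄ : Expr kernelArity (5 + m)
    x₄ = var #4
    x₅ : Expr kernelArity (6 + m)
    x₅ = var #5
    x₆ : Expr kernelArity (7 + m)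
    x₆ = var #6
    x₇ : Expr kernelArity (8 + m)
    x₇ = var #7
    x₈ : Expr kernelArity (9 + m)
    x₈ = var #8

  -- K₂ with its adjacency matrix [01; 10], and parameter 0.
  noCode : Expr kernelArity m
  noCode = cons (cons (cons nil (cons true# nil)) (cons (cons true# (cons nil nil)) nil)) nil

  -- The arguments of a function are `x₀`, `x₁` and so on. The nonempty branch of a `case` has the
  -- head as `x₀` and the tail as `x₁`, with all older variables shifted by two.
  kernelBody : (f : Fin 14) → Expr kernelArity (kernelArity f)
  kernelBody equal# = case x₀ (case x₁ true# nil)
    (case x₃ nil (case (call equal# (x₂ ∷ x₀ ∷ [])) nil (call equal# (x₅ ∷ x₃ ∷ []))))
  kernelBody member# = case x₁ nil
    (case (call equal# (x₂ ∷ x₀ ∷ [])) (call member# (x₂ ∷ x₁ ∷ [])) true#)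
  kernelBody component# = case x₁ true# (case x₄ true#
    (case x₂ (call component# (x₄ ∷ x₃ ∷ x₁ ∷ []))
      (case (call equal# (x₆ ∷ x₂ ∷ [])) nil (call component# (x₈ ∷ x₇ ∷ x₅ ∷ [])))))
  kernelBody setBit# = case x₁ nil (case x₂ (cons true# x₁) (cons x₂ (call setBit# (x₁ ∷ x₃ ∷ []))))
  kernelBody close# = case x₁ nil (cons (call setBit# (x₂ ∷ x₀ ∷ [])) (call close# (cons nil x₂ ∷ x₁ ∷ [])))
  kernelBody keepRow# = case (call component# (x₀ ∷ x₀ ∷ x₃ ∷ []))
    (not# (call member# (x₀ ∷ x₁ ∷ [])))
    (case (call member# (x₂ ∷ x₃ ∷ [])) (call member# (x₂ ∷ x₄ ∷ [])) (not# (call member# (x₄ ∷ x₆ ∷ []))))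
  kernelBody mask# = case x₁ nil
    (cons (call keepRow# (x₀ ∷ x₂ ∷ x₁ ∷ x₄ ∷ [])) (call mask# (cons x₀ x₂ ∷ x₁ ∷ x₄ ∷ [])))
  kernelBody pick# = case x₀ nil (case x₃ nil
    (case x₂ (call pick# (x₃ ∷ x₁ ∷ [])) (cons x₂ (call pick# (x₅ ∷ x₃ ∷ [])))))
  kernelBody prune# = case x₀ nil (case x₃ nil
    (case x₂ (call prune# (x₃ ∷ x₁ ∷ x₆ ∷ []))
      (cons (call pick# (x₈ ∷ x₂ ∷ [])) (call prune# (x₅ ∷ x₃ ∷ x₈ ∷ [])))))
  kernelBody halve# = case x₀ nil (case x₁ (cons x₀ nil) (cons x₂ (call halve# (x₁ ∷ []))))
  kernelBody fits# = case x₁ (case x₀ true# (case x₁ true# nil)) (call fits# (call halve# (x₂ ∷ []) ∷ x₁ ∷ []))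
  kernelBody restrict# = call prune# (x₀ ∷ x₁ ∷ x₀ ∷ [])
  kernelBody maskOf# = call mask# (nil ∷ x₀ ∷ x₀ ∷ [])
  kernelBody finish# = case (call fits# (x₀ ∷ x₁ ∷ [])) noCode (cons x₂ x₃)

  kernelProgram : Program
  kernelProgram = record
    { arity = kernelArity
    ; body  = kernelBody
    ; main  = case x₀ nil (case (call fits# (x₀ ∷ x₁ ∷ []))
        (call finish# (call restrict# (call maskOf# (call close# (nil ∷ x₀ ∷ []) ∷ []) ∷ x₀ ∷ []) ∷ x₁ ∷ [])) x₄)
    }

-- Results and running times of the functions of the program

open Bounded kernelProgram

-- The comparison never descends below the first tree, so the time is charged to a alone. Searching
-- a list for a row thus needs no bound on the sizes of the entries.
equal-runs : ∀ a b → Eval (a ∷ b ∷ []) (kernelBody equal#) (bitCode (does (a ≟ᵗ b))) (size a * 20)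
equal-runs nil     nil     = within numeral-≤ (case-nil! var! (case-nil! var! true!))
equal-runs nil     (c · d) = within numeral-≤ (case-nil! var! (case-cons! var! nil!))
equal-runs (a · b) nil     = within (m≤m+n 5 _) (case-cons! var! (case-nil! var! nil!))
equal-runs (a · b) (c · d) = go (a ≟ᵗ c) (equal-runs a c) (b ≟ᵗ d) (equal-runs b d)
  where
  go : (a? : Dec (a ≡ c)) → Eval (a ∷ c ∷ []) (kernelBody equal#) (bitCode (does a?)) (size a * 20) →
       (b? : Dec (b ≡ d)) → Eval (b ∷ d ∷ []) (kernelBody equal#) (bitCode (does b?)) (size b * 20) →
       Eval ((a · b) ∷ (c · d) ∷ []) (kernelBody equal#) (bitCode (does (a? ×-dec b?))) (size (a · b) * 20)
  go (no _)  r b? r′ = within (bound₁ (size a) (size b))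
    (case-cons! var! (case-cons! var! (case-nil! (call! (var! ∷! var! ∷! []!) r) nil!)))
    where
    bound₁ : ∀ a b → suc (1 + suc (1 + suc (suc (2 + a * 20) + 1))) ≤ suc (a + b) * 20
    bound₁ a b = slack (11 + b * 20) (eq a b)
      where
      eq : ∀ a b → suc (1 + suc (1 + suc (suc (2 + a * 20) + 1))) + (11 + b * 20) ≡ suc (a + b) * 20
      eq = solve-∀
  go (yes _) r b? r′ = within (bound₂ (size a) (size b))
    (case-cons! var! (case-cons! var!
      (case-cons! (call! (var! ∷! var! ∷! []!) r) (call! (var! ∷! var! ∷! []!) r′))))
    where
    bound₂ : ∀ a b → suc (1 + suc (1 + suc (suc (2 + a * 20) + suc (2 + b * 20)))) ≤ suc (a + b) * 20
    bound₂ a b = slack (9) (eq a b)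
      where
      eq : ∀ a b → suc (1 + suc (1 + suc (suc (2 + a * 20) + suc (2 + b * 20)))) + (9) ≡ suc (a + b) * 20
      eq = solve-∀

memberᵇ : Tree → List Tree → Bool
memberᵇ r []      = false
memberᵇ r (h ∷ L) = if does (r ≟ᵗ h) then true else memberᵇ r L

member-runs : ∀ r L → Eval (r ∷ listCode L ∷ []) (kernelBody member#) (bitCode (memberᵇ r L))
                        (suc (length L) * (size r * 20 + 20))
member-runs r [] = within (bound (size r)) (case-nil! var! nil!)
  where
  bound : ∀ E → 3 ≤ 1 * (E * 20 + 20)
  bound E = slack (17 + E * 20) (eq E)
    where
    eq : ∀ E → 3 + (17 + E * 20) ≡ 1 * (E * 20 + 20)
    eq = solve-∀
member-runs r (h ∷ L) with does (r ≟ᵗ h) | equal-runs r h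
... | true | e = within (bound (length L) (size r))
  (case-cons! var! (case-cons! (call! (var! ∷! var! ∷! []!) e) true!))
  where
  bound : ∀ l E → suc (1 + suc (suc (2 + E * 20) + 3)) ≤ suc (suc l) * (E * 20 + 20)
  bound l E = slack (31 + E * 20 + l * 20 + E * l * 20) (eq l E)
    where
    eq : ∀ l E →
         suc (1 + suc (suc (2 + E * 20) + 3)) + (31 + E * 20 + l * 20 + E * l * 20) ≡ suc (suc l) * (E * 20
         + 20)
    eq = solve-∀
... | false | e = within (bound (length L) (size r))
  (case-cons! var! (case-nil! (call! (var! ∷! var! ∷! []!) e) (call! (var! ∷! var! ∷! []!) (member-runs r L))))
  where
  bound : ∀ l E →
          suc (1 + suc (suc (2 + E * 20) + suc (2 + suc l * (E * 20 + 20)))) ≤ suc (suc l) * (E * 20 + 20)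
  bound l E = slack (11) (eq l E)
    where
    eq : ∀ l E →
         suc (1 + suc (suc (2 + E * 20) + suc (2 + suc l * (E * 20 + 20)))) + (11) ≡ suc (suc l) * (E * 20 + 20)
    eq = solve-∀

componentᵇ : Tree → List Bool → List Tree → Bool
componentᵇ r []       hs       = true
componentᵇ r (b ∷ bs) []       = true
componentᵇ r (b ∷ bs) (h ∷ hs) =
  if b then (if does (r ≟ᵗ h) then componentᵇ r bs hs else false) else componentᵇ r bs hs

component-runs : ∀ r bs hs → Eval (r ∷ bitsCode bs ∷ listCode hs ∷ []) (kernelBody component#)
                               (bitCode (componentᵇ r bs hs)) (suc (length bs) * (size r * 20 + 30))
component-runs r [] hs = within (bound (size r)) (case-nil! var! true!)
  where
  bound : ∀ E → 5 ≤ 1 * (E * 20 + 30)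
  bound E = slack (25 + E * 20) (eq E)
    where
    eq : ∀ E → 5 + (25 + E * 20) ≡ 1 * (E * 20 + 30)
    eq = solve-∀
component-runs r (b ∷ bs) [] = within (bound (length bs) (size r)) (case-cons! var! (case-nil! var! true!))
  where
  bound : ∀ l E → 7 ≤ suc (suc l) * (E * 20 + 30)
  bound l E = slack (53 + E * 40 + l * 30 + E * l * 20) (eq l E)
    where
    eq : ∀ l E → 7 + (53 + E * 40 + l * 30 + E * l * 20) ≡ suc (suc l) * (E * 20 + 30)
    eq = solve-∀
component-runs r (false ∷ bs) (h ∷ hs) = within (bound (length bs) (size r))
  (case-cons! var! (case-cons! var! (case-nil! var! (call! (var! ∷! var! ∷! var! ∷! []!) (component-runs r bs hs)))))
  where
  bound : ∀ l E → suc (1 + suc (1 + suc (1 + suc (3 + suc l * (E * 20 + 30))))) ≤ suc (suc l) * (E * 20 + 30)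
  bound l E = slack (20 + E * 20) (eq l E)
    where
    eq : ∀ l E →
         suc (1 + suc (1 + suc (1 + suc (3 + suc l * (E * 20 + 30))))) + (20 + E * 20) ≡ suc (suc l) * (E * 20
         + 30)
    eq = solve-∀
component-runs r (true ∷ bs) (h ∷ hs) with does (r ≟ᵗ h) | equal-runs r h
... | false | e = within (bound (length bs) (size r))
  (case-cons! var! (case-cons! var! (case-cons! var! (case-nil! (call! (var! ∷! var! ∷! []!) e) nil!))))
  where
  bound : ∀ l E → suc (1 + suc (1 + suc (1 + suc (suc (2 + E * 20) + 1)))) ≤ suc (suc l) * (E * 20 + 30)
  bound l E = slack (49 + E * 20 + l * 30 + E * l * 20) (eq l E)
    where
    eq : ∀ l E →
         suc (1 + suc (1 + suc (1 + suc (suc (2 + E * 20) + 1)))) + (49 + E * 20 + l * 30 + E * l * 20)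
         ≡ suc (suc l) * (E * 20 + 30)
    eq = solve-∀
... | true | e = within (bound (length bs) (size r))
  (case-cons! var! (case-cons! var! (case-cons! var! (case-cons! (call! (var! ∷! var! ∷! []!) e)
    (call! (var! ∷! var! ∷! var! ∷! []!) (component-runs r bs hs))))))
  where
  bound : ∀ l E →
          suc (1 + suc (1 + suc (1 + suc (suc (2 + E * 20) + suc (3 + suc l * (E * 20 + 30))))))
          ≤ suc (suc l) * (E * 20 + 30)
  bound l E = slack (16) (eq l E)
    where
    eq : ∀ l E →
         suc (1 + suc (1 + suc (1 + suc (suc (2 + E * 20) + suc (3 + suc l * (E * 20 + 30)))))) + (16)
         ≡ suc (suc l) * (E * 20 + 30)
    eq = solve-∀

setᵇ : ℕ → List Bool → List Bool
setᵇ i       []       = []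
setᵇ zero    (b ∷ bs) = true ∷ bs
setᵇ (suc i) (b ∷ bs) = b ∷ setᵇ i bs

set-runs : ∀ i bs → Eval (numCode i ∷ bitsCode bs ∷ []) (kernelBody setBit#) (bitsCode (setᵇ i bs))
                      (suc (length bs) * 20)
set-runs i [] = within numeral-≤ (case-nil! var! nil!)
set-runs zero (b ∷ bs) = within (m≤m+n 9 _) (case-cons! var! (case-nil! var! (cons! true! var!)))
set-runs (suc i) (b ∷ bs) = within (bound (length bs))
  (case-cons! var! (case-cons! var! (cons! var! (call! (var! ∷! var! ∷! []!) (set-runs i bs)))))
  where
  bound : ∀ l → suc (1 + suc (1 + suc (1 + suc (2 + suc l * 20)))) ≤ suc (suc l) * 20
  bound l = slack (11) (eq l)
    where
    eq : ∀ l → suc (1 + suc (1 + suc (1 + suc (2 + suc l * 20)))) + (11) ≡ suc (suc l) * 20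
    eq = solve-∀

matrixCode : List (List Bool) → Tree
matrixCode rows = listCode (map bitsCode rows)

closeᵇ : ℕ → List (List Bool) → List (List Bool)
closeᵇ i []       = []
closeᵇ i (r ∷ rs) = setᵇ i r ∷ closeᵇ (suc i) rs

close-runs : ∀ i rows {m} → All (λ r → length r ≤ m) rows →
             Eval (numCode i ∷ matrixCode rows ∷ []) (kernelBody close#) (matrixCode (closeᵇ i rows))
               (suc (length rows) * (suc m * 20 + 20))
close-runs i [] {m} [] = within (bound m) (case-nil! var! nil!)
  where
  bound : ∀ m → 3 ≤ 1 * (suc m * 20 + 20)
  bound m = slack (37 + m * 20) (eq m)
    where
    eq : ∀ m → 3 + (37 + m * 20) ≡ 1 * (suc m * 20 + 20)
    eq = solve-∀
close-runs i (r ∷ rs) {m} (r≤m ∷ rs≤m) = within (bound (length rs) m)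
  (case-cons! var! (cons!
    (call! (var! ∷! var! ∷! []!) (within (*-monoˡ-≤ 20 (s≤s r≤m)) (set-runs i r)))
    (call! (cons! nil! var! ∷! var! ∷! []!) (close-runs (suc i) rs rs≤m))))
  where
  bound : ∀ l m →
          suc (1 + suc (suc (2 + suc m * 20) + suc (4 + suc l * (suc m * 20 + 20))))
          ≤ suc (suc l) * (suc m * 20 + 20)
  bound l m = slack (9) (eq l m)
    where
    eq : ∀ l m →
         suc (1 + suc (suc (2 + suc m * 20) + suc (4 + suc l * (suc m * 20 + 20)))) + (9)
         ≡ suc (suc l) * (suc m * 20 + 20)
    eq = solve-∀

keepᵇ : List Bool → List Tree → List Tree → List Tree → Bool
keepᵇ bs seen rest all =
  select (componentᵇ (bitsCode bs) bs all) (memberᵇ (bitsCode bs) seen) (memberᵇ (bitsCode bs) rest)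

not-runs : ∀ {n} {ρ : Vec Tree n} {e b T} → Eval ρ e (bitCode b) T →
           Eval ρ (case e (cons nil nil) nil) (bitCode (not b)) (suc (T + 3))
not-runs {b = true} {T} d = within (s≤s (+-monoʳ-≤ T numeral-≤)) (case-cons! d nil!)
not-runs {b = false} d = case-nil! d true!

keep-runs : ∀ bs seen rest all {m Z} → length bs ≤ m → length seen ≤ m → length rest ≤ m → size (bitsCode bs) ≤ Z →
            Eval (bitsCode bs ∷ listCode seen ∷ listCode rest ∷ listCode all ∷ []) (kernelBody keepRow#)
              (bitCode (keepᵇ bs seen rest all)) (suc m * (Z * 20 + 30) * 3 + 30)
keep-runs bs seen rest all {m} {Z} bs≤ seen≤ rest≤ r≤Z = go
  (componentᵇ r bs all) (memberᵇ r seen) (memberᵇ r rest)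
  (within (*-mono-≤ (s≤s bs≤) (+-monoˡ-≤ 30 (*-monoˡ-≤ 20 r≤Z))) (component-runs r bs all))
  (member-within {seen} seen≤) (member-within {rest} rest≤)
  where
  r = bitsCode bs
  K = suc m * (Z * 20 + 30)
  member-within : ∀ {L} → length L ≤ m → Eval (r ∷ listCode L ∷ []) (kernelBody member#) (bitCode (memberᵇ r L)) K
  member-within {L} L≤ = within (*-mono-≤ (s≤s L≤) (+-mono-≤ (*-monoˡ-≤ 20 r≤Z) (numeral-≤ {20} {30}))) (member-runs r L)
  bound₁ : ∀ K → suc (suc (3 + K) + suc (suc (2 + K) + 3)) ≤ K * 3 + 30
  bound₁ K = slack (18 + K) (eq K)
    where
    eq : ∀ K → suc (suc (3 + K) + suc (suc (2 + K) + 3)) + (18 + K) ≡ K * 3 + 30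
    eq = solve-∀
  bound₂ : ∀ K → suc (suc (3 + K) + suc (suc (2 + K) + suc (2 + K))) ≤ K * 3 + 30
  bound₂ K = slack (18) (eq K)
    where
    eq : ∀ K → suc (suc (3 + K) + suc (suc (2 + K) + suc (2 + K))) + (18) ≡ K * 3 + 30
    eq = solve-∀
  bound₃ : ∀ K → suc (suc (3 + K) + suc (suc (2 + K) + suc (suc (2 + K) + 3))) ≤ K * 3 + 30
  bound₃ K = slack (14) (eq K)
    where
    eq : ∀ K → suc (suc (3 + K) + suc (suc (2 + K) + suc (suc (2 + K) + 3))) + (14) ≡ K * 3 + 30
    eq = solve-∀
  go : ∀ c e l →
       Eval (r ∷ r ∷ listCode all ∷ []) (kernelBody component#) (bitCode c) K →
       Eval (r ∷ listCode seen ∷ []) (kernelBody member#) (bitCode e) K →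
       Eval (r ∷ listCode rest ∷ []) (kernelBody member#) (bitCode l) K →
       Eval (r ∷ listCode seen ∷ listCode rest ∷ listCode all ∷ []) (kernelBody keepRow#)
         (bitCode (select c e l)) (K * 3 + 30)
  go false e     l dc de dl = within (bound₁ K)
    (case-nil! (call! (var! ∷! var! ∷! var! ∷! []!) dc) (not-runs (call! (var! ∷! var! ∷! []!) de)))
  go true  false l dc de dl = within (bound₂ K)
    (case-cons! (call! (var! ∷! var! ∷! var! ∷! []!) dc)
      (case-nil! (call! (var! ∷! var! ∷! []!) de) (call! (var! ∷! var! ∷! []!) dl)))
  go true  true  l dc de dl = within (bound₃ K)
    (case-cons! (call! (var! ∷! var! ∷! var! ∷! []!) dc)
      (case-cons! (call! (var! ∷! var! ∷! []!) de) (not-runs (call! (var! ∷! var! ∷! []!) dl))))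

-- `seen` collects the rows already passed, most recent first. An earlier or later twin is then an
-- equal row in `seen` or among the remaining rows, so vertex numbers need not be compared.
maskᵇ : List Tree → List (List Bool) → List Tree → List Bool
maskᵇ seen []         all = []
maskᵇ seen (bs ∷ bss) all = keepᵇ bs seen (map bitsCode bss) all ∷ maskᵇ (bitsCode bs ∷ seen) bss all

mask-runs : ∀ seen bss all {m Z} → All (λ bs → length bs ≤ m × size (bitsCode bs) ≤ Z) bss →
            length seen + length bss ≤ m →
            Eval (listCode seen ∷ matrixCode bss ∷ listCode all ∷ []) (kernelBody mask#)
              (bitsCode (maskᵇ seen bss all)) (suc (length bss) * (suc m * (Z * 20 + 30) * 3 + 50))
mask-runs seen [] all {m} {Z} [] _ = within (bound (suc m * (Z * 20 + 30))) (case-nil! var! nil!)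
  where
  bound : ∀ K → 3 ≤ 1 * (K * 3 + 50)
  bound K = slack (47 + K * 3) (eq K)
    where
    eq : ∀ K → 3 + (47 + K * 3) ≡ 1 * (K * 3 + 50)
    eq = solve-∀
mask-runs seen (bs ∷ bss) all {m} {Z} ((bs≤ , r≤) ∷ bss≤) total≤ = within (bound (length bss) (suc m * (Z * 20 + 30)))
  (case-cons! var! (cons!
    (call! (var! ∷! var! ∷! var! ∷! var! ∷! []!)
      (keep-runs bs seen (map bitsCode bss) all bs≤ (≤-trans (m≤m+n _ _) total≤)
        (≤-trans (≤-reflexive (List.length-map bitsCode bss)) (≤-trans (m≤n+m _ (suc (length seen))) total≤′)) r≤))
    (call! (cons! var! var! ∷! var! ∷! var! ∷! []!) (mask-runs (bitsCode bs ∷ seen) bss all bss≤ total≤′))))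
  where
  total≤′ : suc (length seen) + length bss ≤ m
  total≤′ = ≤-trans (≤-reflexive (sym (+-suc (length seen) (length bss)))) total≤
  bound : ∀ l K →
          suc (1 + suc (suc (4 + (K * 3 + 30)) + suc (5 + suc l * (K * 3 + 50)))) ≤ suc (suc l) * (K * 3 + 50)
  bound l K = slack (6) (eq l K)
    where
    eq : ∀ l K →
         suc (1 + suc (suc (4 + (K * 3 + 30)) + suc (5 + suc l * (K * 3 + 50)))) + (6) ≡ suc (suc l) * (K * 3
         + 50)
    eq = solve-∀

pick : ∀ {A : Set} → List Bool → List A → List A
pick []           xs       = []
pick (b ∷ bs)     []       = []
pick (true  ∷ bs) (x ∷ xs) = x ∷ pick bs xs
pick (false ∷ bs) (x ∷ xs) = pick bs xs

pick-runs : ∀ bs xs → Eval (bitsCode bs ∷ listCode xs ∷ []) (kernelBody pick#) (listCode (pick bs xs))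
                        (suc (length bs) * 20)
pick-runs []           xs       = within numeral-≤ (case-nil! var! nil!)
pick-runs (b ∷ bs)     []       = within (m≤m+n 5 _) (case-cons! var! (case-nil! var! nil!))
pick-runs (false ∷ bs) (x ∷ xs) = within (bound (length bs))
  (case-cons! var! (case-cons! var! (case-nil! var! (call! (var! ∷! var! ∷! []!) (pick-runs bs xs)))))
  where
  bound : ∀ l → suc (1 + suc (1 + suc (1 + suc (2 + suc l * 20)))) ≤ suc (suc l) * 20
  bound l = slack (11) (eq l)
    where
    eq : ∀ l → suc (1 + suc (1 + suc (1 + suc (2 + suc l * 20)))) + (11) ≡ suc (suc l) * 20
    eq = solve-∀
pick-runs (true ∷ bs)  (x ∷ xs) = within (bound (length bs))
  (case-cons! var! (case-cons! var! (case-cons! var! (cons! var! (call! (var! ∷! var! ∷! []!) (pick-runs bs xs))))))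
  where
  bound : ∀ l → suc (1 + suc (1 + suc (1 + suc (1 + suc (2 + suc l * 20))))) ≤ suc (suc l) * 20
  bound l = slack (9) (eq l)
    where
    eq : ∀ l → suc (1 + suc (1 + suc (1 + suc (1 + suc (2 + suc l * 20))))) + (9) ≡ suc (suc l) * 20
    eq = solve-∀

prune-runs : ∀ bs xss cs → Eval (bitsCode bs ∷ listCode (map listCode xss) ∷ bitsCode cs ∷ []) (kernelBody prune#)
                             (listCode (map listCode (pick bs (map (pick cs) xss))))
                             (suc (length bs) * (suc (length cs) * 20 + 30))
prune-runs [] xss cs = within (bound (length cs)) (case-nil! var! nil!)
  where
  bound : ∀ c → 3 ≤ 1 * (suc c * 20 + 30)
  bound c = slack (47 + c * 20) (eq c)
    where
    eq : ∀ c → 3 + (47 + c * 20) ≡ 1 * (suc c * 20 + 30)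
    eq = solve-∀
prune-runs (b ∷ bs) [] cs = within (bound (length bs) (length cs)) (case-cons! var! (case-nil! var! nil!))
  where
  bound : ∀ l c → 5 ≤ suc (suc l) * (suc c * 20 + 30)
  bound l c = slack (95 + c * 40 + l * 50 + c * l * 20) (eq l c)
    where
    eq : ∀ l c → 5 + (95 + c * 40 + l * 50 + c * l * 20) ≡ suc (suc l) * (suc c * 20 + 30)
    eq = solve-∀
prune-runs (false ∷ bs) (xs ∷ xss) cs = within (bound (length bs) (length cs))
  (case-cons! var! (case-cons! var! (case-nil! var! (call! (var! ∷! var! ∷! var! ∷! []!) (prune-runs bs xss cs)))))
  where
  bound : ∀ l c →
          suc (1 + suc (1 + suc (1 + suc (3 + suc l * (suc c * 20 + 30))))) ≤ suc (suc l) * (suc c * 20 + 30)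
  bound l c = slack (40 + c * 20) (eq l c)
    where
    eq : ∀ l c →
         suc (1 + suc (1 + suc (1 + suc (3 + suc l * (suc c * 20 + 30))))) + (40 + c * 20)
         ≡ suc (suc l) * (suc c * 20 + 30)
    eq = solve-∀
prune-runs (true ∷ bs) (xs ∷ xss) cs = within (bound (length bs) (length cs))
  (case-cons! var! (case-cons! var! (case-cons! var! (cons! (call! (var! ∷! var! ∷! []!) (pick-runs cs xs))
    (call! (var! ∷! var! ∷! var! ∷! []!) (prune-runs bs xss cs))))))
  where
  bound : ∀ l c →
          suc (1 + suc (1 + suc (1 + suc (suc (2 + suc c * 20) + suc (3 + suc l * (suc c * 20 + 30))))))
          ≤ suc (suc l) * (suc c * 20 + 30)
  bound l c = slack (16) (eq l c)
    where
    eq : ∀ l c →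
         suc (1 + suc (1 + suc (1 + suc (suc (2 + suc c * 20) + suc (3 + suc l * (suc c * 20 + 30)))))) + (16)
         ≡ suc (suc l) * (suc c * 20 + 30)
    eq = solve-∀

halve : ∀ {A : Set} → List A → List A
halve []           = []
halve (x ∷ [])     = x ∷ []
halve (x ∷ _ ∷ xs) = x ∷ halve xs

halve-≤ : ∀ {A : Set} (xs : List A) → length (halve xs) ≤ length xs
halve-≤ []           = z≤n
halve-≤ (x ∷ [])     = ≤-refl
halve-≤ (x ∷ _ ∷ xs) = s≤s (m≤n⇒m≤1+n (halve-≤ xs))

halve-runs : ∀ xs → Eval (listCode xs ∷ []) (kernelBody halve#) (listCode (halve xs)) (suc (length xs) * 20)
halve-runs []           = within numeral-≤ (case-nil! var! nil!)
halve-runs (x ∷ [])     = within numeral-≤ (case-cons! var! (case-nil! var! (cons! var! nil!)))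
halve-runs (x ∷ y ∷ xs) = within (bound (length xs))
  (case-cons! var! (case-cons! var! (cons! var! (call! (var! ∷! []!) (halve-runs xs)))))
  where
  bound : ∀ l → suc (1 + suc (1 + suc (1 + suc (1 + suc l * 20)))) ≤ suc (suc (suc l)) * 20
  bound l = slack (32) (eq l)
    where
    eq : ∀ l → suc (1 + suc (1 + suc (1 + suc (1 + suc l * 20)))) + (32) ≡ suc (suc (suc l)) * 20
    eq = solve-∀

-- Tests length ≤ 2^k without writing down 2^k, which would take time exponential in k: the list is
-- halved k times, rounding up, and at most one element must be left.
fitsᵇ : ∀ {A : Set} → List A → ℕ → Bool
fitsᵇ []           zero    = true
fitsᵇ (x ∷ [])     zero    = true
fitsᵇ (x ∷ y ∷ xs) zero    = false
fitsᵇ xs           (suc k) = fitsᵇ (halve xs) k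

fits-suc : ∀ {A : Set} (xs : List A) k → fitsᵇ xs (suc k) ≡ fitsᵇ (halve xs) k
fits-suc []          k = refl
fits-suc (x ∷ [])    k = refl
fits-suc (x ∷ y ∷ _) k = refl

fits-runs : ∀ xs k {m} → length xs ≤ m →
            Eval (listCode xs ∷ numCode k ∷ []) (kernelBody fits#) (bitCode (fitsᵇ xs k)) (suc k * (suc m * 20 + 30))
fits-runs []           zero {m} _ = within (bound m) (case-nil! var! (case-nil! var! true!))
  where
  bound : ∀ m → 7 ≤ 1 * (suc m * 20 + 30)
  bound m = slack (43 + m * 20) (eq m)
    where
    eq : ∀ m → 7 + (43 + m * 20) ≡ 1 * (suc m * 20 + 30)
    eq = solve-∀
fits-runs (x ∷ [])     zero {m} _ = within (bound m) (case-nil! var! (case-cons! var! (case-nil! var! true!)))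
  where
  bound : ∀ m → 9 ≤ 1 * (suc m * 20 + 30)
  bound m = slack (41 + m * 20) (eq m)
    where
    eq : ∀ m → 9 + (41 + m * 20) ≡ 1 * (suc m * 20 + 30)
    eq = solve-∀
fits-runs (x ∷ y ∷ xs) zero {m} _ = within (bound m) (case-nil! var! (case-cons! var! (case-cons! var! nil!)))
  where
  bound : ∀ m → 7 ≤ 1 * (suc m * 20 + 30)
  bound m = slack (43 + m * 20) (eq m)
    where
    eq : ∀ m → 7 + (43 + m * 20) ≡ 1 * (suc m * 20 + 30)
    eq = solve-∀
fits-runs xs (suc k) {m} xs≤ = within (bound k m)
  (case-cons! var! (call! (call! (var! ∷! []!) (within (*-monoˡ-≤ 20 (s≤s xs≤)) (halve-runs xs)) ∷! var! ∷! []!)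
    (subst (λ b → Eval (listCode (halve xs) ∷ numCode k ∷ []) (kernelBody fits#) (bitCode b) (suc k * (suc m * 20 + 30)))
      (sym (fits-suc xs k)) (fits-runs (halve xs) k (≤-trans (halve-≤ xs) xs≤)))))
  where
  bound : ∀ k m →
          suc (1 + suc (suc (1 + suc m * 20) + 1 + suc k * (suc m * 20 + 30))) ≤ suc (suc k) * (suc m * 20 + 30)
  bound k m = slack (24) (eq k m)
    where
    eq : ∀ k m →
         suc (1 + suc (suc (1 + suc m * 20) + 1 + suc k * (suc m * 20 + 30))) + (24)
         ≡ suc (suc k) * (suc m * 20 + 30)
    eq = solve-∀

halve-fits⁺ : ∀ {A : Set} (xs : List A) m → length xs ≤ m + m → length (halve xs) ≤ m
halve-fits⁺ []           m       _ = z≤n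
halve-fits⁺ (x ∷ [])     (suc m) _ = s≤s z≤n
halve-fits⁺ (x ∷ y ∷ xs) (suc m) (s≤s p) = s≤s (halve-fits⁺ xs m (s≤s⁻¹ (≤-trans p (≤-reflexive (+-suc m m)))))

halve-fits⁻ : ∀ {A : Set} (xs : List A) m → length (halve xs) ≤ m → length xs ≤ m + m
halve-fits⁻ []           m       _ = z≤n
halve-fits⁻ (x ∷ [])     (suc m) _ = s≤s z≤n
halve-fits⁻ (x ∷ y ∷ xs) (suc m) (s≤s p) = s≤s (≤-trans (s≤s (halve-fits⁻ xs m p)) (≤-reflexive (sym (+-suc m m))))

2^suc : ∀ k → 2 ^ suc k ≡ 2 ^ k + 2 ^ k
2^suc k = cong (2 ^ k +_) (+-identityʳ (2 ^ k))

fits-does : ∀ {A : Set} (xs : List A) k → fitsᵇ xs k ≡ does (length xs ≤? 2 ^ k)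
fits-does []           zero = refl
fits-does (x ∷ [])     zero = refl
fits-does (x ∷ y ∷ xs) zero = refl
fits-does xs (suc k) = trans (trans (fits-suc xs k) (fits-does (halve xs) k)) same
  where
  same : does (length (halve xs) ≤? 2 ^ k) ≡ does (length xs ≤? 2 ^ suc k)
  same = ≡-does (length xs ≤? 2 ^ suc k)
    (λ p → ≤-trans (halve-fits⁻ xs (2 ^ k) (does-true⁻ (_ ≤? _) p)) (≤-reflexive (sym (2^suc k))))
    (λ p → does-true (_ ≤? _) (halve-fits⁺ xs (2 ^ k) (≤-trans p (≤-reflexive (2^suc k)))))

-- Agreement of the program with the reduction of graphs

tabulate-∘lookup : ∀ {A B : Set} (f : A → B) xs → tabulate (f ∘ List.lookup xs) ≡ map f xs
tabulate-∘lookup f xs = trans (sym (List.map-tabulate (List.lookup xs) f)) (cong (map f) (List.tabulate-lookup xs))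

graphCode-induced : ∀ {n} (G : Graph n) L →
  graphCode (induced G L) ≡ listCode (map (λ v → listCode (map (bitCode ∘ Graph.adj G v) L)) L)
graphCode-induced G L = cong listCode (trans
  (List.tabulate-cong λ a → cong listCode (tabulate-∘lookup (bitCode ∘ Graph.adj G (List.lookup L a)) L))
  (tabulate-∘lookup (λ v → listCode (map (bitCode ∘ Graph.adj G v) L)) L))

tabulate-allFin : ∀ {n} {A : Set} (f : Fin n → A) → tabulate f ≡ map f (allFin n)
tabulate-allFin f = sym (List.map-tabulate id f)

graphCode-allFin : ∀ {n} (G : Graph n) →
  graphCode G ≡ listCode (map (λ v → listCode (map (bitCode ∘ Graph.adj G v) (allFin n))) (allFin n))
graphCode-allFin G = cong listCode (trans
  (List.tabulate-cong λ v → cong listCode (tabulate-allFin (bitCode ∘ Graph.adj G v)))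
  (tabulate-allFin _))

graphCode-matrix : ∀ {n} (G : Graph n) → graphCode G ≡ matrixCode (tabulate λ v → tabulate (Graph.adj G v))
graphCode-matrix G = cong listCode (sym (trans
  (List.map-tabulate _ bitsCode)
  (List.tabulate-cong λ v → cong listCode (List.map-tabulate (Graph.adj G v) bitCode))))

set-tabulate : ∀ {n} (v : Fin n) (f : Fin n → Bool) →
               setᵇ (toℕ v) (tabulate f) ≡ tabulate (λ w → if does (v Fin.≟ w) then true else f w)
set-tabulate zero    f = refl
set-tabulate (suc v) f = cong (f zero ∷_) (set-tabulate v (f ∘ suc))

close-tabulate : ∀ {m} i (f : Fin m → List Bool) →
                 closeᵇ i (tabulate f) ≡ tabulate (λ v → setᵇ (i + toℕ v) (f v))
close-tabulate {zero}  i f = refl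
close-tabulate {suc m} i f = cong₂ _∷_ (cong (λ j → setᵇ j (f zero)) (sym (+-identityʳ i)))
  (trans (close-tabulate (suc i) (f ∘ suc))
    (List.tabulate-cong λ v → cong (λ j → setᵇ j (f (suc v))) (sym (+-suc i (toℕ v)))))

memberᵇ⁻ : ∀ {A : Set} {r} {f : A → Tree} L → memberᵇ r (map f L) ≡ true → ∃[ h ] (h ∈ L × r ≡ f h)
memberᵇ⁻ {r = r} {f} (h ∷ L) p with r ≟ᵗ f h
... | yes e = h , here refl , e
... | no _  = let (h′ , h∈ , e) = memberᵇ⁻ L p in h′ , there h∈ , e

memberᵇ⁺ : ∀ {A : Set} {r} {f : A → Tree} {L h} → h ∈ L → r ≡ f h → memberᵇ r (map f L) ≡ true
memberᵇ⁺ {r = r} {f} (here {x = h} refl) e rewrite does-true (r ≟ᵗ f h) e = refl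
memberᵇ⁺ {r = r} {f} (there {x = h} h∈)  e with does (r ≟ᵗ f h)
... | true  = refl
... | false = memberᵇ⁺ h∈ e

componentᵇ⁻ : ∀ {n r} {f : Fin n → Bool} {g : Fin n → Tree} →
              componentᵇ r (tabulate f) (tabulate g) ≡ true → ∀ w → f w ≡ true → r ≡ g w
componentᵇ⁻ {r = r} {f} {g} p zero fw with f zero
... | true with r ≟ᵗ g zero
...   | yes e = e
componentᵇ⁻ {r = r} {f} {g} p (suc w) fw with f zero
... | false = componentᵇ⁻ {f = f ∘ suc} {g ∘ suc} p w fw
... | true with r ≟ᵗ g zero
...   | yes _ = componentᵇ⁻ {f = f ∘ suc} {g ∘ suc} p w fw

componentᵇ⁺ : ∀ {n r} {f : Fin n → Bool} {g : Fin n → Tree} →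
              (∀ w → f w ≡ true → r ≡ g w) → componentᵇ r (tabulate f) (tabulate g) ≡ true
componentᵇ⁺ {zero} all = refl
componentᵇ⁺ {suc n} {r} {f} {g} all with f zero | all zero
... | false | _ = componentᵇ⁺ {f = f ∘ suc} {g ∘ suc} (all ∘ suc)
... | true  | e rewrite does-true (r ≟ᵗ g zero) (e refl) = componentᵇ⁺ {f = f ∘ suc} {g ∘ suc} (all ∘ suc)

pick-filter : ∀ {A B : Set} (k : A → Bool) (f : A → B) L →
              pick (map k L) (map f L) ≡ map f (filter (λ v → k v Bool.≟ true) L)
pick-filter k f [] = refl
pick-filter k f (x ∷ L) with k x
... | true  = cong (f x ∷_) (pick-filter k f L)
... | false = pick-filter k f L

size-bitsCode : ∀ bs → size (bitsCode bs) ≤ suc (length bs) * 4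
size-bitsCode [] = numeral-≤
size-bitsCode (false ∷ bs) = s≤s (s≤s (m≤n⇒m≤1+n (m≤n⇒m≤1+n (size-bitsCode bs))))
size-bitsCode (true ∷ bs)  = s≤s (s≤s (s≤s (s≤s (size-bitsCode bs))))

returning : ∀ {n} {ρ : Vec Tree n} {e v w T} → v ≡ w → Eval ρ e v T → Eval ρ e w T
returning refl d = d

module _ {n} (G : Graph n) where

  open Reduction G

  private
    closedRow : Fin n → List Bool
    closedRow v = tabulate (closed v)

  closedRows : closeᵇ 0 (tabulate λ v → tabulate (Graph.adj G v)) ≡ map closedRow (allFin n)
  closedRows = trans (close-tabulate 0 _)
    (trans (List.tabulate-cong λ v → set-tabulate v (Graph.adj G v)) (tabulate-allFin closedRow))

  -- The invariant of the pass over the rows: s holds the vertices passed and t the others in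
  -- increasing order. So for the head v of t, the list s contains exactly the vertices below v, and
  -- the tail of t those above.
  Split : List (Fin n) → List (Fin n) → Set
  Split s t = All (λ u → All (u Fin.<_) t) s × AllPairs Fin._<_ t × (∀ u → u ∈ s ⊎ u ∈ t)

  split-start : Split [] (allFin n)
  split-start = [] , AllPairs.tabulate⁺-< id , λ u → inj₂ (∈-allFin u)

  split-step : ∀ {s v t} → Split s (v ∷ t) → Split (v ∷ s) t
  split-step (s<vt , v<t ∷ t< , covers) = v<t ∷ All.map (λ { (_ ∷ u<t) → u<t }) s<vt , t< , move
    where
    move : ∀ u → _
    move u with covers u
    ... | inj₁ u∈         = inj₁ (there u∈)
    ... | inj₂ (here e)   = inj₁ (here e)
    ... | inj₂ (there u∈) = inj₂ u∈

  module _ {s v t} (split : Split s (v ∷ t)) where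

    private
      s<vt = proj₁ split
      v<t : All (v Fin.<_) t
      v<t = case proj₁ (proj₂ split) of λ { (v<t ∷ _) → v<t }
      covers = proj₂ (proj₂ split)

    member-earlier : memberᵇ (row v) (map row s) ≡ does (earlier? v)
    member-earlier = ≡-does (earlier? v)
      (λ p → let (u , u∈ , e) = memberᵇ⁻ s p in
             u , (case All.lookup s<vt u∈ of λ { (u<v ∷ _) → u<v }) , sym e)
      (λ (u , u<v , e) → memberᵇ⁺ (before u u<v) (sym e))
      where
      before : ∀ u → u Fin.< v → u ∈ s
      before u u<v with covers u
      ... | inj₁ u∈          = u∈
      ... | inj₂ (here refl) = contradiction u<v (Fin.<-irrefl refl)
      ... | inj₂ (there u∈)  = contradiction (All.lookup v<t u∈) (Fin.<-asym u<v)

    member-later : memberᵇ (row v) (map row t) ≡ does (later? v)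
    member-later = ≡-does (later? v)
      (λ p → let (u , u∈ , e) = memberᵇ⁻ t p in u , All.lookup v<t u∈ , sym e)
      (λ (u , v<u , e) → memberᵇ⁺ (after u v<u) (sym e))
      where
      after : ∀ u → v Fin.< u → u ∈ t
      after u v<u with covers u
      ... | inj₁ u∈          = contradiction (case All.lookup s<vt u∈ of λ { (u<v ∷ _) → u<v }) (Fin.<-asym v<u)
      ... | inj₂ (here refl) = contradiction v<u (Fin.<-irrefl refl)
      ... | inj₂ (there u∈)  = u∈

  component-complete : ∀ v → componentᵇ (row v) (closedRow v) (map row (allFin n)) ≡ does (complete? v)
  component-complete v = trans (cong (componentᵇ (row v) (closedRow v)) (sym (tabulate-allFin row)))
    (≡-does (complete? v)
      (λ p w vw → sym (componentᵇ⁻ {f = closed v} {row} p w vw))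
      (λ c → componentᵇ⁺ {f = closed v} {row} λ w vw → sym (c w vw)))

  mask-keep : ∀ s t → Split s t → maskᵇ (map row s) (map closedRow t) (map row (allFin n)) ≡ map keep t
  mask-keep s []      _     = refl
  mask-keep s (v ∷ t) split = cong₂ _∷_
    (trans (cong (λ L → select (componentᵇ (row v) (closedRow v) (map row (allFin n)))
                                (memberᵇ (row v) (map row s)) (memberᵇ (row v) L))
                 (sym (List.map-∘ t)))
           (trans (cong₂ (λ c e → select c e (memberᵇ (row v) (map row t))) (component-complete v) (member-earlier split))
                  (cong (select (does (complete? v)) (does (earlier? v))) (member-later split))))
    (mask-keep (v ∷ s) t (split-step split))

  private
    vertices = allFin n
    length-vertices : length vertices ≡ n
    length-vertices = List.length-tabulate {n = n} id
    closedMatrix = map closedRow vertices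
    length-closedMatrix : length closedMatrix ≡ n
    length-closedMatrix = trans (List.length-map closedRow vertices) length-vertices
    bits : Fin n → List Tree
    bits v = map (bitCode ∘ Graph.adj G v) vertices

  close-graph : Eval (nil ∷ graphCode G ∷ []) (kernelBody close#) (matrixCode closedMatrix)
                  (suc n * (suc n * 20 + 20))
  close-graph = subst₂ (λ g l → Eval (nil ∷ g ∷ []) (kernelBody close#) (matrixCode closedMatrix) (suc l * (suc n * 20 + 20)))
    (sym (graphCode-matrix G)) (List.length-tabulate {n = n} _)
    (returning (cong matrixCode closedRows)
      (close-runs 0 (tabulate λ v → tabulate (Graph.adj G v))
        (All.tabulate⁺ λ v → ≤-reflexive (List.length-tabulate (Graph.adj G v)))))

  mask-graph : Eval (nil ∷ matrixCode closedMatrix ∷ matrixCode closedMatrix ∷ []) (kernelBody mask#)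
                 (bitsCode (map keep vertices)) (suc n * (suc n * (suc n * 4 * 20 + 30) * 3 + 50))
  mask-graph = subst₂ (λ bs l → Eval (nil ∷ matrixCode closedMatrix ∷ matrixCode closedMatrix ∷ []) (kernelBody mask#)
                                  (bitsCode bs) (suc l * (suc n * (suc n * 4 * 20 + 30) * 3 + 50)))
    (trans (cong (maskᵇ [] closedMatrix) (sym (List.map-∘ vertices))) (mask-keep [] vertices split-start))
    length-closedMatrix
    (mask-runs [] closedMatrix (map bitsCode closedMatrix)
      (All.map⁺ (All.tabulate⁺ λ v → ≤-reflexive (List.length-tabulate (closed v)) ,
        ≤-trans (size-bitsCode (closedRow v)) (≤-reflexive (cong (λ l → suc l * 4) (List.length-tabulate (closed v))))))
      (≤-reflexive length-closedMatrix))

  prune-graph : Eval (bitsCode (map keep vertices) ∷ graphCode G ∷ bitsCode (map keep vertices) ∷ []) (kernelBody prune#)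
                  (graphCode (induced G kept)) (suc n * (suc n * 20 + 30))
  prune-graph = subst₂ (λ g h → Eval (bitsCode (map keep vertices) ∷ g ∷ bitsCode (map keep vertices) ∷ []) (kernelBody prune#) h
                                  (suc n * (suc n * 20 + 30)))
    (trans (cong listCode (sym (List.map-∘ {g = listCode} {f = bits} vertices))) (sym (graphCode-allFin G)))
    pruned
    (within (≤-reflexive (cong (λ l → suc l * (suc l * 20 + 30)) (trans (List.length-map keep vertices) length-vertices)))
      (prune-runs (map keep vertices) (map bits vertices) (map keep vertices)))
    where
    open ≡-Reasoning
    pruned : listCode (map listCode (pick (map keep vertices) (map (pick (map keep vertices)) (map bits vertices))))
             ≡ graphCode (induced G kept)
    pruned = begin
      listCode (map listCode (pick (map keep vertices) (map (pick (map keep vertices)) (map bits vertices))))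
        ≡⟨ cong (listCode ∘ map listCode ∘ pick (map keep vertices))
             (trans (sym (List.map-∘ vertices))
               (List.map-cong (λ v → pick-filter keep (bitCode ∘ Graph.adj G v) vertices) vertices)) ⟩
      listCode (map listCode (pick (map keep vertices) (map (λ v → map (bitCode ∘ Graph.adj G v) kept′) vertices)))
        ≡⟨ cong (listCode ∘ map listCode) (pick-filter keep _ vertices) ⟩
      listCode (map listCode (map (λ v → map (bitCode ∘ Graph.adj G v) kept′) kept′))
        ≡⟨ cong listCode (sym (List.map-∘ kept′)) ⟩
      listCode (map (λ v → listCode (map (bitCode ∘ Graph.adj G v) kept′)) kept′)
        ≡⟨ cong (λ L → listCode (map (λ v → listCode (map (bitCode ∘ Graph.adj G v) L)) L)) (sym kept-filter) ⟩
      listCode (map (λ v → listCode (map (bitCode ∘ Graph.adj G v) kept)) kept)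
        ≡⟨ graphCode-induced G kept ⟨
      graphCode (induced G kept) ∎
      where
      kept′ = filter (λ v → keep v Bool.≟ true) vertices

  reduce-runs : ∀ {m} {ρ : Vec Tree m} →
    Eval (graphCode G ∷ ρ)
      (call restrict# (call maskOf# (call close# (nil ∷ var zero ∷ []) ∷ []) ∷ var zero ∷ []))
      (graphCode (induced G kept)) (suc n * suc n * suc n * 1000)
  reduce-runs = within (bound n)
    (call! (call! (call! (nil! ∷! var! ∷! []!) close-graph ∷! []!)
              (call! (nil! ∷! var! ∷! var! ∷! []!) mask-graph) ∷! var! ∷! []!)
      (call! (var! ∷! var! ∷! var! ∷! []!) prune-graph))
    where
    bound : ∀ n →
            suc (suc (suc (2 + suc n * (suc n * 20 + 20)) + 0 + suc (3 + suc n * (suc n * (suc n * 4 * 20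
            + 30) * 3 + 50))) + 1 + suc (3 + suc n * (suc n * 20 + 30))) ≤ suc n * suc n * suc n * 1000
    bound n = slack (516 + n * 1920 + n * n * 2150 + n * n * n * 760) (eq n)
      where
      eq : ∀ n →
           suc (suc (suc (2 + suc n * (suc n * 20 + 20)) + 0 + suc (3 + suc n * (suc n * (suc n * 4 * 20
           + 30) * 3 + 50))) + 1 + suc (3 + suc n * (suc n * 20 + 30))) + (516 + n * 1920 + n * n * 2150
           + n * n * n * 760) ≡ suc n * suc n * suc n * 1000
      eq = solve-∀

-- The kernelization

K₂ : Graph 2
K₂ = record { adj = adj ; sym = symmetric ; irref = irreflexive }
  where
  adj : Fin 2 → Fin 2 → Bool
  adj zero    zero    = false
  adj zero    (suc _) = true
  adj (suc _) zero    = true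
  adj (suc _) (suc _) = false
  symmetric : ∀ v w → adj v w ≡ adj w v
  symmetric zero    zero    = refl
  symmetric zero    (suc _) = refl
  symmetric (suc _) zero    = refl
  symmetric (suc _) (suc _) = refl
  irreflexive : ∀ v → adj v v ≡ false
  irreflexive zero    = refl
  irreflexive (suc _) = refl

noInstance : Instance
noInstance = ⟨ K₂ , 0 ⟩

noInstance-negative : Negative noInstance
noInstance-negative (_ , _ , covers) = case proj₁ (covers zero (suc zero) refl) of λ ()

keptOf : (x : Instance) → List (Fin (order x))
keptOf x = Reduction.kept (graph x)

reduced : Instance → Instance
reduced x = ⟨ induced (graph x) (keptOf x) , parameter x ⟩

module _ (x : Instance) where

  private
    w = 2 ^ parameter x

  -- Small instances are returned as they are, twins included. A reduced instance is therefore a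
  -- fixed point simply because it is small, and no second look at its twins is necessary. The
  -- decisions are arguments so that the run of the program can be analysed along the same branches.
  decide : Dec (order x ≤ w) → Dec (length (keptOf x) ≤ w) → Instance
  decide (yes _) _       = x
  decide (no _)  (yes _) = reduced x
  decide (no _)  (no _)  = noInstance

  shrink : Instance
  shrink = decide (order x ≤? w) (length (keptOf x) ≤? w)

  data Outcome : Instance → Set where
    unchanged : order x ≤ w → Outcome x
    shrunk    : w < order x → length (keptOf x) ≤ w → Outcome (reduced x)
    refused   : w < order x → w < length (keptOf x) → Outcome noInstance

  outcome : Outcome shrink
  outcome with order x ≤? w | length (keptOf x) ≤? w
  ... | yes small | _       = unchanged small
  ... | no big    | yes few = shrunk (≰⇒> big) few
  ... | no big    | no many = refused (≰⇒> big) (≰⇒> many)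

  shrink-small : order x ≤ w → shrink ≡ x
  shrink-small small with order x ≤? w
  ... | yes _  = refl
  ... | no big = contradiction small big

kept-edge : ∀ {n} (G : Graph n) → 1 ≤ length (Reduction.kept G) → ∃[ v ] ∃[ w ] Edge G v w
kept-edge G nonempty with Reduction.kept G | Reduction.∈-kept⁻ G
... | v ∷ _ | kept = v , Reduction.kept-nonisolated G (kept (here refl))

length-≥2 : ∀ {A : Set} {u v : A} {xs} → u ∈ xs → v ∈ xs → u ≢ v → 2 ≤ length xs
length-≥2 {xs = _ ∷ _ ∷ _} _           _           _   = s≤s (s≤s z≤n)
length-≥2 {xs = _ ∷ []}    (here refl) (here refl) u≢v = contradiction refl u≢v

edge-kept : ∀ {n} (G : Graph n) {v w} → Edge G v w → 2 ≤ length (Reduction.kept G)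
edge-kept G vw with Reduction.keptTwin G vw
... | u , _ , ku , ¬e with Reduction.kept-neighbour G ¬e ku
... | z , kz , uz = length-≥2 (Reduction.∈-kept⁺ G ku) (Reduction.∈-kept⁺ G kz) (edge-≢ G uz)

-- K₂ exceeds its own threshold 2^0 and keeps both vertices, so it is refused, and the replacement
-- is K₂ again.
shrink-noInstance : shrink noInstance ≡ noInstance
shrink-noInstance with shrink noInstance | outcome noInstance
... | _ | unchanged (s≤s ())
... | _ | shrunk _ few = contradiction (≤-trans (edge-kept K₂ {zero} {suc zero} refl) few) λ { (s≤s ()) }
... | _ | refused _ _ = refl

shrink-idempotent : ∀ x → code (shrink (shrink x)) ≡ code (shrink x)
shrink-idempotent x with shrink x | outcome x
... | _ | unchanged small = cong code (shrink-small x small)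
... | _ | shrunk _ few    = cong code (shrink-small (reduced x) few)
... | _ | refused _ _     = cong code shrink-noInstance

overfull-negative : ∀ x → 2 ^ parameter x < length (keptOf x) → Negative x
overfull-negative x many = refuted-negative (graph x) (Counting.overfull-refutation (graph x) (parameter x) many)

shrink-equivalent : ∀ x → Positive x ⇔ Positive (shrink x)
shrink-equivalent x with shrink x | outcome x
... | _ | unchanged _     = mk⇔ id id
... | _ | shrunk _ _      = mk⇔ (induced-cover (graph x) (Reduction.kept-unique (graph x))) (Reduction.kept-cover (graph x))
... | _ | refused _ many  = mk⇔ (λ p → contradiction p (overfull-negative x many)) (λ p → contradiction p noInstance-negative)

-- Sizes of codes

size-map-mono : ∀ {A : Set} {f g : A → Tree} → (∀ v → size (f v) ≤ size (g v)) → ∀ xs →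
                size (listCode (map f xs)) ≤ size (listCode (map g xs))
size-map-mono f≤g []       = ≤-refl
size-map-mono f≤g (x ∷ xs) = s≤s (+-mono-≤ (f≤g x) (size-map-mono f≤g xs))

size-filter : ∀ {A : Set} (k : A → Bool) (f : A → Tree) xs →
              size (listCode (map f (filter (λ v → k v Bool.≟ true) xs))) ≤ size (listCode (map f xs))
size-filter k f [] = ≤-refl
size-filter k f (x ∷ xs) with k x
... | true  = s≤s (+-monoʳ-≤ (size (f x)) (size-filter k f xs))
... | false = m≤n⇒m≤1+n (≤-trans (size-filter k f xs) (m≤n+m _ (size (f x))))

reduced-size : ∀ x → ∣ reduced x ∣ ≤ ∣ x ∣
reduced-size x = begin
  size (graphCode (induced G kept))
    ≡⟨ cong size (graphCode-induced G kept) ⟩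
  size (listCode (map (λ v → listCode (map (bits v) kept)) kept))
    ≡⟨ cong (λ L → size (listCode (map (λ v → listCode (map (bits v) L)) L))) kept-filter ⟩
  size (listCode (map (λ v → listCode (map (bits v) kept′)) kept′))
    ≤⟨ size-filter keep _ (allFin (order x)) ⟩
  size (listCode (map (λ v → listCode (map (bits v) kept′)) (allFin (order x))))
    ≤⟨ size-map-mono (λ v → size-filter keep (bits v) (allFin (order x))) (allFin (order x)) ⟩
  size (listCode (map (λ v → listCode (map (bits v) (allFin (order x)))) (allFin (order x))))
    ≡⟨ cong size (graphCode-allFin G) ⟨
  size (graphCode G) ∎
  where
  open ≤-Reasoning
  G = graph x
  open Reduction G
  bits : Fin (order x) → Fin (order x) → Tree
  bits v = bitCode ∘ Graph.adj G v
  kept′ = filter (λ v → keep v Bool.≟ true) (allFin (order x))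

size-listCode-≥ : ∀ {c xs} → All (λ t → c ≤ size t) xs → suc (length xs * suc c) ≤ size (listCode xs)
size-listCode-≥ []       = ≤-refl
size-listCode-≥ {c} {x ∷ xs} (p ∷ ps) = s≤s (≤-trans (≤-reflexive (sym (+-suc c _))) (+-mono-≤ p (size-listCode-≥ ps)))

size-listCode-≤ : ∀ {c xs} → All (λ t → size t ≤ c) xs → size (listCode xs) ≤ suc (length xs * suc c)
size-listCode-≤ []       = ≤-refl
size-listCode-≤ {c} {x ∷ xs} (p ∷ ps) = s≤s (≤-trans (+-mono-≤ p (size-listCode-≤ ps)) (≤-reflexive (+-suc c _)))

size-positive : ∀ t → 1 ≤ size t
size-positive nil     = ≤-refl
size-positive (_ · _) = s≤s z≤n

size-bitCode : ∀ b → size (bitCode b) ≤ 3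
size-bitCode true  = ≤-refl
size-bitCode false = s≤s z≤n

module _ {n} (G : Graph n) where

  private
    bits : Fin n → Fin n → Tree
    bits v = bitCode ∘ Graph.adj G v
    rows : List Tree
    rows = tabulate λ v → listCode (tabulate (bits v))

  size-graph-≥ : suc (n * suc (suc (n * 2))) ≤ size (graphCode G)
  size-graph-≥ = subst (λ l → suc (l * suc (suc (n * 2))) ≤ size (graphCode G)) (List.length-tabulate {n = n} _)
    (size-listCode-≥ {xs = rows} (All.tabulate⁺ λ v →
      subst (λ l → suc (l * 2) ≤ size (listCode (tabulate (bits v)))) (List.length-tabulate (bits v))
        (size-listCode-≥ (All.tabulate⁺ {f = bits v} λ w → size-positive (bits v w)))))

  size-graph-≤ : size (graphCode G) ≤ suc (n * suc (suc (n * 4)))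
  size-graph-≤ = subst (λ l → size (graphCode G) ≤ suc (l * suc (suc (n * 4)))) (List.length-tabulate {n = n} _)
    (size-listCode-≤ {xs = rows} (All.tabulate⁺ λ v →
      subst (λ l → size (listCode (tabulate (bits v))) ≤ suc (l * 4)) (List.length-tabulate (bits v))
        (size-listCode-≤ (All.tabulate⁺ {f = bits v} λ w → size-bitCode (Graph.adj G v w)))))

-- The edge requires two vertices. A graph with exactly two is then K₂ itself, whose code has size
-- 17, and three vertices already give at least 1 + 3 · 8 = 25.
noInstance-size : ∀ {n} (G : Graph n) {v w} → Edge G v w → ∣ noInstance ∣ ≤ size (graphCode G)
noInstance-size {1} G {zero} {zero} vw = contradiction refl (edge-≢ G vw)
noInstance-size {2} G {zero} {zero} vw = contradiction refl (edge-≢ G vw)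
noInstance-size {2} G {suc zero} {suc zero} vw = contradiction refl (edge-≢ G vw)
noInstance-size {2} G {zero} {suc zero} vw
  rewrite Graph.irref G zero | Graph.irref G (suc zero) | vw | trans (Graph.sym G (suc zero) zero) vw = ≤-refl
noInstance-size {2} G {suc zero} {zero} vw
  rewrite Graph.irref G zero | Graph.irref G (suc zero) | vw | trans (Graph.sym G zero (suc zero)) vw = ≤-refl
noInstance-size {suc (suc (suc n))} G vw = ≤-trans numeral-≤ (≤-trans
  (s≤s (*-mono-≤ {3} {3 + n} {8} (m≤m+n 3 n) (s≤s (s≤s (m≤m+n 6 (n * 2)))))) (size-graph-≥ G))

shrink-nonincreasing : ∀ x → ∣ shrink x ∣ ≤ ∣ x ∣
shrink-nonincreasing x with shrink x | outcome x
... | _ | unchanged _    = ≤-refl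
... | _ | shrunk _ _     = reduced-size x
... | _ | refused _ many =
  let (_ , _ , vw) = kept-edge (graph x) (≤-trans (s≤s z≤n) many) in noInstance-size (graph x) vw

-- Running time of the reduction rule

rowCodes : ∀ {n} → Graph n → List Tree
rowCodes G = tabulate λ v → listCode (tabulate λ w → bitCode (Graph.adj G v w))

length-rowCodes : ∀ {n} (G : Graph n) → length (rowCodes G) ≡ n
length-rowCodes {n} G = List.length-tabulate {n = n} _

fits-graph : ∀ {n} (G : Graph n) k {m} → n ≤ m →
             Eval (graphCode G ∷ numCode k ∷ []) (kernelBody fits#) (bitCode (does (n ≤? 2 ^ k))) (suc k * (suc m * 20 + 30))
fits-graph {n} G k {m} n≤m =
  returning (cong bitCode (trans (fits-does rows k) (cong (λ l → does (l ≤? 2 ^ k)) length-rows)))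
    (fits-runs rows k (≤-trans (≤-reflexive length-rows) n≤m))
  where
  rows = rowCodes G
  length-rows = length-rowCodes G

module _ (x : Instance) where

  private
    k = parameter x
    G = graph x
    n = order x
    fitsTime reduceTime : ℕ
    fitsTime   = suc k * (suc n * 20 + 30)
    reduceTime = suc n * suc n * suc n * 1000
    kept≤ : length (keptOf x) ≤ n
    kept≤ = ≤-trans (≤-reflexive (cong length (Reduction.kept-filter G)))
      (≤-trans (List.length-filter _ (allFin n)) (≤-reflexive (List.length-tabulate {n = n} id)))

  decide-runs : ∀ {F R} (d : Dec (n ≤ 2 ^ k)) (e : Dec (length (keptOf x) ≤ 2 ^ k)) →
    Eval (graphCode G ∷ numCode k ∷ []) (kernelBody fits#) (bitCode (does d)) F →
    Eval (graphCode (induced G (keptOf x)) ∷ numCode k ∷ []) (kernelBody fits#) (bitCode (does e)) F →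
    Eval (graphCode G ∷ numCode k ∷ code x ∷ [])
      (call restrict# (call maskOf# (call close# (nil ∷ var zero ∷ []) ∷ []) ∷ var zero ∷ []))
      (graphCode (induced G (keptOf x))) R →
    Eval (code x ∷ []) (Program.main kernelProgram) (code (decide x d e)) (F + F + R + 100)
  decide-runs {F} {R} (yes _) _ r _ s = within (bound F R)
    (case-cons! var! (case-cons! (call! (var! ∷! var! ∷! []!) r) var!))
    where
    bound : ∀ F R → suc (1 + suc (suc (2 + F) + 1)) ≤ F + F + R + 100
    bound F R = slack (93 + F + R) (eq F R)
      where
      eq : ∀ F R → suc (1 + suc (suc (2 + F) + 1)) + (93 + F + R) ≡ F + F + R + 100
      eq = solve-∀
  decide-runs {F} {R} (no _) (yes _) r r′ s = within (bound F R)
    (case-cons! var! (case-nil! (call! (var! ∷! var! ∷! []!) r)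
      (call! (s ∷! var! ∷! []!) (case-cons! (call! (var! ∷! var! ∷! []!) r′) (cons! var! var!)))))
    where
    bound : ∀ F R → suc (1 + suc (suc (2 + F) + suc (R + 1 + suc (suc (2 + F) + 3)))) ≤ F + F + R + 100
    bound F R = slack (85) (eq F R)
      where
      eq : ∀ F R → suc (1 + suc (suc (2 + F) + suc (R + 1 + suc (suc (2 + F) + 3)))) + (85) ≡ F + F + R + 100
      eq = solve-∀
  decide-runs {F} {R} (no _) (no _) r r′ s = within (bound F R)
    (case-cons! var! (case-nil! (call! (var! ∷! var! ∷! []!) r)
      (call! (s ∷! var! ∷! []!) (case-nil! (call! (var! ∷! var! ∷! []!) r′)
        (cons! (cons! (cons! nil! (cons! true! nil!)) (cons! (cons! true! (cons! nil! nil!)) nil!)) nil!)))))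
    where
    bound : ∀ F R → suc (1 + suc (suc (2 + F) + suc (R + 1 + suc (suc (2 + F) + 19)))) ≤ F + F + R + 100
    bound F R = slack (69) (eq F R)
      where
      eq : ∀ F R → suc (1 + suc (suc (2 + F) + suc (R + 1 + suc (suc (2 + F) + 19)))) + (69) ≡ F + F + R + 100
      eq = solve-∀

  shrink-runs : Eval (code x ∷ []) (Program.main kernelProgram) (code (shrink x)) (fitsTime + fitsTime + reduceTime + 100)
  shrink-runs = decide-runs (n ≤? 2 ^ k) (length (keptOf x) ≤? 2 ^ k)
    (fits-graph G k ≤-refl) (fits-graph (induced G (keptOf x)) k kept≤) (reduce-runs G)

-- Two size tests of order k · n and a cubic reduction, all raised to degree four; the coefficient
-- is 50 + 50 + 1000.
timePolynomial : Polynomial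
timePolynomial = 100 ∷ 0 ∷ 0 ∷ 0 ∷ 1100 ∷ []

time-≤ : ∀ {N a b} → a ≤ N → b ≤ N → 1 ≤ N →
         a * (b * 20 + 30) + a * (b * 20 + 30) + b * b * b * 1000 + 100 ≤ ⟦ timePolynomial ⟧ N
time-≤ {N} {a} {b} a≤N b≤N 1≤N = begin
  a * (b * 20 + 30) + a * (b * 20 + 30) + b * b * b * 1000 + 100
    ≤⟨ +-monoˡ-≤ 100 (+-mono-≤ (+-mono-≤ fits≤ fits≤)
         (*-monoˡ-≤ 1000 (≤-trans (*-mono-≤ (*-mono-≤ b≤N b≤N) b≤N) (m≤m*n _ N)))) ⟩
  N * N * N * N * 50 + N * N * N * N * 50 + N * N * N * N * 1000 + 100
    ≡⟨ eq N ⟩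
  ⟦ timePolynomial ⟧ N ∎
  where
  open ≤-Reasoning
  instance
    N≢0 = >-nonZero 1≤N
  fits≤ : a * (b * 20 + 30) ≤ N * N * N * N * 50
  fits≤ = begin
    a * (b * 20 + 30)       ≤⟨ *-mono-≤ a≤N (+-mono-≤ (*-monoˡ-≤ 20 b≤N) (*-monoˡ-≤ 30 1≤N)) ⟩
    N * (N * 20 + N * 30)   ≤⟨ ≤-trans (m≤m*n _ N) (m≤m*n _ N) ⟩
    N * (N * 20 + N * 30) * N * N ≡⟨ eq′ N ⟩
    N * N * N * N * 50      ∎
    where
    eq′ : ∀ N → N * (N * 20 + N * 30) * N * N ≡ N * N * N * N * 50
    eq′ = solve-∀
  eq : ∀ N → N * N * N * N * 50 + N * N * N * N * 50 + N * N * N * N * 1000 + 100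
       ≡ 100 + N * (0 + N * (0 + N * (0 + N * (1100 + N * 0))))
  eq = solve-∀

order<size : ∀ x → order x < ∣ x ∣
order<size x = ≤-trans (s≤s (m≤m*n (order x) (suc (suc (order x * 2))))) (size-graph-≥ (graph x))

shrink-polynomialTime : ∀ x → ∃[ t ] (Runs kernelProgram (code x) (code (shrink x)) t × t ≤ ⟦ timePolynomial ⟧ (∣ x ∣ + parameter x))
shrink-polynomialTime x = proj₁ (shrink-runs x) , proj₁ (proj₂ (shrink-runs x)) , ≤-trans (proj₂ (proj₂ (shrink-runs x)))
  (time-≤ {∣ x ∣ + parameter x} {suc (parameter x)} {suc (order x)}
  (+-monoˡ-≤ (parameter x) 1≤size) (≤-trans (order<size x) (m≤m+n _ _)) (≤-trans 1≤size (m≤m+n _ _)))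
  where
  1≤size : 1 ≤ ∣ x ∣
  1≤size = ≤-trans (s≤s z≤n) (order<size x)

shrinkRule : DataReductionRule
shrinkRule = record
  { reduce         = shrink
  ; polynomialTime = kernelProgram , timePolynomial , shrink-polynomialTime
  ; equivalent     = shrink-equivalent
  ; nonincreasing  = shrink-nonincreasing
  }

-- Equals 32 · 4^k + a. The accumulator form makes it easy to program in the tree language: every
-- level runs the level below four times. 4^k accounts for an adjacency matrix on 2^k vertices, and
-- 32 leaves room for K₂ when k = 0.
padded : ℕ → ℕ → ℕ
padded zero    a = 32 + a
padded (suc k) a = padded k (padded k (padded k (padded k a)))

padded-≡ : ∀ k a → padded k a ≡ 2 ^ k * 2 ^ k * 32 + a
padded-≡ zero    a = refl
padded-≡ (suc k) a
  rewrite padded-≡ k a | padded-≡ k (2 ^ k * 2 ^ k * 32 + a)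
        | padded-≡ k (2 ^ k * 2 ^ k * 32 + (2 ^ k * 2 ^ k * 32 + a))
        | padded-≡ k (2 ^ k * 2 ^ k * 32 + (2 ^ k * 2 ^ k * 32 + (2 ^ k * 2 ^ k * 32 + a))) = eq (2 ^ k) a
  where
  eq : ∀ w a → w * w * 32 + (w * w * 32 + (w * w * 32 + (w * w * 32 + a))) ≡ (w + (w + 0)) * (w + (w + 0)) * 32 + a
  eq = solve-∀

module PaddedProgram where

  arity : Fin 1 → ℕ
  arity _ = 2

  grow : ∀ {n} → ℕ → Expr arity n → Expr arity n
  grow zero    e = e
  grow (suc m) e = cons nil (grow m e)

  nest : ∀ {n} → Expr arity n → ℕ → Expr arity n → Expr arity n
  nest κ zero    e = e
  nest κ (suc m) e = call zero (κ ∷ nest κ m e ∷ [])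

  body : (f : Fin 1) → Expr arity (arity f)
  body _ = case (var zero) (grow 32 (var (suc zero))) (nest (var (suc zero)) 4 (var (suc (suc (suc zero)))))

  program : Program
  program = record { arity = arity ; body = body ; main = call zero (var zero ∷ nil ∷ []) }

  open Semantics program

  grow-runs : ∀ {n a} {ρ : Vec Tree n} {e} m → ∃[ t ] (ρ ⊢ e ⇓ numCode a ⟨ t ⟩) → ∃[ t ] (ρ ⊢ grow m e ⇓ numCode (m + a) ⟨ t ⟩)
  grow-runs zero    r = r
  grow-runs (suc m) r = _ , cons nil (proj₂ (grow-runs m r))

  body-runs : ∀ k a → ∃[ t ] ((numCode k ∷ numCode a ∷ []) ⊢ body zero ⇓ numCode (padded k a) ⟨ t ⟩)
  body-runs zero    a = _ , case-nil (var zero) (proj₂ (grow-runs {a = a} 32 (_ , var (suc zero))))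
  body-runs (suc k) a = _ , case-cons (var zero)
    (call (var (suc zero) ∷ call (var (suc zero) ∷ call (var (suc zero) ∷ call (var (suc zero) ∷ var (suc (suc (suc zero))) ∷ [])
      (proj₂ (body-runs k a)) ∷ [])
      (proj₂ (body-runs k (padded k a))) ∷ [])
      (proj₂ (body-runs k (padded k (padded k a)))) ∷ [])
      (proj₂ (body-runs k (padded k (padded k (padded k a))))))

  runs : ∀ k → ∃[ t ] Runs program (numCode k) (numCode (padded k 0)) t
  runs k = _ , call (var zero ∷ nil ∷ []) (proj₂ (body-runs k 0))

small-bounded : ∀ {n} (G : Graph n) k → n ≤ 2 ^ k → size (graphCode G) + k ≤ padded k 0
small-bounded {n} G k n≤w = begin
  size (graphCode G) + k                        ≤⟨ +-mono-≤ (size-graph-≤ G) (n≤2^n k) ⟩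
  suc (n * suc (suc (n * 4))) + w               ≤⟨ +-monoˡ-≤ w (s≤s (*-mono-≤ n≤w (s≤s (s≤s (*-monoˡ-≤ 4 n≤w))))) ⟩
  1 + w * suc (suc (w * 4)) + w                 ≡⟨ eq₁ w ⟩
  1 + w * 3 + w * w * 4                         ≤⟨ +-monoˡ-≤ (w * w * 4) (+-mono-≤ (*-mono-≤ (1≤2^ k) (1≤2^ k))
                                                     (*-monoˡ-≤ 3 (m≤m*n w w {{>-nonZero (1≤2^ k)}}))) ⟩
  w * w + w * w * 3 + w * w * 4                 ≡⟨ eq₂ (w * w) ⟩
  w * w * 8                                     ≤⟨ *-monoʳ-≤ (w * w) numeral-≤ ⟩
  w * w * 32                                    ≡⟨ +-identityʳ _ ⟨
  w * w * 32 + 0                                ≡⟨ padded-≡ k 0 ⟨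
  padded k 0                                    ∎
  where
  open ≤-Reasoning
  w = 2 ^ k
  eq₁ : ∀ w → 1 + w * suc (suc (w * 4)) + w ≡ 1 + w * 3 + w * w * 4
  eq₁ = solve-∀
  eq₂ : ∀ u → u + u * 3 + u * 4 ≡ u * 8
  eq₂ = solve-∀

shrink-bounded : ∀ x → ∣ shrink x ∣ + parameter (shrink x) ≤ padded (parameter x) 0
shrink-bounded x with shrink x | outcome x
... | _ | unchanged small = small-bounded (graph x) (parameter x) small
... | _ | shrunk _ few    = small-bounded (induced (graph x) (keptOf x)) (parameter x) few
... | _ | refused _ _     = ≤-trans (numeral-≤ {17} {32})
  (≤-trans (*-monoˡ-≤ 32 (*-mono-≤ (1≤2^ k) (1≤2^ k)))
    (≤-reflexive (sym (trans (padded-≡ k 0) (+-identityʳ _)))))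
  where
  k = parameter x

-- The kernel, its chain and the witnesses

numCode-injective : ∀ {j k} → numCode j ≡ numCode k → j ≡ k
numCode-injective {zero}  {zero}  _ = refl
numCode-injective {suc j} {suc k} p = cong suc (numCode-injective (proj₂ (·-injective p)))

listCode-length : ∀ {xs ys} → listCode xs ≡ listCode ys → length xs ≡ length ys
listCode-length {[]}     {[]}     _ = refl
listCode-length {x ∷ xs} {y ∷ ys} p = cong suc (listCode-length {xs} {ys} (proj₂ (·-injective p)))

module _ (x y : Instance) (same : code x ≡ code y) where

  same-size : ∣ x ∣ ≡ ∣ y ∣
  same-size = cong size (proj₁ (·-injective same))

  same-parameter : parameter x ≡ parameter y
  same-parameter = numCode-injective (proj₂ (·-injective same))

  same-order : order x ≡ order y
  same-order = trans (sym (length-rowCodes (graph x)))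
    (trans (listCode-length {rowCodes (graph x)} {rowCodes (graph y)} (proj₁ (·-injective same)))
      (length-rowCodes (graph y)))

module _ (x : Instance) where

  -- A chain must end in the kernel itself, so x is kept if shrink x is only
  -- another instance with the same code.
  settle : Dec (code (shrink x) ≡ code x) → Instance
  settle (yes _) = x
  settle (no _)  = shrink x

  settle-code : ∀ d → code (settle d) ≡ code (shrink x)
  settle-code (yes p) = sym p
  settle-code (no _)  = refl

  settle-equivalent : ∀ d → Positive x ⇔ Positive (settle d)
  settle-equivalent (yes _) = mk⇔ id id
  settle-equivalent (no _)  = shrink-equivalent x

  settle-chain : ∀ d → Chain (shrinkRule ∷ []) x (settle d)
  settle-chain (yes p) = exhausted ((λ applicable → applicable p) ∷ [])
  settle-chain (no ¬p) = step shrinkRule (here refl) ¬p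
    (exhausted ((λ applicable → applicable (shrink-idempotent x)) ∷ []))

  settled? : Dec (code (shrink x) ≡ code x)
  settled? = code (shrink x) ≟ᵗ code x

  kernelOf : Instance
  kernelOf = settle settled?

  kernel-code : code kernelOf ≡ code (shrink x)
  kernel-code = settle-code settled?

kernelization : Kernelization
kernelization = record
  { kernel         = kernelOf
  ; polynomialTime = kernelProgram , timePolynomial , λ x →
      let (t , runs , t≤) = shrink-polynomialTime x in
      t , subst (λ c → Runs kernelProgram (code x) c t) (sym (kernel-code x)) runs , t≤
  ; equivalent     = λ x → settle-equivalent x (settled? x)
  ; bound          = λ k → padded k 0
  ; computable     = PaddedProgram.program , PaddedProgram.runs
  ; bounded        = λ x → ≤-trans (≤-reflexive (cong₂ _+_ (same-size (kernelOf x) (shrink x) (kernel-code x))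
                                                      (same-parameter (kernelOf x) (shrink x) (kernel-code x))))
                             (shrink-bounded x)
  ; rules          = shrinkRule ∷ []
  ; chain          = λ x → settle-chain x (settled? x)
  }

kernel-order : ∀ x → 1 ≤ parameter x → order (Kernelization.kernel kernelization x) ≤ 2 ^ parameter x
kernel-order x 1≤k = ≤-trans (≤-reflexive (same-order (kernelOf x) (shrink x) (kernel-code x))) shrink-order
  where
  shrink-order : order (shrink x) ≤ 2 ^ parameter x
  shrink-order with shrink x | outcome x
  ... | _ | unchanged small = small
  ... | _ | shrunk _ few    = few
  -- K₂ has two vertices, so 1 ≤ k is used here.
  ... | _ | refused _ _     = ^-monoʳ-≤ 2 1≤k

-- There is at most one step, and it is taken only from n > 2^k ≥ 2 vertices. With m = 2^k - 1 ≥ 1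
-- this gives 1 + m ≤ 2m ≤ n · m, so C = 1 suffices.
chain-length : ∀ x → 1 ≤ parameter x → 1 ≤ order x → ∀ d →
               AtMostLog (chainLength (settle-chain x d)) 1 (2 ^ parameter x ∸ 1) (order x)
chain-length x 1≤k 1≤n (yes _) = ≤-trans 1≤n (≤-reflexive (sym (trans (*-identityʳ _) (*-identityʳ _))))
chain-length x 1≤k 1≤n (no ¬p) = begin
  suc m ^ 1              ≡⟨ *-identityʳ (suc m) ⟩
  1 + m                  ≤⟨ +-monoˡ-≤ m 1≤m ⟩
  m + m                  ≡⟨ cong (m +_) (sym (+-identityʳ m)) ⟩
  2 * m                  ≤⟨ *-monoˡ-≤ m (≤-trans (^-monoʳ-≤ 2 1≤k) (<⇒≤ (≰⇒> (¬p ∘ cong code ∘ shrink-small x)))) ⟩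
  order x * m            ≡⟨ cong₂ _*_ (*-identityʳ (order x)) (*-identityʳ m) ⟨
  order x ^ 1 * m ^ 1    ∎
  where
  open ≤-Reasoning
  m = 2 ^ parameter x ∸ 1
  1≤m : 1 ≤ m
  1≤m = ∸-monoˡ-≤ 1 (^-monoʳ-≤ 2 1≤k)

refused-step : ∀ x → 2 ^ parameter x < length (keptOf x) →
               StepWitnessed 1 (⟦ soundnessPolynomial ⟧ ∣Φ x ∣) x noInstance
refused-step x many = step-witnessed {x} {noInstance} (λ _ → ⊥ᶠ)
  -- Once ⊥ is derived, any substitution works. The formula of K₂ with parameter 0 has four clauses,
  -- each taking five lines, which is the 20 in `bound`.
  (cut (Counting.overfull-refutation G k many) (each (All.tabulate λ _ → ⊥E h₀)))
  (≤-trans (≤-trans (bound ((2 ^ k) ^ 5 * overfullCost)) (+-monoˡ-≤ 100 (≤-trans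
      (*-monoˡ-≤ overfullCost (^-monoˡ-≤ 5 w≤m)) (m≤n+m _ m))))
    (soundnessPolynomial-≥ m))
  where
  G = graph x
  k = parameter x
  m = ∣Φ x ∣
  w≤m : 2 ^ k ≤ m
  w≤m = let (_ , _ , vw) = kept-edge G (≤-trans (s≤s z≤n) many) in Φ-length G k (edge-≢ G vw)
  bound : ∀ p → 8 + (20 + p) ≤ p + 100
  bound p = ≤-trans (+-monoˡ-≤ p (numeral-≤ {28} {100})) (≤-reflexive (+-comm 100 p))

shrink-witnessed : ∀ x → code (shrink x) ≢ code x → StepWitnessed 1 (⟦ soundnessPolynomial ⟧ ∣Φ x ∣) x (shrink x)
shrink-witnessed x changed with shrink x | outcome x
... | _ | unchanged _    = contradiction refl changed
... | _ | shrunk _ _     = induced-step (graph x) (parameter x) (Reduction.kept-unique (graph x))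
... | _ | refused _ many = refused-step x many

chain-witnessed : ∀ x d → AllSteps (StepWitnessed 1 (⟦ soundnessPolynomial ⟧ ∣Φ x ∣)) (settle-chain x d)
chain-witnessed x (yes _) = tt
chain-witnessed x (no ¬p) = shrink-witnessed x ¬p , tt

theorem4 : (Σ[ K ∈ Kernelization ]
    ((x : Instance) → 1 ≤ parameter x →
    order (Kernelization.kernel K x) ≤ 2 ^ parameter x)
    × (∃[ C ] ((x : Instance) → 1 ≤ parameter x → 1 ≤ order x →
    AtMostLog (chainLength (Kernelization.chain K x)) C (2 ^ parameter x ∸ 1) (order x)))
    × SoundnessWitnessed K)
    × ((k : ℕ) →
    (Σ[ p ∈ Polynomial ] (∀ {n} (G : Graph n) → ¬ EdgeCliqueCover G k →
    ∃[ s ] (ExtendedFregeRefutation (Φ G k) s × s ≤ ⟦ p ⟧ (length (Φ G k)))))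
    × (∃[ f ] (Quasipolynomial f × (∀ {n} (G : Graph n) → ¬ EdgeCliqueCover G k →
    ∃[ s ] (FregeRefutation (Φ G k) s × s ≤ f (length (Φ G k)))))))
theorem4 =
  (kernelization , kernel-order ,
   (1 , λ x 1≤k 1≤n → chain-length x 1≤k 1≤n (settled? x)) ,
   (1 , ≤-refl , soundnessPolynomial , λ x _ → chain-witnessed x (settled? x))) ,
  fixed-parameter
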